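{- Let $L/K$ be a finite extension, let $L_S/K$ be its maximal separable subextension, let $L_I/K$ be its maximal purely inseparable subextension, and let $i_K(L)=[L_I:K]$. Let $F'/K$ be the maximal normal subextension of $L/K$ and $F/K$ the largest Galois subextension of $L/K$. Then (1) $F'=FL_I$ and $a_K(L)=t_K(L)\cdot i_K(L)$. (2) $a_K(L)\cdot u_K(L)=[L_SL_I:K]$. (3) $L/K$ is normal if and only if $a_K(L)=[L:K]$.
   Context: $K$ is any field (not necessarily perfect) with a fixed algebraic closure $\bar K$; all extensions are finite and contained in $\bar K$. The ascending index of $L/K$ is $t_K(L)=[F:K]$, and $u_K(L)=[L_S:F]$ (note $F\subset L_S$). The ascending normal index is $a_K(L)=[F':K]$, where $F'/K$ is the normal subextension of $L/K$ of maximum possible degree. -}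

module Defs where

open import Algebra.Apartness.Bundles using (HeytingField)
open import Algebra.Bundles.Raw using (RawRing; RawSemiring)
import Algebra.Definitions.RawSemiring as RawSemiringDefs
open import Axiom.ExcludedMiddle using (ExcludedMiddle)
open import Data.Fin.Base using (Fin)
open import Data.List.Base using (List; []; _∷_; foldr; map)
open import Data.List.Relation.Unary.All using (All)
open import Data.Nat.Base as ℕ using (ℕ; zero; suc)
open import Data.Nat.Primality using (Prime)
open import Data.Product.Base using (Σ; ∃; ∃-syntax; _×_; _,_; proj₁)
open import Level using (Level; _⊔_) renaming (suc to lsuc)
open import Relation.Nullary.Decidable.Core using (yes; no)
open import Relation.Nullary.Negation.Core using (¬_)
open import Relation.Unary using (Pred; _∈_; _⊆_; _≐_; _∪_)

-- Univariate polynomials as coefficient lists, constant term first.  Trailing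
-- zeros are allowed, so equality is equality of all coefficients.

module Polynomials {c ℓ : Level} (R : RawRing c ℓ) where

  open RawRing R

  Poly : Set c
  Poly = List Carrier

  coeff : Poly → ℕ → Carrier
  coeff []      _       = 0#
  coeff (a ∷ _) zero    = a
  coeff (_ ∷ f) (suc n) = coeff f n

  infix 4 _≈ₚ_
  _≈ₚ_ : Poly → Poly → Set ℓ
  f ≈ₚ g = ∀ n → coeff f n ≈ coeff g n

  infixl 6 _+ₚ_
  _+ₚ_ : Poly → Poly → Poly
  []      +ₚ g       = g
  (a ∷ f) +ₚ []      = a ∷ f
  (a ∷ f) +ₚ (b ∷ g) = a + b ∷ f +ₚ g

  infixl 7 _*ₚ_
  _*ₚ_ : Poly → Poly → Poly
  []      *ₚ g = []
  (a ∷ f) *ₚ g = map (a *_) g +ₚ (0# ∷ f *ₚ g)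

  polynomials : RawSemiring c ℓ
  polynomials = record
    { Carrier = Poly ; _≈_ = _≈ₚ_ ; _+_ = _+ₚ_ ; _*_ = _*ₚ_
    ; 0# = [] ; 1# = 1# ∷ [] }

  open RawSemiringDefs polynomials public using (Irreducible; _∣_; _∤_)

  Monic : Poly → Set ℓ
  Monic f = ∃[ n ] (coeff f n ≈ 1#) × (∀ m → n ℕ.< m → coeff f m ≈ 0#)

  NonZero : Poly → Set ℓ
  NonZero f = ∃[ n ] ¬ (coeff f n ≈ 0#)

  NonConstant : Poly → Set ℓ
  NonConstant f = ∃[ n ] ¬ (coeff f (suc n) ≈ 0#)

  eval : Poly → Carrier → Carrier
  eval f x = foldr (λ a v → a + x * v) 0# f

  X-_ : Carrier → Poly
  X- a = (- a) ∷ 1# ∷ []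

  ∏X- : List Carrier → Poly
  ∏X- = foldr (λ a f → (X- a) *ₚ f) (1# ∷ [])

-- All fields live inside a fixed ambient field.  Classically a Heyting field
-- is just a field: by tightness x # y is equivalent to ¬ (x ≈ y).

module FieldTheory {c ℓ₁ ℓ₂ : Level} (K̄ : HeytingField c ℓ₁ ℓ₂) where

  open HeytingField K̄ using (Carrier; _≈_; _+_; _*_; -_; 0#; 1#)

  private
    v : Level
    v = c ⊔ ℓ₁ ⊔ ℓ₂

  rawRing : RawRing c ℓ₁
  rawRing = record
    { Carrier = Carrier ; _≈_ = _≈_ ; _+_ = _+_ ; _*_ = _*_ ; -_ = -_
    ; 0# = 0# ; 1# = 1# }

  open RawSemiringDefs (RawRing.rawSemiring rawRing)
    using (_^_; sum) renaming (_×_ to _·_)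

  module K̄[X] = Polynomials rawRing

  record Subfield : Set (lsuc v) where
    field
      member   : Pred Carrier v
      ≈-closed : ∀ {x y} → x ≈ y → x ∈ member → y ∈ member
      0-closed : 0# ∈ member
      1-closed : 1# ∈ member
      +-closed : ∀ {x y} → x ∈ member → y ∈ member → x + y ∈ member
      *-closed : ∀ {x y} → x ∈ member → y ∈ member → x * y ∈ member
      neg-closed : ∀ {x} → x ∈ member → - x ∈ member
      inv-closed : ∀ {x y} → x * y ≈ 1# → x ∈ member → y ∈ member

  open Subfield using (member)

  infix 4 _∈ₛ_ _⊑_ _≋_

  _∈ₛ_ : Carrier → Subfield → Set v
  x ∈ₛ E = x ∈ member E

  _⊑_ : Subfield → Subfield → Set v
  E ⊑ M = member E ⊆ member M

  _≋_ : Subfield → Subfield → Set v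
  E ≋ M = member E ≐ member M

  data Generated (S : Pred Carrier v) : Pred Carrier v where
    gen  : ∀ {x} → x ∈ S → Generated S x
    resp : ∀ {x y} → x ≈ y → Generated S x → Generated S y
    zro  : Generated S 0#
    one  : Generated S 1#
    add  : ∀ {x y} → Generated S x → Generated S y → Generated S (x + y)
    mul  : ∀ {x y} → Generated S x → Generated S y → Generated S (x * y)
    neg  : ∀ {x} → Generated S x → Generated S (- x)
    inv  : ∀ {x y} → x * y ≈ 1# → Generated S x → Generated S y

  infixl 7 _∙_
  _∙_ : Subfield → Subfield → Subfield
  E ∙ M = record
    { member = Generated (member E ∪ member M)
    ; ≈-closed = resp ; 0-closed = zro ; 1-closed = one ; +-closed = add
    ; *-closed = mul ; neg-closed = neg ; inv-closed = inv }

  module _ (E : Subfield) where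

    private module E = Subfield E

    subfieldRing : RawRing v ℓ₁
    subfieldRing = record
      { Carrier = Σ Carrier E.member
      ; _≈_ = λ (x , _) (y , _) → x ≈ y
      ; _+_ = λ (x , p) (y , q) → x + y , E.+-closed p q
      ; _*_ = λ (x , p) (y , q) → x * y , E.*-closed p q
      ; -_  = λ (x , p) → - x , E.neg-closed p
      ; 0# = 0# , E.0-closed ; 1# = 1# , E.1-closed }

    module Over = Polynomials subfieldRing

  _[X] : Subfield → Set v
  E [X] = Over.Poly E

  embed : (E : Subfield) → E [X] → K̄[X].Poly
  embed _ = map proj₁

  IsRootOf : (E : Subfield) → Carrier → E [X] → Set ℓ₁
  IsRootOf E α f = K̄[X].eval (embed E f) α ≈ 0#

  AlgebraicOver : Subfield → Carrier → Set v
  AlgebraicOver E α = ∃[ f ] Over.NonZero E f × IsRootOf E α f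

  IsAlgebraicClosureOf : Subfield → Set v
  IsAlgebraicClosureOf K =
    (∀ f → K̄[X].NonConstant f → ∃[ α ] K̄[X].eval f α ≈ 0#) ×
    (∀ α → AlgebraicOver K α)

  IsMinimalPolynomial : (E : Subfield) → E [X] → Carrier → Set v
  IsMinimalPolynomial E f α =
    Over.Monic E f × Over.Irreducible E f × IsRootOf E α f

  NoMultipleRoots : K̄[X].Poly → Set (c ⊔ ℓ₁)
  NoMultipleRoots f = ∀ β → ((X- β) *ₚ (X- β)) ∤ f
    where open K̄[X]

  SeparableOver : Subfield → Carrier → Set v
  SeparableOver E α =
    ∃[ f ] IsMinimalPolynomial E f α × NoMultipleRoots (embed E f)

  SplitsIn : Subfield → K̄[X].Poly → Set v
  SplitsIn M f = ∃[ a ] ∃[ αs ]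
    a ∈ₛ M × All (_∈ₛ M) αs × f K̄[X].≈ₚ (a ∷ []) K̄[X].*ₚ K̄[X].∏X- αs

  data IsCharacteristicExponent : ℕ → Set ℓ₁ where
    char-0 : (∀ n → ¬ (suc n · 1# ≈ 0#)) → IsCharacteristicExponent 1
    char-p : ∀ {p} → Prime p → p · 1# ≈ 0# → IsCharacteristicExponent p

  -- Properties of an extension M/E inside an algebraic closure of the base
  -- field; every such extension is algebraic, so the properties do not repeat
  -- that requirement.

  Separable : Subfield → Subfield → Set v
  Separable E M = ∀ {α} → α ∈ₛ M → SeparableOver E α

  PurelyInseparable : Subfield → Subfield → Set v
  PurelyInseparable E M =
    ∀ {p} → IsCharacteristicExponent p →
    ∀ {α} → α ∈ₛ M → ∃[ n ] α ^ (p ℕ.^ n) ∈ₛ E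

  Normal : Subfield → Subfield → Set v
  Normal E M =
    ∀ f → Over.Irreducible E f →
    ∀ {α} → α ∈ₛ M → IsRootOf E α f → SplitsIn M (embed E f)

  Galois : Subfield → Subfield → Set v
  Galois E M = Normal E M × Separable E M

  IsSubextension : (K L E : Subfield) → Set v
  IsSubextension K L E = K ⊑ E × E ⊑ L

  record IsLargest (P : Subfield → Subfield → Set v) (K L E : Subfield)
                   : Set (lsuc v) where
    field
      subextension : IsSubextension K L E
      property     : P K E
      largest      : ∀ M → IsSubextension K L M → P K M → M ⊑ E

  record IsBasis (K L : Subfield) {n : ℕ} (b : Fin n → Carrier) : Set v where
    field
      inside      : ∀ j → b j ∈ₛ L
      spanning    : ∀ {x} → x ∈ₛ L → Σ (Fin n → Carrier) λ k →
                    (∀ j → k j ∈ₛ K) × x ≈ sum (λ j → k j * b j)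
      independent : (k : Fin n → Carrier) → (∀ j → k j ∈ₛ K) →
                    sum (λ j → k j * b j) ≈ 0# → ∀ j → k j ≈ 0#

  HasDegree : Subfield → Subfield → ℕ → Set v
  HasDegree K L n = Σ (Fin n → Carrier) λ b → IsBasis K L b

  IsFiniteExtension : Subfield → Subfield → Set v
  IsFiniteExtension K L = K ⊑ L × ∃ (HasDegree K L)

  module Degree (em : ∀ {a} → ExcludedMiddle a) where

    -- The size of a basis, and 0 if there is no finite basis.
    [_∶_] : Subfield → Subfield → ℕ
    [ L ∶ K ] with em {P = ∃ (HasDegree K L)}
    ... | yes (n , _) = n
    ... | no  _       = 0

    record IsNormalOfMaximumDegree (K L E : Subfield) : Set (lsuc v) where
      field
        subextension : IsSubextension K L E
        normal       : Normal K E
        maximum      : ∀ M → IsSubextension K L M → Normal K M →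
                       [ M ∶ K ] ℕ.≤ [ E ∶ K ]

-- Let φₙ be x ↦ x^(pⁿ), with p the characteristic exponent.  Everything rests on a descent: if φₙ α ∈ E and α is
-- a root of a polynomial over E without multiple roots, then α ∈ E, because the minimal polynomial of α divides
-- both that polynomial and X^(pⁿ) − φₙ α, whose only root is α.
--
-- For M/K finite the K-spans of φₙ(M) form a decreasing chain of fields, so they stabilise at a field S.  Linear
-- independence survives φ₁ when the p-th powers span, which makes S/K separable (an inseparable minimal polynomial
-- is a polynomial in X^p), and by descent S/K is normal when M/K is.  So for M = F' some φₙ maps F' into S ⊑ F.
-- The minimal polynomial of φₙ α is then ∏ (X − φₙ αⱼ) with αⱼ ∈ F', the coefficients of h = ∏ (X − αⱼ) are purely
-- inseparable, and descent applied to h gives α ∈ F Lᵢ.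
--
-- Conversely F Lᵢ is normal: if γ is a conjugate of α ∈ F Lᵢ over K, then γ is a root of the minimal polynomial of α
-- over Lᵢ, which has no multiple roots, and φₙ γ ∈ F; descent gives γ ∈ F Lᵢ.  No embeddings are needed.  Maximality
-- of F' forces F' = F Lᵢ, and the degrees follow since a basis of a separable E/K stays a basis of E Lᵢ over Lᵢ.

module Submission where

open import Defs
open import Algebra.Apartness.Bundles using (HeytingCommutativeRing; HeytingField)
import Algebra.Apartness.Properties.HeytingCommutativeRing
open import Algebra.Bundles using (CommutativeRing)
open import Algebra.Bundles.Raw using (RawRing; RawSemiring)
import Algebra.Definitions.RawMagma as RawMagma
import Algebra.Definitions.RawSemiring as RawSemiringDefs
import Algebra.Properties.AbelianGroup
import Algebra.Properties.CommutativeSemiring.Binomial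
import Algebra.Properties.CommutativeSemiring.Exp
import Algebra.Properties.Ring
import Algebra.Properties.Semiring.Exp
import Algebra.Properties.Semiring.Mult
import Algebra.Properties.Semiring.Sum
import Algebra.Solver.Ring
open import Algebra.Solver.Ring.AlmostCommutativeRing using (fromCommutativeRing; _-Raw-AlmostCommutative⟶_)
open import Axiom.ExcludedMiddle using (ExcludedMiddle)
open import Data.Empty using (⊥; ⊥-elim)
open import Data.Fin.Base using (Fin; zero; suc; toℕ; fromℕ; inject₁)
import Data.Fin.Properties as Fin
import Data.Integer.Base as ℤ
import Data.Integer.Properties as ℤ
open import Data.List.Base using (List; []; _∷_; _∷ʳ_; _++_; length; lookup; map; replicate; tabulate; take)
open import Data.List.Properties using (length-++; length-map; length-tabulate; length-take; map-++; tabulate-lookup)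
open import Data.List.Relation.Unary.All as All using (All; []; _∷_)
import Data.List.Relation.Unary.All.Properties as All
open import Data.Maybe.Base as Maybe using (Maybe)
open import Data.Nat.Base as ℕ using (ℕ; zero; suc; _∸_; _!; _≤_; _<_; z≤n; s≤s)
open import Data.Nat.Combinatorics using (_C_; nCk≡n!/k![n-k]!; nCn≡1; k![n∸k]!∣n!)
open import Data.Nat.Coprimality using (Coprime; coprime-Bézout)
open import Data.Nat.DivMod using (m/n*n≡m)
open import Data.Nat.Divisibility using (_∣_; divides; _∣?_; ∣⇒≤; ∣1⇒≡1; m∣m*n)
open import Data.Nat.Divisibility.Core using (hasNonTrivialDivisor)
open import Data.Nat.GCD using (module Bézout)
open import Data.Nat.Induction using (<-rec)
open import Data.Nat.Primality using (Prime; Composite; euclidsLemma; prime⇒irreducible; prime⇒nonTrivial; prime⇒nonZero; ¬composite⇒prime)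
import Data.Nat.Properties as ℕ
open import Data.Product.Base using (Σ; ∃; ∃-syntax; _×_; _,_; proj₁; proj₂)
import Data.Sign.Base as Sign
open import Data.Sum.Base using (_⊎_; inj₁; inj₂; [_,_]′)
open import Function.Base using (_∘_; id)
open import Function.Bundles using (_⇔_; mk⇔)
open import Level using (Level; _⊔_)
open import Relation.Binary.PropositionalEquality as ≡ using (_≡_; _≢_)
import Relation.Binary.Reasoning.Setoid
open import Relation.Nullary.Decidable.Core using (yes; no; dec⇒maybe; decidable-stable)
open import Relation.Nullary.Negation.Core using (¬_; contradiction)

-- Two steps need separability of a whole field: S over K, and F Lᵢ over Lᵢ. Closure properties of
-- separable elements would call for embeddings or primitive elements, so separability is read off
-- from spans instead: if the p-th powers of a finite extension M/E span M over E, every element of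
-- M has a minimal polynomial over E without multiple roots (MacLane's criterion). One proof of it
-- serves both steps.
--
-- Conjugates are handled by evaluation: a polynomial over K that vanishes at α vanishes at each
-- conjugate γ, and applying this to g(X^(pⁿ)) reaches φₙ γ.
--
-- Multiple roots are always tested in K̄[X], so their absence passes to divisors over larger fields
-- and back along φₙ. The characteristic exponent is 1 in characteristic 0, where φₙ is the
-- identity; beyond the basic facts about p, only the derivative argument splits by characteristic.

-- Integer coefficients for the ring solver

module IntegerCoefficients {c ℓ : Level} (R : CommutativeRing c ℓ) where

  open import Data.Integer.Base using (ℤ; +_; -[1+_]; _⊖_; _◃_)
  open CommutativeRing R
  open Algebra.Properties.Ring ring
  open Algebra.Properties.AbelianGroup +-abelianGroup using (⁻¹-∙-comm)
  open Algebra.Properties.Semiring.Mult semiring renaming (_×_ to _·_)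
  open Relation.Binary.Reasoning.Setoid setoid

  ⟦_⟧ℤ : ℤ → Carrier
  ⟦ + n ⟧ℤ      = n · 1#
  ⟦ -[1+ n ] ⟧ℤ = - (suc n · 1#)

  ⊖-homo : ∀ m n → ⟦ m ⊖ n ⟧ℤ ≈ m · 1# + - (n · 1#)
  ⊖-homo m zero = begin
    m · 1#          ≈⟨ +-identityʳ _ ⟨
    m · 1# + 0#     ≈⟨ +-congˡ -0#≈0# ⟨
    m · 1# + - 0#   ∎
  ⊖-homo zero (suc n) = sym (+-identityˡ _)
  ⊖-homo (suc m) (suc n) = begin
    ⟦ suc m ⊖ suc n ⟧ℤ                      ≡⟨ ≡.cong ⟦_⟧ℤ (ℤ.[1+m]⊖[1+n]≡m⊖n m n) ⟩
    ⟦ m ⊖ n ⟧ℤ                              ≈⟨ ⊖-homo m n ⟩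
    m · 1# + - (n · 1#)                     ≈⟨ +-congˡ (+-identityˡ _) ⟨
    m · 1# + (0# + - (n · 1#))              ≈⟨ +-congˡ (+-congʳ (-‿inverseʳ 1#)) ⟨
    m · 1# + ((1# + - 1#) + - (n · 1#))     ≈⟨ +-congˡ (+-assoc _ _ _) ⟩
    m · 1# + (1# + (- 1# + - (n · 1#)))     ≈⟨ +-assoc _ _ _ ⟨
    (m · 1# + 1#) + (- 1# + - (n · 1#))     ≈⟨ +-cong (+-comm _ _) (⁻¹-∙-comm _ _) ⟩
    suc m · 1# + - (suc n · 1#)             ∎

  ⟦⟧-+-homo : ∀ i j → ⟦ i ℤ.+ j ⟧ℤ ≈ ⟦ i ⟧ℤ + ⟦ j ⟧ℤ
  ⟦⟧-+-homo (+ m)    (+ n)    = ×-homo-+ 1# m n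
  ⟦⟧-+-homo (+ m)    -[1+ n ] = ⊖-homo m (suc n)
  ⟦⟧-+-homo -[1+ m ] (+ n)    = trans (⊖-homo n (suc m)) (+-comm _ _)
  ⟦⟧-+-homo -[1+ m ] -[1+ n ] = begin
    - (suc (suc (m ℕ.+ n)) · 1#)            ≈⟨ -‿cong (+-congˡ (×-homo-+ 1# (suc m) n)) ⟩
    - (1# + (suc m · 1# + n · 1#))          ≈⟨ -‿cong (+-assoc _ _ _) ⟨
    - ((1# + suc m · 1#) + n · 1#)          ≈⟨ -‿cong (+-congʳ (+-comm _ _)) ⟩
    - ((suc m · 1# + 1#) + n · 1#)          ≈⟨ -‿cong (+-assoc _ _ _) ⟩
    - (suc m · 1# + suc n · 1#)             ≈⟨ ⁻¹-∙-comm _ _ ⟨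
    - (suc m · 1#) + - (suc n · 1#)         ∎

  ⁻◃-homo : ∀ n → ⟦ Sign.- ◃ n ⟧ℤ ≈ - (n · 1#)
  ⁻◃-homo zero    = sym -0#≈0#
  ⁻◃-homo (suc n) = refl

  ⁺◃-homo : ∀ n → ⟦ Sign.+ ◃ n ⟧ℤ ≈ n · 1#
  ⁺◃-homo zero    = refl
  ⁺◃-homo (suc n) = refl

  ⟦⟧-*-homo : ∀ i j → ⟦ i ℤ.* j ⟧ℤ ≈ ⟦ i ⟧ℤ * ⟦ j ⟧ℤ
  ⟦⟧-*-homo (+ m)    (+ n)    = trans (⁺◃-homo (m ℕ.* n)) (×1-homo-* m n)
  ⟦⟧-*-homo (+ m)    -[1+ n ] = begin
    ⟦ Sign.- ◃ m ℕ.* suc n ⟧ℤ               ≈⟨ ⁻◃-homo (m ℕ.* suc n) ⟩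
    - ((m ℕ.* suc n) · 1#)                  ≈⟨ -‿cong (×1-homo-* m (suc n)) ⟩
    - ((m · 1#) * (suc n · 1#))             ≈⟨ -‿distribʳ-* _ _ ⟩
    (m · 1#) * - (suc n · 1#)               ∎
  ⟦⟧-*-homo -[1+ m ] (+ n)    = begin
    ⟦ Sign.- ◃ suc m ℕ.* n ⟧ℤ               ≈⟨ ⁻◃-homo (suc m ℕ.* n) ⟩
    - ((suc m ℕ.* n) · 1#)                  ≈⟨ -‿cong (×1-homo-* (suc m) n) ⟩
    - ((suc m · 1#) * (n · 1#))             ≈⟨ -‿distribˡ-* _ _ ⟩
    - (suc m · 1#) * (n · 1#)               ∎
  ⟦⟧-*-homo -[1+ m ] -[1+ n ] = begin
    (suc m ℕ.* suc n) · 1#                  ≈⟨ ×1-homo-* (suc m) (suc n) ⟩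
    (suc m · 1#) * (suc n · 1#)             ≈⟨ -‿involutive _ ⟨
    - - ((suc m · 1#) * (suc n · 1#))       ≈⟨ -‿cong (-‿distribˡ-* _ _) ⟩
    - (- (suc m · 1#) * (suc n · 1#))       ≈⟨ -‿distribʳ-* _ _ ⟩
    - (suc m · 1#) * - (suc n · 1#)         ∎

  ⟦⟧-neg-homo : ∀ i → ⟦ ℤ.- i ⟧ℤ ≈ - ⟦ i ⟧ℤ
  ⟦⟧-neg-homo (+ zero)  = sym -0#≈0#
  ⟦⟧-neg-homo (+ suc n) = refl
  ⟦⟧-neg-homo -[1+ n ]  = sym (-‿involutive _)

  homomorphism : ℤ.+-*-rawRing -Raw-AlmostCommutative⟶ fromCommutativeRing R
  homomorphism = record
    { ⟦_⟧ = ⟦_⟧ℤ ; +-homo = ⟦⟧-+-homo ; *-homo = ⟦⟧-*-homo ; -‿homo = ⟦⟧-neg-homo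
    ; 0-homo = refl ; 1-homo = +-identityʳ 1# }

  -- In positive characteristic distinct integers may have equal images, so a negative answer about
  -- integers says nothing; the solver asks for positive ones only.
  _≟ᶜ_ : ∀ i j → Maybe (⟦ i ⟧ℤ ≈ ⟦ j ⟧ℤ)
  i ≟ᶜ j = Maybe.map (λ i≡j → reflexive (≡.cong ⟦_⟧ℤ i≡j)) (dec⇒maybe (i ℤ.≟ j))

  module Solver = Algebra.Solver.Ring ℤ.+-*-rawRing (fromCommutativeRing R) homomorphism _≟ᶜ_

-- Divisibility identities in a commutative ring, later applied to K̄[X]

module Cofactors {c ℓ : Level} (R : CommutativeRing c ℓ) where

  open CommutativeRing R
  open Algebra.Properties.Ring ring
  open Relation.Binary.Reasoning.Setoid setoid

  1-x≈0 : ∀ x → 1# + - x ≈ 0# → x ≈ 1#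
  1-x≈0 x eq = sym (x∙y⁻¹≈ε⇒x≈y 1# x eq)

  -- Prepares cancellation of f in a domain: the second factor must vanish, which makes s and r
  -- inverse to each other.
  cofactor-difference : ∀ f s r → f ≈ (s * f) * r → f * (1# + - (s * r)) ≈ 0#
  cofactor-difference f s r eq = begin
    f * (1# + - (s * r))            ≈⟨ distribˡ f 1# _ ⟩
    f * 1# + f * - (s * r)          ≈⟨ +-cong (*-identityʳ f) (sym (-‿distribʳ-* f (s * r))) ⟩
    f + - (f * (s * r))             ≈⟨ +-congʳ eq ⟩
    (s * f) * r + - (f * (s * r))   ≈⟨ +-congʳ (trans (*-congʳ (*-comm s f)) (*-assoc f s r)) ⟩
    f * (s * r) + - (f * (s * r))   ≈⟨ -‿inverseʳ _ ⟩
    0#                              ∎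

  unit-cofactor : ∀ {f g} t s → t * s ≈ 1# → f ≈ s * g → g ≈ t * f
  unit-cofactor {f} {g} t s ts≈1 f≈sg = begin
    g            ≈⟨ *-identityˡ g ⟨
    1# * g       ≈⟨ *-congʳ ts≈1 ⟨
    (t * s) * g  ≈⟨ *-assoc t s g ⟩
    t * (s * g)  ≈⟨ *-congˡ f≈sg ⟨
    t * f        ∎

  square-factor : ∀ {f g} a r → f ≈ a * g → g ≈ a * r → r * (a * a) ≈ f
  square-factor {f} {g} a r f≈ag g≈ar = begin
    r * (a * a)  ≈⟨ *-comm r _ ⟩
    (a * a) * r  ≈⟨ *-assoc a a r ⟩
    a * (a * r)  ≈⟨ *-congˡ g≈ar ⟨
    a * g        ≈⟨ f≈ag ⟨
    f            ∎

-- Coefficient lists as a commutative ring, and evaluation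

module PolynomialRing {c ℓ : Level} (R : CommutativeRing c ℓ) where

  open CommutativeRing R
  open Polynomials rawRing
  open Algebra.Properties.Ring ring using (-0#≈0#)
  open IntegerCoefficients R using (module Solver)
  open Solver using (solve; _:=_; _:+_; _:*_; :-_)

  -- The pointwise equality _≈ₚ_ unfolds and loses its endpoints; the record keeps them inferable.
  infix 4 _≗_
  record _≗_ (f g : Poly) : Set ℓ where
    constructor ⟨_⟩
    field coeffs : f ≈ₚ g
  open _≗_ public

  private
    variable
      f f′ g g′ h : Poly
      a b : Carrier

  scale : Carrier → Poly → Poly
  scale a = map (a *_)

  negate : Poly → Poly
  negate = map (λ a → - a)

  coeff-+ₚ : ∀ f g n → coeff (f +ₚ g) n ≈ coeff f n + coeff g n
  coeff-+ₚ []      g       n       = sym (+-identityˡ _)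
  coeff-+ₚ (a ∷ f) []      n       = sym (+-identityʳ _)
  coeff-+ₚ (a ∷ f) (b ∷ g) zero    = refl
  coeff-+ₚ (a ∷ f) (b ∷ g) (suc n) = coeff-+ₚ f g n

  coeff-scale : ∀ a f n → coeff (scale a f) n ≈ a * coeff f n
  coeff-scale a []      n       = sym (zeroʳ a)
  coeff-scale a (b ∷ f) zero    = refl
  coeff-scale a (b ∷ f) (suc n) = coeff-scale a f n

  coeff-negate : ∀ f n → coeff (negate f) n ≈ - coeff f n
  coeff-negate []      n       = sym -0#≈0#
  coeff-negate (a ∷ f) zero    = refl
  coeff-negate (a ∷ f) (suc n) = coeff-negate f n

  ≗-refl : f ≗ f
  ≗-refl = ⟨ (λ n → refl) ⟩

  ≗-sym : f ≗ g → g ≗ f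
  ≗-sym f≗g = ⟨ (λ n → sym (coeffs f≗g n)) ⟩

  ≗-trans : f ≗ g → g ≗ h → f ≗ h
  ≗-trans f≗g g≗h = ⟨ (λ n → trans (coeffs f≗g n) (coeffs g≗h n)) ⟩

  ∷-cong : a ≈ b → f ≗ g → a ∷ f ≗ b ∷ g
  ∷-cong a≈b f≗g = ⟨ (λ { zero → a≈b ; (suc n) → coeffs f≗g n }) ⟩

  tail-cong : a ∷ f ≗ b ∷ g → f ≗ g
  tail-cong af≗bg = ⟨ (λ n → coeffs af≗bg (suc n)) ⟩

  ∷-≗[] : a ≈ 0# → f ≗ [] → a ∷ f ≗ []
  ∷-≗[] a≈0 f≗[] = ⟨ (λ { zero → a≈0 ; (suc n) → coeffs f≗[] n }) ⟩

  tail-≗[] : a ∷ f ≗ [] → f ≗ []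
  tail-≗[] af≗[] = ⟨ (λ n → coeffs af≗[] (suc n)) ⟩

  module _ where
    private
      via : ∀ {x y : ℕ → Carrier} → (∀ n → coeff f n ≈ x n) → (∀ n → coeff g n ≈ y n) →
            (∀ n → x n ≈ y n) → f ≗ g
      via p q r = ⟨ (λ n → trans (p n) (trans (r n) (sym (q n)))) ⟩

    +ₚ-cong : f ≗ f′ → g ≗ g′ → f +ₚ g ≗ f′ +ₚ g′
    +ₚ-cong {f} {f′} {g} {g′} p q =
      via (coeff-+ₚ f g) (coeff-+ₚ f′ g′) (λ n → +-cong (coeffs p n) (coeffs q n))

    +ₚ-congˡ : ∀ f → g ≗ g′ → f +ₚ g ≗ f +ₚ g′
    +ₚ-congˡ f = +ₚ-cong (≗-refl {f})

    +ₚ-congʳ : ∀ g → f ≗ f′ → f +ₚ g ≗ f′ +ₚ g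
    +ₚ-congʳ g p = +ₚ-cong p (≗-refl {g})

    +ₚ-comm : ∀ f g → f +ₚ g ≗ g +ₚ f
    +ₚ-comm f g = via (coeff-+ₚ f g) (coeff-+ₚ g f) (λ n → +-comm _ _)

    +ₚ-assoc : ∀ f g h → (f +ₚ g) +ₚ h ≗ f +ₚ (g +ₚ h)
    +ₚ-assoc f g h = via
      (λ n → trans (coeff-+ₚ (f +ₚ g) h n) (+-congʳ (coeff-+ₚ f g n)))
      (λ n → trans (coeff-+ₚ f (g +ₚ h) n) (+-congˡ (coeff-+ₚ g h n)))
      (λ n → +-assoc _ _ _)

    +ₚ-identityʳ : ∀ f → f +ₚ [] ≗ f
    +ₚ-identityʳ f = ⟨ (λ n → trans (coeff-+ₚ f [] n) (+-identityʳ _)) ⟩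

    +ₚ-inverseʳ : ∀ f → f +ₚ negate f ≗ []
    +ₚ-inverseʳ f = ⟨ (λ n → trans (coeff-+ₚ f (negate f) n)
                        (trans (+-congˡ (coeff-negate f n)) (-‿inverseʳ _))) ⟩

    negate-cong : f ≗ g → negate f ≗ negate g
    negate-cong {f} {g} p = via (coeff-negate f) (coeff-negate g) (λ n → -‿cong (coeffs p n))

    scale-cong : a ≈ b → f ≗ g → scale a f ≗ scale b g
    scale-cong {a} {b} {f} {g} p q =
      via (coeff-scale a f) (coeff-scale b g) (λ n → *-cong p (coeffs q n))

    scale-+ₚ : ∀ a f g → scale a (f +ₚ g) ≗ scale a f +ₚ scale a g
    scale-+ₚ a f g = via
      (λ n → trans (coeff-scale a (f +ₚ g) n) (*-congˡ (coeff-+ₚ f g n)))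
      (λ n → trans (coeff-+ₚ (scale a f) (scale a g) n) (+-cong (coeff-scale a f n) (coeff-scale a g n)))
      (λ n → distribˡ _ _ _)

    scale-scale : ∀ a b f → scale a (scale b f) ≗ scale (a * b) f
    scale-scale a b f = via
      (λ n → trans (coeff-scale a (scale b f) n) (*-congˡ (coeff-scale b f n)))
      (coeff-scale (a * b) f) (λ n → sym (*-assoc _ _ _))

    scale-1 : ∀ f → scale 1# f ≗ f
    scale-1 f = ⟨ (λ n → trans (coeff-scale 1# f n) (*-identityˡ _)) ⟩

    scale-0 : a ≈ 0# → ∀ f → scale a f ≗ []
    scale-0 a≈0 f = ⟨ (λ n → trans (coeff-scale _ f n) (trans (*-congʳ a≈0) (zeroˡ _))) ⟩

  shift-+ₚ : ∀ f g → 0# ∷ (f +ₚ g) ≗ (0# ∷ f) +ₚ (0# ∷ g)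
  shift-+ₚ f g = ∷-cong (sym (+-identityˡ 0#)) ≗-refl

  +ₚ-interchange : ∀ f g h k → (f +ₚ g) +ₚ (h +ₚ k) ≗ (f +ₚ h) +ₚ (g +ₚ k)
  +ₚ-interchange f g h k =
    ≗-trans (+ₚ-assoc f g (h +ₚ k)) (≗-trans (+ₚ-cong (≗-refl {f})
      (≗-trans (≗-sym (+ₚ-assoc g h k)) (≗-trans (+ₚ-cong (+ₚ-comm g h) (≗-refl {k})) (+ₚ-assoc h g k))))
      (≗-sym (+ₚ-assoc f h (g +ₚ k))))

  *ₚ-congˡ : ∀ f → g ≗ g′ → f *ₚ g ≗ f *ₚ g′
  *ₚ-congˡ []      p = ≗-refl
  *ₚ-congˡ (a ∷ f) p = +ₚ-cong (scale-cong refl p) (∷-cong refl (*ₚ-congˡ f p))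

  *ₚ-zeroʳ : ∀ f → f *ₚ [] ≗ []
  *ₚ-zeroʳ []      = ≗-refl
  *ₚ-zeroʳ (a ∷ f) = ∷-≗[] refl (*ₚ-zeroʳ f)

  -- `_*ₚ_` recurses on its first factor; this supplies the recursion on the second, and
  -- commutativity follows by comparing the two.
  *ₚ-∷ : ∀ f b g → f *ₚ (b ∷ g) ≗ scale b f +ₚ (0# ∷ f *ₚ g)
  *ₚ-∷ []      b g = ≗-sym (∷-≗[] refl ≗-refl)
  *ₚ-∷ (a ∷ f) b g = ∷-cong (+-congʳ (*-comm a b))
    (≗-trans (+ₚ-cong (≗-refl {scale a g}) (*ₚ-∷ f b g))
    (≗-trans (≗-sym (+ₚ-assoc (scale a g) (scale b f) _))
    (≗-trans (+ₚ-cong (+ₚ-comm (scale a g) (scale b f)) ≗-refl)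
             (+ₚ-assoc (scale b f) (scale a g) _))))

  *ₚ-comm : ∀ f g → f *ₚ g ≗ g *ₚ f
  *ₚ-comm f []      = *ₚ-zeroʳ f
  *ₚ-comm f (b ∷ g) = ≗-trans (*ₚ-∷ f b g) (+ₚ-cong ≗-refl (∷-cong refl (*ₚ-comm f g)))

  *ₚ-congʳ : f ≗ f′ → ∀ g → f *ₚ g ≗ f′ *ₚ g
  *ₚ-congʳ {f} {f′} p g = ≗-trans (*ₚ-comm f g) (≗-trans (*ₚ-congˡ g p) (*ₚ-comm g f′))

  *ₚ-distribˡ : ∀ f g h → f *ₚ (g +ₚ h) ≗ (f *ₚ g) +ₚ (f *ₚ h)
  *ₚ-distribˡ []      g h = ≗-refl
  *ₚ-distribˡ (a ∷ f) g h =
    ≗-trans (+ₚ-cong (scale-+ₚ a g h) (≗-trans (∷-cong refl (*ₚ-distribˡ f g h)) (shift-+ₚ (f *ₚ g) (f *ₚ h))))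
            (+ₚ-interchange (scale a g) (scale a h) (0# ∷ f *ₚ g) (0# ∷ f *ₚ h))

  *ₚ-distribʳ : ∀ f g h → (g +ₚ h) *ₚ f ≗ (g *ₚ f) +ₚ (h *ₚ f)
  *ₚ-distribʳ f g h = ≗-trans (*ₚ-comm (g +ₚ h) f) (≗-trans (*ₚ-distribˡ f g h)
    (+ₚ-cong (*ₚ-comm f g) (*ₚ-comm f h)))

  scale-*ₚ : ∀ a f g → scale a f *ₚ g ≗ scale a (f *ₚ g)
  scale-*ₚ a []      g = ≗-refl
  scale-*ₚ a (b ∷ f) g = ≗-trans
    (+ₚ-cong (≗-sym (scale-scale a b g)) (∷-cong (sym (zeroʳ a)) (scale-*ₚ a f g)))
    (≗-sym (scale-+ₚ a (scale b g) (0# ∷ f *ₚ g)))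

  shift-*ₚ : ∀ f g → (0# ∷ f) *ₚ g ≗ 0# ∷ f *ₚ g
  shift-*ₚ f g = +ₚ-cong (scale-0 refl g) (≗-refl {0# ∷ f *ₚ g})

  *ₚ-assoc : ∀ f g h → (f *ₚ g) *ₚ h ≗ f *ₚ (g *ₚ h)
  *ₚ-assoc []      g h = ≗-refl
  *ₚ-assoc (a ∷ f) g h = ≗-trans (*ₚ-distribʳ h (scale a g) (0# ∷ f *ₚ g))
    (+ₚ-cong (scale-*ₚ a g h) (≗-trans (shift-*ₚ (f *ₚ g) h) (∷-cong refl (*ₚ-assoc f g h))))

  constant-*ₚ : ∀ a f → (a ∷ []) *ₚ f ≗ scale a f
  constant-*ₚ a f = ≗-trans (+ₚ-cong (≗-refl {scale a f}) (∷-≗[] refl ≗-refl)) (+ₚ-identityʳ _)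

  *ₚ-identityˡ : ∀ f → (1# ∷ []) *ₚ f ≗ f
  *ₚ-identityˡ f = ≗-trans (constant-*ₚ 1# f) (scale-1 f)

  polynomialRing : CommutativeRing c ℓ
  polynomialRing = record
    { Carrier = Poly ; _≈_ = _≗_ ; _+_ = _+ₚ_ ; _*_ = _*ₚ_ ; -_ = negate ; 0# = [] ; 1# = 1# ∷ []
    ; isCommutativeRing = record
      { isRing = record
        { +-isAbelianGroup = record
          { isGroup = record
            { isMonoid = record
              { isSemigroup = record
                { isMagma = record
                  { isEquivalence = record { refl = ≗-refl ; sym = ≗-sym ; trans = ≗-trans }
                  ; ∙-cong = +ₚ-cong }
                ; assoc = +ₚ-assoc }
              ; identity = (λ f → ≗-refl) , +ₚ-identityʳ }
            ; inverse = (λ f → ≗-trans (+ₚ-comm (negate f) f) (+ₚ-inverseʳ f)) , +ₚ-inverseʳ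
            ; ⁻¹-cong = negate-cong }
          ; comm = +ₚ-comm }
        ; *-cong = λ {f} {f′} {g} {g′} p q → ≗-trans (*ₚ-congʳ p g) (*ₚ-congˡ f′ q)
        ; *-assoc = *ₚ-assoc
        ; *-identity = *ₚ-identityˡ , (λ f → ≗-trans (*ₚ-comm f (1# ∷ [])) (*ₚ-identityˡ f))
        ; distrib = *ₚ-distribˡ , *ₚ-distribʳ }
      ; *-comm = *ₚ-comm } }

  eval-≗[] : ∀ f x → f ≗ [] → eval f x ≈ 0#
  eval-≗[] []      x p = refl
  eval-≗[] (a ∷ f) x p =
    trans (+-cong (coeffs p 0) (trans (*-congˡ (eval-≗[] f x (tail-≗[] p))) (zeroʳ x))) (+-identityˡ 0#)

  eval-cong : ∀ f g x → f ≗ g → eval f x ≈ eval g x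
  eval-cong []      g       x p = sym (eval-≗[] g x (≗-sym p))
  eval-cong (a ∷ f) []      x p = eval-≗[] (a ∷ f) x p
  eval-cong (a ∷ f) (b ∷ g) x p = +-cong (coeffs p 0) (*-congˡ (eval-cong f g x (tail-cong p)))

  eval-point : ∀ f {x y} → x ≈ y → eval f x ≈ eval f y
  eval-point []      p = refl
  eval-point (a ∷ f) p = +-congˡ (*-cong p (eval-point f p))

  eval-+ₚ : ∀ f g x → eval (f +ₚ g) x ≈ eval f x + eval g x
  eval-+ₚ []      g       x = sym (+-identityˡ _)
  eval-+ₚ (a ∷ f) []      x = sym (+-identityʳ _)
  eval-+ₚ (a ∷ f) (b ∷ g) x = trans (+-congˡ (*-congˡ (eval-+ₚ f g x)))
    (solve 5 (λ a b x u v → (a :+ b) :+ x :* (u :+ v) := (a :+ x :* u) :+ (b :+ x :* v)) refl a b x (eval f x) (eval g x))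

  eval-scale : ∀ a f x → eval (scale a f) x ≈ a * eval f x
  eval-scale a []      x = sym (zeroʳ a)
  eval-scale a (b ∷ f) x = trans (+-congˡ (*-congˡ (eval-scale a f x)))
    (solve 4 (λ a b x u → a :* b :+ x :* (a :* u) := a :* (b :+ x :* u)) refl a b x (eval f x))

  eval-*ₚ : ∀ f g x → eval (f *ₚ g) x ≈ eval f x * eval g x
  eval-*ₚ []      g x = sym (zeroˡ _)
  eval-*ₚ (a ∷ f) g x = trans (eval-+ₚ (scale a g) (0# ∷ f *ₚ g) x)
    (trans (+-cong (eval-scale a g x) (trans (+-identityˡ _) (*-congˡ (eval-*ₚ f g x))))
    (solve 4 (λ a x u v → a :* v :+ x :* (u :* v) := (a :+ x :* u) :* v) refl a x (eval f x) (eval g x)))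

-- Classical field arithmetic

module FieldBasics (em : ∀ {a : Level} → ExcludedMiddle a)
  {c ℓ₁ ℓ₂ : Level} (K̄ : HeytingField c ℓ₁ ℓ₂) where

  open FieldTheory K̄ public

  private
    HCR : HeytingCommutativeRing c ℓ₁ ℓ₂
    HCR = HeytingField.heytingCommutativeRing K̄

  K̄-ring : CommutativeRing c ℓ₁
  K̄-ring = HeytingCommutativeRing.commutativeRing HCR

  open HeytingField K̄ using (_#_; tight; #⇒invertible; #-irrefl)
  open CommutativeRing K̄-ring public using (Carrier; _≈_; _+_; _*_; -_; 0#; 1#; refl; sym; trans; reflexive; setoid;
    +-cong; +-congˡ; +-congʳ; +-identityˡ; +-identityʳ; +-comm; +-assoc; -‿inverseˡ; -‿inverseʳ; -‿cong; *-cong; *-congˡ; *-congʳ;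
    *-identityˡ; *-identityʳ; *-comm; *-assoc; distribˡ; distribʳ; zeroˡ; zeroʳ; ring; semiring; commutativeSemiring)
  open Algebra.Properties.Ring ring public using (-0#≈0#; -‿involutive; x∙y⁻¹≈ε⇒x≈y; x≈y⇒x∙y⁻¹≈ε; -1*x≈-x; +-inverseʳ-unique)
  open Algebra.Properties.Semiring.Exp semiring public
  open Algebra.Properties.CommutativeSemiring.Exp commutativeSemiring public using (^-distrib-*)
  open Algebra.Properties.Semiring.Sum semiring public using (sum; sum-cong-≋; sum-init-last; sum-replicate-zero)
  open Algebra.Properties.Semiring.Mult semiring public renaming (_×_ to _·_)
  open PolynomialRing K̄-ring public
  open IntegerCoefficients K̄-ring public using (module Solver)
  open Solver public using (solve; _:=_; _:+_; _:*_; :-_)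
  open K̄[X] public using (Poly; coeff; _≈ₚ_; _+ₚ_; _*ₚ_; eval; X-_; ∏X-)
  open Algebra.Apartness.Properties.HeytingCommutativeRing HCR using (1#0; x-0≈x)
  open Relation.Binary.Reasoning.Setoid setoid

  1≉0 : ¬ 1# ≈ 0#
  1≉0 1≈0 = #-irrefl 1≈0 1#0

  -- Tightness and excluded middle turn `¬ x ≈ 0#` into apartness, which makes the difference of x
  -- and 0 invertible.
  inverse : ∀ {x} → ¬ x ≈ 0# → ∃[ y ] x * y ≈ 1#
  inverse {x} x≉0 with em {P = x # 0#}
  ... | no  ¬x#0 = contradiction (proj₁ (tight x 0#) ¬x#0) x≉0
  ... | yes x#0  with y , _ , xy≈1 ← #⇒invertible x#0 = y , trans (*-congʳ (sym (x-0≈x x))) xy≈1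

  *-cancel-0 : ∀ {x y} → ¬ x ≈ 0# → x * y ≈ 0# → y ≈ 0#
  *-cancel-0 {x} {y} x≉0 xy≈0 with z , xz≈1 ← inverse x≉0 = begin
    y            ≈⟨ *-identityˡ y ⟨
    1# * y       ≈⟨ *-congʳ xz≈1 ⟨
    (x * z) * y  ≈⟨ solve 3 (λ x y z → (x :* z) :* y := z :* (x :* y)) refl x y z ⟩
    z * (x * y)  ≈⟨ *-congˡ xy≈0 ⟩
    z * 0#       ≈⟨ zeroʳ z ⟩
    0#           ∎

  zero-product : ∀ {x y} → x * y ≈ 0# → x ≈ 0# ⊎ y ≈ 0#
  zero-product {x} xy≈0 with em {P = x ≈ 0#}
  ... | yes x≈0 = inj₁ x≈0
  ... | no  x≉0 = inj₂ (*-cancel-0 x≉0 xy≈0)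

  ^-zero : ∀ {x} n → x ^ n ≈ 0# → x ≈ 0#
  ^-zero zero    1≈0 = contradiction 1≈0 1≉0
  ^-zero (suc n) x^≈0 = [ id , ^-zero n ]′ (zero-product x^≈0)

  1^ : ∀ n → 1# ^ n ≈ 1#
  1^ zero    = refl
  1^ (suc n) = trans (*-identityˡ _) (1^ n)

  least : ∀ {a} (P : ℕ → Set a) → ∀ n → P n → ∃[ m ] P m × (∀ k → k < m → ¬ P k)
  least P = <-rec _ step
    where
    step : ∀ n → (∀ {m} → m < n → P m → ∃[ k ] P k × (∀ j → j < k → ¬ P j)) →
           P n → ∃[ m ] P m × (∀ k → k < m → ¬ P k)
    step n rec pn with em {P = ∃[ m ] m < n × P m}
    ... | yes (m , m<n , pm) = rec m<n pm
    ... | no  none = n , pn , λ k k<n pk → none (k , k<n , pk)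

  -- Primes, binomial coefficients and the characteristic exponent

  prime∤! : ∀ {p} → Prime p → ∀ n → n < p → ¬ p ∣ n !
  prime∤! {p} pr zero    _   p∣1 = nontrivial (prime⇒nonTrivial pr) (∣1⇒≡1 p∣1)
    where
    nontrivial : ℕ.NonTrivial p → ¬ p ≡ 1
    nontrivial () ≡.refl
  prime∤! pr (suc n) n<p p∣ with euclidsLemma (suc n) (n !) pr p∣
  ... | inj₁ p∣1+n = ℕ.<⇒≱ n<p (∣⇒≤ p∣1+n)
  ... | inj₂ p∣n!  = prime∤! pr n (ℕ.<-trans (ℕ.n<1+n n) n<p) p∣n!

  -- The prime p divides p! = (p C k) · k! · (p ∸ k)! but neither factorial, since k and p ∸ k lie
  -- below p.
  prime∣C : ∀ {p} → Prime p → ∀ k → 0 < k → k < p → p ∣ p C k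
  prime∣C {p} pr k 0<k k<p with euclidsLemma (p C k) (k ! ℕ.* (p ∸ k) !) pr p∣product
    where
    instance
      _ = k ℕ.!* (p ∸ k) !≢0
    p∣! : ∀ n → .{{ℕ.NonZero n}} → n ∣ n !
    p∣! (suc n) = m∣m*n (n !)
    p∣product : p ∣ (p C k) ℕ.* (k ! ℕ.* (p ∸ k) !)
    p∣product rewrite nCk≡n!/k![n-k]! (ℕ.<⇒≤ k<p) | m/n*n≡m (k![n∸k]!∣n! (ℕ.<⇒≤ k<p)) =
      p∣! p {{prime⇒nonZero pr}}
  ... | inj₁ p∣C = p∣C
  ... | inj₂ p∣k!* with euclidsLemma (k !) ((p ∸ k) !) pr p∣k!*
  ...   | inj₁ p∣k! = contradiction p∣k! (prime∤! pr k k<p)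
  ...   | inj₂ p∣[p-k]! = contradiction p∣[p-k]! (prime∤! pr (p ∸ k) (ℕ.∸-monoʳ-< 0<k (ℕ.<⇒≤ k<p)))

  ·-vanish : ∀ {p n} → p · 1# ≈ 0# → p ∣ n → ∀ x → n · x ≈ 0#
  ·-vanish {p} p·1≈0 (divides q ≡.refl) x = begin
    (q ℕ.* p) · x                ≈⟨ ×-congʳ (q ℕ.* p) (*-identityˡ x) ⟨
    (q ℕ.* p) · (1# * x)         ≈⟨ ×-assoc-* (q ℕ.* p) 1# x ⟨
    ((q ℕ.* p) · 1#) * x         ≈⟨ *-congʳ (×1-homo-* q p) ⟩
    ((q · 1#) * (p · 1#)) * x    ≈⟨ *-congʳ (trans (*-congˡ p·1≈0) (zeroʳ _)) ⟩
    0# * x                       ≈⟨ zeroˡ x ⟩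
    0#                           ∎

  -- Otherwise p and n are coprime, and a Bézout identity makes 1 vanish in the field.
  characteristic-∣ : ∀ {p} → Prime p → p · 1# ≈ 0# → ∀ n → n · 1# ≈ 0# → p ∣ n
  characteristic-∣ {p} pr p·1≈0 n n·1≈0 with p ∣? n
  ... | yes p∣n = p∣n
  ... | no  p∤n = ⊥-elim (bézout (coprime-Bézout coprime))
    where
    coprime : Coprime p n
    coprime (d∣p , d∣n) with prime⇒irreducible pr d∣p
    ... | inj₁ d≡1    = d≡1
    ... | inj₂ ≡.refl = contradiction d∣n p∤n
    combination : ∀ i j → i · 1# ≈ 0# → j · 1# ≈ 0# → ∀ x y → ¬ 1 ℕ.+ y ℕ.* i ≡ x ℕ.* j
    combination i j i≈0 j≈0 x y eq = 1≉0 (begin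
      1#                   ≈⟨ +-identityʳ 1# ⟨
      1# + 0#              ≈⟨ +-congˡ (·-vanish i≈0 (divides y ≡.refl) 1#) ⟨
      (1 ℕ.+ y ℕ.* i) · 1# ≡⟨ ≡.cong (_· 1#) eq ⟩
      (x ℕ.* j) · 1#       ≈⟨ ·-vanish j≈0 (divides x ≡.refl) 1# ⟩
      0#                   ∎)
    bézout : Bézout.Identity 1 p n → ⊥
    bézout (Bézout.+- x y eq) = combination n p n·1≈0 p·1≈0 x y eq
    bézout (Bézout.-+ x y eq) = combination p n p·1≈0 n·1≈0 y x eq

  -- The least positive n with n · 1 = 0 is prime: from a proper factorisation, one of the two
  -- factors would already vanish, as a field has no zero divisors.
  characteristicExponent-exists : ∃[ p ] IsCharacteristicExponent p
  characteristicExponent-exists with em {P = ∃[ n ] suc n · 1# ≈ 0#}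
  ... | no  none = 1 , char-0 λ n n·1≈0 → none (n , n·1≈0)
  ... | yes (n , n·1≈0) = fromLeast (least (λ n → suc n · 1# ≈ 0#) n n·1≈0)
    where
    fromLeast : (∃[ n ] suc n · 1# ≈ 0# × (∀ k → k < n → ¬ suc k · 1# ≈ 0#)) →
                ∃[ p ] IsCharacteristicExponent p
    fromLeast (zero , 1·1≈0 , _) = contradiction (trans (sym (×-homo-1 1#)) 1·1≈0) 1≉0
    fromLeast (suc m , m·1≈0 , minimal) = suc (suc m) , char-p (¬composite⇒prime ¬composite) m·1≈0
      where
      below : ∀ k → 0 < k → k < suc (suc m) → ¬ k · 1# ≈ 0#
      below (suc k) _ (s≤s k<) = minimal k k<
      ¬composite : ¬ Composite (suc (suc m))
      ¬composite (hasNonTrivialDivisor {d} {{nt}} d<n (divides (suc e) eq)) =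
        [ below (suc e) (s≤s z≤n) (≡.subst (suc e <_) (≡.sym eq) (ℕ.m<m*n (suc e) d (ℕ.nonTrivial⇒n>1 d)))
        , below d (ℕ.<-trans (s≤s z≤n) (ℕ.nonTrivial⇒n>1 d)) d<n ]′
        (zero-product (trans (sym (×1-homo-* (suc e) d)) (trans (×-congˡ (≡.sym eq)) m·1≈0)))

  frobenius-+ : ∀ {p} → IsCharacteristicExponent p → ∀ x y → (x + y) ^ p ≈ x ^ p + y ^ p
  frobenius-+ (char-0 _) x y = trans (*-identityʳ _) (sym (+-cong (*-identityʳ x) (*-identityʳ y)))
  frobenius-+ {suc q} (char-p pr p·1≈0) x y = begin
    (x + y) ^ suc q                          ≈⟨ Binomial.theorem (suc q) x y ⟩
    term zero + sum (term ∘ suc)             ≈⟨ +-congˡ (sum-init-last (term ∘ suc)) ⟩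
    term zero + (sum (term ∘ suc ∘ inject₁) + term (suc (fromℕ q)))
                                             ≈⟨ +-congˡ (+-congʳ (trans (sum-cong-≋ middle) (sum-replicate-zero q))) ⟩
    term zero + (0# + term (suc (fromℕ q)))  ≈⟨ +-cong first (trans (+-identityˡ _) last) ⟩
    y ^ suc q + x ^ suc q                    ≈⟨ +-comm _ _ ⟩
    x ^ suc q + y ^ suc q                    ∎
    where
    module Binomial = Algebra.Properties.CommutativeSemiring.Binomial commutativeSemiring
    term : Fin (suc (suc q)) → Carrier
    term = Binomial.binomialTerm x y (suc q)
    middle : ∀ i → term (suc (inject₁ i)) ≈ 0#
    middle i = ·-vanish p·1≈0 (prime∣C pr (suc (toℕ (inject₁ i))) (s≤s z≤n)
      (s≤s (≡.subst (_< q) (≡.sym (Fin.toℕ-inject₁ i)) (Fin.toℕ<n i)))) _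
    -- The binomial term of index k is (p C k) xᵏ yᵖ⁻ᵏ, so index zero yields the power of y and the
    -- last index that of x.
    first : term zero ≈ y ^ suc q
    first = trans (×-homo-1 _) (*-identityˡ _)
    last : term (suc (fromℕ q)) ≈ x ^ suc q
    last rewrite Fin.toℕ-fromℕ q | nCn≡1 (suc q) | ℕ.n∸n≡0 q = trans (×-homo-1 _) (*-identityʳ _)

  charExp-positive : ∀ {p} → IsCharacteristicExponent p → ∃[ k ] p ≡ suc k
  charExp-positive (char-0 _) = 0 , ≡.refl
  charExp-positive {suc k} (char-p _ _) = k , ≡.refl

  -- `PurelyInseparable` quantifies over all characteristic exponents; uniqueness lets a proof for
  -- one exponent serve for all.
  charExp-unique : ∀ {p p′} → IsCharacteristicExponent p → IsCharacteristicExponent p′ → p ≡ p′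
  charExp-unique (char-0 _) (char-0 _) = ≡.refl
  charExp-unique {p′ = suc k} (char-0 n≉0) (char-p _ p·1≈0) = contradiction p·1≈0 (n≉0 k)
  charExp-unique {suc k} (char-p _ p·1≈0) (char-0 n≉0) = contradiction p·1≈0 (n≉0 k)
  charExp-unique (char-p pr e) (char-p pr′ e′) with prime⇒irreducible pr′ (characteristic-∣ pr e _ e′)
  ... | inj₁ ≡.refl with () ← prime⇒nonTrivial pr
  ... | inj₂ p≡p′ = p≡p′

  -- The iterated Frobenius map x ↦ x^(pⁿ)

  module Frobenius {p : ℕ} (charExp : IsCharacteristicExponent p) where

    φ : ℕ → Carrier → Carrier
    φ n x = x ^ (p ℕ.^ n)

    φ-cong : ∀ n {x y} → x ≈ y → φ n x ≈ φ n y
    φ-cong n = ^-congˡ (p ℕ.^ n)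

    φ-suc : ∀ n x → φ (suc n) x ≈ φ n (x ^ p)
    φ-suc n x = sym (^-assocʳ x p (p ℕ.^ n))

    φ-1 : ∀ n → φ n 1# ≈ 1#
    φ-1 n = 1^ (p ℕ.^ n)

    φ-* : ∀ n x y → φ n (x * y) ≈ φ n x * φ n y
    φ-* n x y = ^-distrib-* x y (p ℕ.^ n)

    φ-+ : ∀ n x y → φ n (x + y) ≈ φ n x + φ n y
    φ-+ zero x y = trans (*-identityʳ _) (sym (+-cong (*-identityʳ x) (*-identityʳ y)))
    φ-+ (suc n) x y = begin
      φ (suc n) (x + y)          ≈⟨ φ-suc n (x + y) ⟩
      φ n ((x + y) ^ p)          ≈⟨ φ-cong n (frobenius-+ charExp x y) ⟩
      φ n (x ^ p + y ^ p)        ≈⟨ φ-+ n (x ^ p) (y ^ p) ⟩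
      φ n (x ^ p) + φ n (y ^ p)  ≈⟨ +-cong (φ-suc n x) (φ-suc n y) ⟨
      φ (suc n) x + φ (suc n) y  ∎

    φ-∘ : ∀ m n x → φ (m ℕ.+ n) x ≈ φ m (φ n x)
    φ-∘ m n x = begin
      x ^ (p ℕ.^ (m ℕ.+ n))           ≡⟨ ≡.cong (x ^_) (≡.trans (ℕ.^-distribˡ-+-* p m n) (ℕ.*-comm (p ℕ.^ m) _)) ⟩
      x ^ (p ℕ.^ n ℕ.* p ℕ.^ m)       ≈⟨ ^-assocʳ x (p ℕ.^ n) (p ℕ.^ m) ⟨
      (x ^ (p ℕ.^ n)) ^ (p ℕ.^ m)     ∎

    -- Displays pⁿ as a successor, as needed to see that 0 goes to 0 and to present φ n y as a
    -- positive power of y.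
    exponent-positive : ∀ n → ∃[ k ] p ℕ.^ n ≡ suc k
    exponent-positive n with k , ≡.refl ← charExp-positive charExp = positive (suc k ℕ.^ n) (ℕ.m^n>0 (suc k) n)
      where
      positive : ∀ m → 0 < m → ∃[ j ] m ≡ suc j
      positive (suc j) _ = j , ≡.refl

    φ-0 : ∀ n → φ n 0# ≈ 0#
    φ-0 n with k , eq ← exponent-positive n rewrite eq = zeroˡ _

    φ-neg : ∀ n x → φ n (- x) ≈ - φ n x
    φ-neg n x = +-inverseʳ-unique (φ n x) (φ n (- x))
      (trans (sym (φ-+ n x (- x))) (trans (φ-cong n (-‿inverseʳ x)) (φ-0 n)))

    φ-≈0 : ∀ n {x} → φ n x ≈ 0# → x ≈ 0#
    φ-≈0 n = ^-zero (p ℕ.^ n)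

    φ-injective : ∀ n {x y} → φ n x ≈ φ n y → x ≈ y
    φ-injective n {x} {y} eq = x∙y⁻¹≈ε⇒x≈y x y (φ-≈0 n
      (trans (φ-+ n x (- y)) (trans (+-congˡ (φ-neg n y)) (x≈y⇒x∙y⁻¹≈ε eq))))

-- Spans, exchange, bases and degrees

module LinearAlgebra (em : ∀ {a : Level} → ExcludedMiddle a)
  {c ℓ₁ ℓ₂ : Level} (K̄ : HeytingField c ℓ₁ ℓ₂) where

  open FieldBasics em K̄ public
  open Relation.Binary.Reasoning.Setoid setoid

  private
    variable
      E K L M : Subfield
      u w x y : Carrier
      us vs ws : List Carrier

    v : Level
    v = c ⊔ ℓ₁ ⊔ ℓ₂

  ^-closed : ∀ E n → x ∈ₛ E → x ^ n ∈ₛ E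
  ^-closed E zero    x∈ = Subfield.1-closed E
  ^-closed E (suc n) x∈ = Subfield.*-closed E x∈ (^-closed E n x∈)

  -- One target notion for `span-elim`: it covers spans, subfields, and preimages of a span under
  -- multiplication by an element.
  record IsSubspace (E : Subfield) {t} (T : Carrier → Set t) : Set (v ⊔ t) where
    field
      resp-closed  : x ≈ y → T x → T y
      zero-closed  : T 0#
      add-closed   : T x → T y → T (x + y)
      scale-closed : ∀ {k} → k ∈ₛ E → T x → T (k * x)

  -- Coefficients are consumed along the list of vectors. The equation stored in each constructor
  -- makes closure under `_≈_` immediate, without recursion.
  data Span (E : Subfield) : List Carrier → Carrier → Set v where
    none : x ≈ 0# → Span E [] x
    plus : ∀ {k} → k ∈ₛ E → Span E vs y → x ≈ k * w + y → Span E (w ∷ vs) x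

  span-resp : x ≈ y → Span E vs x → Span E vs y
  span-resp x≈y (none x≈0)      = none (trans (sym x≈y) x≈0)
  span-resp x≈y (plus k∈ s x≈) = plus k∈ s (trans (sym x≈y) x≈)

  span-0 : ∀ vs → Span E vs 0#
  span-0         []       = none refl
  span-0 {E = E} (w ∷ vs) = plus (Subfield.0-closed E) (span-0 vs) (sym (trans (+-identityʳ _) (zeroˡ w)))

  span-+ : Span E vs x → Span E vs y → Span E vs (x + y)
  span-+ (none x≈0) (none y≈0) = none (trans (+-cong x≈0 y≈0) (+-identityˡ 0#))
  span-+ {E = E} (plus k∈ s x≈) (plus l∈ t y≈) = plus (Subfield.+-closed E k∈ l∈) (span-+ s t)
    (trans (+-cong x≈ y≈) (solve 5 (λ k l w a b → (k :* w :+ a) :+ (l :* w :+ b) := (k :+ l) :* w :+ (a :+ b)) refl _ _ _ _ _))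

  span-* : ∀ {k} → k ∈ₛ E → Span E vs x → Span E vs (k * x)
  span-* k∈ (none x≈0) = none (trans (*-congˡ x≈0) (zeroʳ _))
  span-* {E = E} k∈ (plus l∈ s x≈) = plus (Subfield.*-closed E k∈ l∈) (span-* k∈ s)
    (trans (*-congˡ x≈) (solve 4 (λ k l w a → k :* (l :* w :+ a) := (k :* l) :* w :+ k :* a) refl _ _ _ _))

  span-neg : Span E vs x → Span E vs (- x)
  span-neg {E = E} s = span-resp (-1*x≈-x _) (span-* (Subfield.neg-closed E (Subfield.1-closed E)) s)

  span-isSubspace : ∀ E vs → IsSubspace E (Span E vs)
  span-isSubspace E vs = record
    { resp-closed = span-resp ; zero-closed = span-0 vs ; add-closed = span-+ ; scale-closed = span-* }

  subfield-isSubspace : E ⊑ M → IsSubspace E (_∈ₛ M)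
  subfield-isSubspace {M = M} E⊑M = record
    { resp-closed = Subfield.≈-closed M ; zero-closed = Subfield.0-closed M ; add-closed = Subfield.+-closed M
    ; scale-closed = λ k∈ → Subfield.*-closed M (E⊑M k∈) }

  span-elim : ∀ {t} {T : Carrier → Set t} → IsSubspace E T → All T vs → Span E vs x → T x
  span-elim T-sub [] (none x≈0) = IsSubspace.resp-closed T-sub (sym x≈0) (IsSubspace.zero-closed T-sub)
  span-elim T-sub (tw ∷ tvs) (plus k∈ s x≈) = resp-closed (sym x≈)
    (add-closed (scale-closed k∈ tw) (span-elim T-sub tvs s))
    where open IsSubspace T-sub

  span-⊑ : E ⊑ M → All (_∈ₛ M) vs → Span E vs x → x ∈ₛ M
  span-⊑ {E} {M} E⊑M = span-elim (subfield-isSubspace {E} {M} E⊑M)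

  span-⊆ : All (Span E ws) vs → Span E vs x → Span E ws x
  span-⊆ {E} {ws} = span-elim (span-isSubspace E ws)

  span-there : Span E vs x → Span E (w ∷ vs) x
  span-there {E = E} s = plus (Subfield.0-closed E) s (sym (trans (+-congʳ (zeroˡ _)) (+-identityˡ _)))

  span-here : ∀ w vs → Span E (w ∷ vs) w
  span-here {E = E} w vs = plus (Subfield.1-closed E) (span-0 vs) (sym (trans (+-identityʳ _) (*-identityˡ w)))

  span-self : ∀ vs → All (Span E vs) vs
  span-self []       = []
  span-self (w ∷ vs) = span-here w vs ∷ All.map span-there (span-self vs)

  span-∷-mono : (∀ {x} → Span E vs x → Span E ws x) → Span E (w ∷ vs) x → Span E (w ∷ ws) x
  span-∷-mono f (plus k∈ s x≈) = plus k∈ (f s) x≈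

  span-base : E ⊑ M → Span E vs x → Span M vs x
  span-base E⊑M (none x≈0)      = none x≈0
  span-base E⊑M (plus k∈ s x≈) = plus (E⊑M k∈) (span-base E⊑M s) x≈

  -- w = k⁻¹(x - y). The subspace T is arbitrary because w is placed in spans of various lists,
  -- often in order to contradict independence.
  span-solve : ∀ {k} → ¬ k ≈ 0# → k ∈ₛ E → Span E vs y → x ≈ k * w + y →
               ∀ {t} {T : Carrier → Set t} → IsSubspace E T → T x → T y → T w
  span-solve {E = E} {y = y} {x = x} {w = w} {k} k≉0 k∈ s x≈ T-sub tx ty
    with l , kl≈1 ← inverse k≉0 = resp-closed (begin
      l * (x + - y)              ≈⟨ *-congˡ (+-congʳ x≈) ⟩
      l * ((k * w + y) + - y)    ≈⟨ solve 4 (λ l k w y → l :* ((k :* w :+ y) :+ :- y) := (k :* l) :* w) refl l k w y ⟩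
      (k * l) * w                     ≈⟨ trans (*-congʳ kl≈1) (*-identityˡ w) ⟩
      w                               ∎)
      (scale-closed (Subfield.inv-closed E kl≈1 k∈)
        (add-closed tx (resp-closed (-1*x≈-x y) (scale-closed (Subfield.neg-closed E (Subfield.1-closed E)) ty))))
    where open IsSubspace T-sub

  -- Triangular form of independence: each vector lies outside the span of its successors, so a list
  -- grows one vector at a time. `independent-coefficients` and `coefficients-independent` link it
  -- to the usual form.
  data Independent (E : Subfield) : List Carrier → Set v where
    []  : Independent E []
    _∷_ : ¬ Span E vs w → Independent E vs → Independent E (w ∷ vs)

  -- As u is not in the span of us, some vector of ws has a nonzero coefficient in u; the first such
  -- vector is traded for u. P records where the surviving vectors come from.
  exchange-one : ∀ {P : Carrier → Set v} ws → All P ws → Span E (ws ++ us) u → ¬ Span E us u →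
    ∃[ ws′ ] suc (length ws′) ≡ length ws × All P ws′ ×
             (∀ {x} → Span E (ws ++ us) x → Span E (ws′ ++ u ∷ us) x)
  exchange-one [] _ s ¬s = contradiction s ¬s
  exchange-one {E = E} {us = us} {u = u} (w ∷ ws) (pw ∷ pws) (plus {k = k} k∈ s u≈) ¬s with em {P = k ≈ 0#}
  ... | yes k≈0
    with ws′ , len , pws′ , ⊆′ ← exchange-one {us = us} ws pws (span-resp (sym (trans u≈ (trans (+-congʳ (trans (*-congʳ k≈0) (zeroˡ w))) (+-identityˡ _)))) s) ¬s
    = w ∷ ws′ , ≡.cong suc len , pw ∷ pws′ , span-∷-mono ⊆′
  ... | no  k≉0 = ws , ≡.refl , pws , span-⊆ (w∈ ∷ rest)
    where
    self : All (Span E (ws ++ u ∷ us)) (ws ++ u ∷ us)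
    self = span-self (ws ++ u ∷ us)
    rest : All (Span E (ws ++ u ∷ us)) (ws ++ us)
    rest = All.++⁺ (All.++⁻ˡ ws self) (All.tail (All.++⁻ʳ ws self))
    w∈ : Span E (ws ++ u ∷ us) w
    w∈ = span-solve k≉0 k∈ s u≈ (span-isSubspace E _) (All.head (All.++⁻ʳ ws self)) (span-⊆ rest s)

  -- Steinitz exchange, putting in the vectors of us one after another from the last. The count of
  -- survivors yields both the comparison of lengths and the completion of us to a spanning list.
  exchange : ∀ {P : Carrier → Set v} → Independent E us → All P vs → All (Span E vs) us →
    ∃[ ws ] length us ℕ.+ length ws ≡ length vs × All P ws ×
            (∀ {x} → Span E vs x → Span E (ws ++ us) x)
  exchange {vs = vs} [] pvs [] = vs , ≡.refl , pvs , span-⊆ (All.++⁻ˡ vs (span-self _))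
  exchange {us = u ∷ us} (u∉ ∷ ind) pvs (u∈ ∷ us∈)
    with ws , len , pws , ⊆ws ← exchange ind pvs us∈
    with ws′ , len′ , pws′ , ⊆ws′ ← exchange-one {us = us} ws pws (⊆ws u∈) u∉
    = ws′ , ≡.trans (≡.sym (ℕ.+-suc (length us) (length ws′))) (≡.trans (≡.cong (length us ℕ.+_) len′) len)
    , pws′ , ⊆ws′ ∘ ⊆ws

  independent-≤ : Independent E us → All (Span E vs) us → length us ≤ length vs
  independent-≤ {E} {us} {vs} ind us∈ with exchange {P = Span E vs} ind (span-self vs) us∈
  ... | ws , len , _ = ≡.subst (length us ≤_) len (ℕ.m≤m+n (length us) (length ws))

  independent-tail : Independent E (w ∷ vs) → Independent E vs
  independent-tail (_ ∷ ind) = ind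

  independent-++ʳ : ∀ us → Independent E (us ++ vs) → Independent E vs
  independent-++ʳ []       ind = ind
  independent-++ʳ (u ∷ us) ind = independent-++ʳ us (independent-tail ind)

  -- Drops each vector that depends on the kept ones after it. The alternative at the end says that
  -- either nothing had to be dropped or the list became strictly shorter; `spanning⇒independent`
  -- rests on it.
  prune : ∀ {P : Carrier → Set v} vs → All P vs →
    ∃[ us ] Independent E us × All P us × (∀ {x} → Span E vs x → Span E us x) ×
            (Independent E vs ⊎ length us < length vs) × length us ≤ length vs
  prune [] [] = [] , [] , [] , id , inj₁ [] , z≤n
  prune {E = E} (w ∷ vs) (pw ∷ pvs)
    with us , ind , pus , vs⊆us , shrunk , len ← prune {E = E} vs pvs
    with em {P = Span E us w}
  ... | yes w∈ = us , ind , pus , span-⊆ (w∈ ∷ All.map vs⊆us (span-self vs)) , inj₂ (s≤s len) , ℕ.m≤n⇒m≤1+n len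
  ... | no  w∉ = w ∷ us , w∉ ∷ ind , pw ∷ pus , span-∷-mono vs⊆us
               , [ (λ ind′ → inj₁ ((λ s → w∉ (vs⊆us s)) ∷ ind′)) , (λ lt → inj₂ (s≤s lt)) ]′ shrunk , s≤s len

  record Basis (K L : Subfield) (n : ℕ) : Set v where
    field
      vectors     : List Carrier
      size        : length vectors ≡ n
      inside      : All (_∈ₛ L) vectors
      spanning    : ∀ {x} → x ∈ₛ L → Span K vectors x
      independent : Independent K vectors

  open Basis

  basis-≤ : ∀ {m n} → M ⊑ L → Basis K M m → Basis K L n → m ≤ n
  basis-≤ M⊑L B B′ = ≡.subst₂ _≤_ (size B) (size B′)
    (independent-≤ (independent B) (All.map (λ x∈ → spanning B′ (M⊑L x∈)) (inside B)))

  basis-unique : ∀ {m n} → Basis K L m → Basis K L n → m ≡ n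
  basis-unique B B′ = ℕ.≤-antisym (basis-≤ id B B′) (basis-≤ id B′ B)

  -- Exchanging a basis of M into one of L leaves n - m survivors; there are none when n ≤ m, so the
  -- basis of M already spans L.
  full-dimension⇒⊒ : ∀ {m n} → K ⊑ M → M ⊑ L → Basis K M m → Basis K L n → n ≤ m → L ⊑ M
  full-dimension⇒⊒ {K} {M} {m = m} {n} K⊑M M⊑L B B′ n≤m x∈
    with exchange (independent B) (inside B′) (All.map (λ x∈ → spanning B′ (M⊑L x∈)) (inside B))
  ... | []     , len , _ , ⊆ = span-⊑ {K} {M} K⊑M (inside B) (⊆ (spanning B′ x∈))
  ... | w ∷ ws , len , _ , _ = contradiction
    (≡.subst₂ (λ a b → a ℕ.+ suc (length ws) ≡ b) (size B) (size B′) len)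
    (λ eq → ℕ.<⇒≱ (ℕ.m<m+n m (s≤s z≤n)) (≡.subst (_≤ m) (≡.sym eq) n≤m))

  spanning⇒independent : ∀ {n} → Basis K L n → All (_∈ₛ L) vs → (∀ {x} → x ∈ₛ L → Span K vs x) →
                         length vs ≤ n → Independent K vs
  spanning⇒independent {K = K} {vs = vs} B vs∈ sp len with prune {E = K} vs vs∈
  ... | us , _ , _ , _ , inj₁ ind , _ = ind
  ... | us , _ , _ , vs⊆us , inj₂ lt , _ = contradiction
    (≡.subst (_≤ length us) (size B) (independent-≤ (independent B) (All.map (λ x∈ → vs⊆us (sp x∈)) (inside B))))
    (ℕ.<⇒≱ (ℕ.<-≤-trans lt len))

  spanned-basis : All (_∈ₛ L) vs → (∀ {x} → x ∈ₛ L → Span K vs x) → ∃[ n ] Basis K L n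
  spanned-basis {vs = vs} vs∈ sp with us , ind , us∈ , vs⊆us , _ ← prune vs vs∈ =
    length us , record { vectors = us ; size = ≡.refl ; inside = us∈ ; spanning = vs⊆us ∘ sp ; independent = ind }

  -- Extends an independent list in M greedily. The argument k of `grow` counts the vectors that
  -- still fit below the degree of L, so the process stops.
  subfield-basis : ∀ {n} → M ⊑ L → Basis K L n → ∃[ m ] Basis K M m
  subfield-basis {M} {L} {K} {n} M⊑L B′ = grow n [] [] [] (ℕ.+-identityʳ n)
    where
    grow : ∀ k us → Independent K us → All (_∈ₛ M) us → k ℕ.+ length us ≡ n → ∃[ m ] Basis K M m
    grow k us ind us∈ eq with em {P = ∃[ x ] x ∈ₛ M × ¬ Span K us x}
    ... | no  all = length us , record
      { vectors = us ; size = ≡.refl ; inside = us∈ ; independent = ind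
      ; spanning = λ {x} x∈ → decidable-stable em (λ x∉ → all (x , x∈ , x∉)) }
    grow zero    us ind us∈ eq | yes (x , x∈ , x∉) = contradiction
      (≡.subst (length (x ∷ us) ≤_) (≡.trans (size B′) (≡.sym eq))
        (independent-≤ (x∉ ∷ ind) (All.map (λ z∈ → spanning B′ (M⊑L z∈)) (x∈ ∷ us∈))))
      (ℕ.<⇒≱ (ℕ.n<1+n (length us)))
    grow (suc k) us ind us∈ eq | yes (x , x∈ , x∉) =
      grow k (x ∷ us) (x∉ ∷ ind) (x∈ ∷ us∈) (≡.trans (ℕ.+-suc k (length us)) eq)

  larger-base-basis : ∀ {n} → E ⊑ M → Basis E L n → ∃[ m ] Basis M L m
  larger-base-basis E⊑M B = spanned-basis (inside B) (λ x∈ → span-base E⊑M (spanning B x∈))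

  -- Products of bases and the tower law

  products : List Carrier → List Carrier → List Carrier
  products vs []       = []
  products vs (w ∷ ws) = map (_* w) vs ++ products vs ws

  length-products : ∀ vs ws → length (products vs ws) ≡ length ws ℕ.* length vs
  length-products vs []       = ≡.refl
  length-products vs (w ∷ ws) = ≡.trans (length-++ (map (_* w) vs))
    (≡.cong₂ ℕ._+_ (length-map (_* w) vs) (length-products vs ws))

  module _ {K M L : Subfield} (K⊑M : K ⊑ M) (M⊑L : M ⊑ L) where

    products-inside : All (_∈ₛ M) vs → All (_∈ₛ L) ws → All (_∈ₛ L) (products vs ws)
    products-inside vs∈ []         = []
    products-inside vs∈ (w∈ ∷ ws∈) =
      All.++⁺ (All.map⁺ (All.map (λ v∈ → Subfield.*-closed L (M⊑L v∈) w∈) vs∈)) (products-inside vs∈ ws∈)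

    map-*-spanning : Span K vs x → Span K (map (_* w) vs ++ us) (x * w)
    map-*-spanning {us = us} (none x≈0) = span-resp (sym (trans (*-congʳ x≈0) (zeroˡ _))) (span-0 us)
    map-*-spanning (plus k∈ s x≈) = plus k∈ (map-*-spanning s)
      (trans (*-congʳ x≈) (trans (distribʳ _ _ _) (+-congʳ (*-assoc _ _ _))))

    products-spanning : (∀ {x} → x ∈ₛ M → Span K vs x) → Span M ws x → Span K (products vs ws) x
    products-spanning sp (none x≈0) = none x≈0
    products-spanning {vs = vs} {ws = w ∷ ws} sp (plus k∈ s x≈) = span-resp (sym x≈)
      (span-+ (map-*-spanning (sp k∈))
        (span-⊆ (All.++⁻ʳ (map (_* w) vs) (span-self (map (_* w) vs ++ products vs ws))) (products-spanning sp s)))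

    -- Separates the block of multiples of w from the later blocks, so that a K-combination of
    -- products reads as an M-combination of w and ws.
    map-*-decompose : ∀ vs → All (_∈ₛ M) vs → All (Span M ws) us → Span K (map (_* w) vs ++ us) x →
                      ∃[ a ] ∃[ y ] Span K vs a × Span M ws y × x ≈ a * w + y
    map-*-decompose {ws = ws} {x = x} [] [] us∈ s =
      0# , x , none refl , span-elim (record
        { resp-closed = span-resp ; zero-closed = span-0 ws ; add-closed = span-+
        ; scale-closed = λ k∈ → span-* (K⊑M k∈) }) us∈ s
      , sym (trans (+-congʳ (zeroˡ _)) (+-identityˡ _))
    map-*-decompose (z ∷ vs) (z∈ ∷ vs∈) us∈ (plus {k = k} k∈ s x≈)
      with a , y , a∈ , y∈ , eq ← map-*-decompose vs vs∈ us∈ s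
      = k * z + a , y , plus k∈ a∈ refl , y∈ , trans x≈ (trans (+-congˡ eq)
          (solve 5 (λ k z w a y → k :* (z :* w) :+ (a :* w :+ y) := (k :* z :+ a) :* w :+ y) refl k z _ a y))

    -- If z w depended on the later products, then (z - a) w would lie in the M-span of ws for some
    -- a in the K-span of the later vs. Independence of vs gives z ≠ a, so w itself would lie there.
    map-*-independent : ∀ vs → All (_∈ₛ M) vs → Independent K vs → All (Span M ws) us → Independent K us →
                        ¬ Span M ws w → Independent K (map (_* w) vs ++ us)
    map-*-independent [] [] [] us∈ ind w∉ = ind
    map-*-independent {ws = ws} {w = w} (z ∷ vs) (z∈ ∷ vs∈) (z∉ ∷ ind-vs) us∈ ind w∉ =
      head ∷ map-*-independent vs vs∈ ind-vs us∈ ind w∉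
      where
      head : ¬ Span K (map (_* w) vs ++ _) (z * w)
      head s with a , y , a∈ , y∈ , eq ← map-*-decompose vs vs∈ us∈ s with em {P = z + - a ≈ 0#}
      ... | yes z-a≈0 = z∉ (span-resp (sym (x∙y⁻¹≈ε⇒x≈y z a z-a≈0)) a∈)
      ... | no  z-a≉0 = w∉ (span-solve z-a≉0
              (Subfield.+-closed M z∈ (Subfield.neg-closed M (span-⊑ {K} {M} K⊑M vs∈ a∈)))
              (span-neg y∈)
              (begin
                0#                              ≈⟨ -‿inverseʳ (z * w) ⟨
                z * w + - (z * w)               ≈⟨ +-congˡ (-‿cong eq) ⟩
                z * w + - (a * w + y)           ≈⟨ solve 4 (λ z w a y → z :* w :+ :- (a :* w :+ y) := (z :+ :- a) :* w :+ :- y) refl z w a y ⟩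
                (z + - a) * w + - y             ∎)
              (span-isSubspace M ws) (span-0 ws) (span-neg y∈))

    products-∈span : All (_∈ₛ M) vs → ∀ ws → All (Span M ws) (products vs ws)
    products-∈span vs∈ []       = []
    products-∈span vs∈ (w ∷ ws) = All.++⁺ (All.map⁺ (All.map (λ v∈ → span-* v∈ (span-here w ws)) vs∈))
      (All.map span-there (products-∈span vs∈ ws))

    products-independent : All (_∈ₛ M) vs → Independent K vs → Independent M ws → Independent K (products vs ws)
    products-independent vs∈ ind []            = []
    products-independent vs∈ ind (w∉ ∷ ind-ws) =
      map-*-independent _ vs∈ ind (products-∈span vs∈ _) (products-independent vs∈ ind ind-ws) w∉

    tower : ∀ {m n} → Basis M L n → Basis K M m → Basis K L (n ℕ.* m)
    tower B′ B = record
      { vectors     = products (vectors B) (vectors B′)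
      ; size        = ≡.trans (length-products (vectors B) (vectors B′)) (≡.cong₂ ℕ._*_ (size B′) (size B))
      ; inside      = products-inside (inside B) (inside B′)
      ; spanning    = λ x∈ → products-spanning (spanning B) (spanning B′ x∈)
      ; independent = products-independent (inside B) (independent B) (independent B′) }

  -- Total on lists of unequal length, missing entries counting as zero: the coefficient list of a
  -- polynomial may be shorter than the list of powers it is paired with.
  combination : List Carrier → List Carrier → Carrier
  combination []       vs       = 0#
  combination (k ∷ ks) []       = 0#
  combination (k ∷ ks) (w ∷ vs) = k * w + combination ks vs

  combination-span : ∀ {ks} vs → All (_∈ₛ E) ks → Span E vs (combination ks vs)
  combination-span vs       []         = span-0 vs
  combination-span []       (k∈ ∷ ks∈) = none refl
  combination-span (w ∷ vs) (k∈ ∷ ks∈) = plus k∈ (combination-span vs ks∈) refl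

  span-combination : Span E vs x → ∃[ ks ] All (_∈ₛ E) ks × length ks ≡ length vs × x ≈ combination ks vs
  span-combination (none x≈0) = [] , [] , ≡.refl , x≈0
  span-combination (plus k∈ s x≈) with ks , ks∈ , len , eq ← span-combination s =
    _ ∷ ks , k∈ ∷ ks∈ , ≡.cong suc len , trans x≈ (+-congˡ eq)

  independent-coefficients : ∀ {ks} → Independent E vs → All (_∈ₛ E) ks → length ks ≤ length vs →
                             combination ks vs ≈ 0# → All (_≈ 0#) ks
  independent-coefficients ind [] len eq = []
  independent-coefficients {E = E} {vs = w ∷ vs} {k ∷ ks} (w∉ ∷ ind) (k∈ ∷ ks∈) (s≤s len) eq with em {P = k ≈ 0#}
  ... | yes k≈0 = k≈0 ∷ independent-coefficients ind ks∈ len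
          (trans (sym (trans (+-congʳ (trans (*-congʳ k≈0) (zeroˡ w))) (+-identityˡ _))) eq)
  ... | no  k≉0 = contradiction
          (span-solve k≉0 k∈ (combination-span vs ks∈) (sym eq) (span-isSubspace E vs) (span-0 vs) (combination-span vs ks∈)) w∉

  coefficients-independent : (∀ {ks} → All (_∈ₛ E) ks → length ks ≡ length vs → combination ks vs ≈ 0# → All (_≈ 0#) ks) →
                             Independent E vs
  coefficients-independent {vs = []} h = []
  coefficients-independent {E = E} {vs = w ∷ vs} h = w∉ ∷ coefficients-independent tail
    where
    tail : ∀ {ks} → All (_∈ₛ E) ks → length ks ≡ length vs → combination ks vs ≈ 0# → All (_≈ 0#) ks
    tail ks∈ len eq = All.tail (h (Subfield.0-closed E ∷ ks∈) (≡.cong suc len)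
      (trans (+-congʳ (zeroˡ w)) (trans (+-identityˡ _) eq)))
    w∉ : ¬ Span E vs w
    -- Moving w to the other side gives a relation in which w has coefficient -1, so -1 would
    -- vanish.
    w∉ s with ks , ks∈ , len , eq ← span-combination s = 1≉0 (begin
      1#        ≈⟨ -‿involutive 1# ⟨
      - (- 1#)  ≈⟨ -‿cong (All.head (h (Subfield.neg-closed E (Subfield.1-closed E) ∷ ks∈) (≡.cong suc len)
                     (trans (+-cong (-1*x≈-x w) (sym eq)) (-‿inverseˡ w)))) ⟩
      - 0#      ≈⟨ -0#≈0# ⟩
      0#        ∎)

  -- Passage to bases indexed by `Fin`

  sum-combination : ∀ {n} (k b : Fin n → Carrier) → sum (λ j → k j * b j) ≡ combination (tabulate k) (tabulate b)
  sum-combination {zero}  k b = ≡.refl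
  sum-combination {suc n} k b = ≡.cong (k zero * b zero +_) (sum-combination (k ∘ suc) (b ∘ suc))

  tabulation : ∀ {n} {A : Set c} (ks : List A) → length ks ≡ n → ∃[ k ] tabulate {n = n} k ≡ ks
  tabulation ks ≡.refl = lookup ks , tabulate-lookup ks

  fromIsBasis : ∀ {n} → HasDegree K L n → Basis K L n
  fromIsBasis {K} {L} (b , B) = record
    { vectors = tabulate b ; size = length-tabulate b ; inside = All.tabulate⁺ (IsBasis.inside B)
    ; spanning = spanning′ ; independent = coefficients-independent independent′ }
    where
    spanning′ : ∀ {x} → x ∈ₛ L → Span K (tabulate b) x
    spanning′ x∈ with k , k∈ , eq ← IsBasis.spanning B x∈ =
      span-resp (sym (trans eq (reflexive (sum-combination k b)))) (combination-span (tabulate b) (All.tabulate⁺ k∈))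
    independent′ : ∀ {ks} → All (_∈ₛ K) ks → length ks ≡ length (tabulate b) → combination ks (tabulate b) ≈ 0# → All (_≈ 0#) ks
    independent′ {ks} ks∈ len eq with k , ≡.refl ← tabulation ks (≡.trans len (length-tabulate b)) =
      All.tabulate⁺ (IsBasis.independent B k (All.tabulate⁻ ks∈) (trans (reflexive (sum-combination k b)) eq))

  toIsBasis : ∀ {n} → Basis K L n → HasDegree K L n
  toIsBasis {K} {L} {n} B = from (vectors B) (size B) (inside B) (spanning B) (independent B)
    where
    from : ∀ vs → length vs ≡ n → All (_∈ₛ L) vs → (∀ {x} → x ∈ₛ L → Span K vs x) → Independent K vs → HasDegree K L n
    from vs len vs∈ sp ind with b , ≡.refl ← tabulation vs len = b , record
      { inside = All.tabulate⁻ vs∈ ; spanning = spanning′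
      ; independent = λ k k∈ eq → All.tabulate⁻ (independent-coefficients ind (All.tabulate⁺ {f = k} k∈)
          (ℕ.≤-reflexive (≡.trans (length-tabulate k) (≡.sym (length-tabulate b)))) (trans (reflexive (≡.sym (sum-combination k b))) eq)) }
      where
      spanning′ : ∀ {x} → x ∈ₛ L → Σ (Fin n → Carrier) λ k → (∀ j → k j ∈ₛ K) × x ≈ sum (λ j → k j * b j)
      spanning′ x∈ with ks , ks∈ , len′ , eq ← span-combination (sp x∈)
        with k , ≡.refl ← tabulation ks (≡.trans len′ (length-tabulate b))
        = k , All.tabulate⁻ ks∈ , trans eq (reflexive (≡.sym (sum-combination k b)))

  open Degree em

  -- `[_∶_]` takes whatever basis excluded middle supplies; uniqueness of dimension makes its size
  -- that of any basis at hand.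
  degree-basis : ∀ {n} → Basis K L n → [ L ∶ K ] ≡ n
  degree-basis {K} {L} B with em {P = ∃ (HasDegree K L)}
  ... | yes (m , B′) = basis-unique (fromIsBasis {K} {L} B′) B
  ... | no  ¬basis  = contradiction (_ , toIsBasis {K} {L} B) ¬basis

-- Polynomials over subfields, division and roots

module PolynomialsOverSubfields (em : ∀ {a : Level} → ExcludedMiddle a)
  {c ℓ₁ ℓ₂ : Level} (K̄ : HeytingField c ℓ₁ ℓ₂) where

  open LinearAlgebra em K̄ public
  module K̄[X]-ring = CommutativeRing polynomialRing
  ≗-reflexive : ∀ {f g} → f ≡ g → f ≗ g
  ≗-reflexive = K̄[X]-ring.reflexive

  module ≗-Reasoning = Relation.Binary.Reasoning.Setoid K̄[X]-ring.setoid

  private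
    variable
      E K L M : Subfield
      x y α β : Carrier
      f g h : Poly

    v : Level
    v = c ⊔ ℓ₁ ⊔ ℓ₂

  -- Polynomials with coefficients in a subfield

  infix 4 _∈[X]_
  _∈[X]_ : Poly → Subfield → Set v
  f ∈[X] E = All (_∈ₛ E) f

  module _ (E : Subfield) where

    open Subfield E

    scale-∈ : ∀ {a} → a ∈ₛ E → f ∈[X] E → scale a f ∈[X] E
    scale-∈ a∈ f∈ = All.map⁺ (All.map (*-closed a∈) f∈)

    +ₚ-∈ : f ∈[X] E → g ∈[X] E → f +ₚ g ∈[X] E
    +ₚ-∈ []        g∈        = g∈
    +ₚ-∈ (a∈ ∷ f∈) []        = a∈ ∷ f∈
    +ₚ-∈ (a∈ ∷ f∈) (b∈ ∷ g∈) = +-closed a∈ b∈ ∷ +ₚ-∈ f∈ g∈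

    *ₚ-∈ : f ∈[X] E → g ∈[X] E → f *ₚ g ∈[X] E
    *ₚ-∈ []        g∈ = []
    *ₚ-∈ (a∈ ∷ f∈) g∈ = +ₚ-∈ (scale-∈ a∈ g∈) (0-closed ∷ *ₚ-∈ f∈ g∈)

    coeff-∈ : f ∈[X] E → ∀ n → coeff f n ∈ₛ E
    coeff-∈ []        n       = 0-closed
    coeff-∈ (a∈ ∷ f∈) zero    = a∈
    coeff-∈ (a∈ ∷ f∈) (suc n) = coeff-∈ f∈ n

    -- All arithmetic happens in K̄[X] with membership of the coefficients carried separately, so
    -- that several base fields share one polynomial ring. `lift` and `embed` translate to `E [X]`,
    -- in which the theorem is stated.
    lift : f ∈[X] E → E [X]
    lift []        = []
    lift (a∈ ∷ f∈) = (_ , a∈) ∷ lift f∈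

    embed-lift : (f∈ : f ∈[X] E) → embed E (lift f∈) ≡ f
    embed-lift []        = ≡.refl
    embed-lift (a∈ ∷ f∈) = ≡.cong (_ ∷_) (embed-lift f∈)

    embed-∈ : (f : E [X]) → embed E f ∈[X] E
    embed-∈ []             = []
    embed-∈ ((a , a∈) ∷ f) = a∈ ∷ embed-∈ f

    embed-coeff : ∀ f n → proj₁ (Over.coeff E f n) ≡ coeff (embed E f) n
    embed-coeff []      n       = ≡.refl
    embed-coeff (a ∷ f) zero    = ≡.refl
    embed-coeff (a ∷ f) (suc n) = embed-coeff f n

    embed-+ₚ : ∀ f g → embed E (Over._+ₚ_ E f g) ≡ embed E f +ₚ embed E g
    embed-+ₚ []      g       = ≡.refl
    embed-+ₚ (a ∷ f) []      = ≡.refl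
    embed-+ₚ (a ∷ f) (b ∷ g) = ≡.cong (_ ∷_) (embed-+ₚ f g)

    embed-scale : ∀ a g → embed E (map (RawRing._*_ (subfieldRing E) a) g) ≡ scale (proj₁ a) (embed E g)
    embed-scale a []      = ≡.refl
    embed-scale a (b ∷ g) = ≡.cong (_ ∷_) (embed-scale a g)

    embed-*ₚ : ∀ f g → embed E (Over._*ₚ_ E f g) ≡ embed E f *ₚ embed E g
    embed-*ₚ []      g = ≡.refl
    embed-*ₚ (a ∷ f) g = ≡.trans (embed-+ₚ (map (RawRing._*_ (subfieldRing E) a) g) _)
      (≡.cong₂ _+ₚ_ (embed-scale a g) (≡.cong (0# ∷_) (embed-*ₚ f g)))

    embed-≈ : ∀ f g → Over._≈ₚ_ E f g → embed E f ≗ embed E g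
    embed-≈ f g f≈g = ⟨ (λ n → ≡.subst₂ _≈_ (embed-coeff f n) (embed-coeff g n) (f≈g n)) ⟩

    embed-reflects-≈ : ∀ f g → embed E f ≗ embed E g → Over._≈ₚ_ E f g
    embed-reflects-≈ f g f≗g n = ≡.subst₂ _≈_ (≡.sym (embed-coeff f n)) (≡.sym (embed-coeff g n)) (coeffs f≗g n)

    UnitOver : Poly → Set v
    UnitOver f = ∃[ t ] t ∈[X] E × t *ₚ f ≗ 1# ∷ []

    unit-lift : (f : E [X]) → UnitOver (embed E f) → Over._∣_ E f (RawSemiring.1# (Over.polynomials E))
    unit-lift f (t , t∈ , tf≗1) = lift t∈ RawMagma., embed-reflects-≈ _ _
      (≗-trans (≗-reflexive (≡.trans (embed-*ₚ (lift t∈) f) (≡.cong (_*ₚ embed E f) (embed-lift t∈)))) tf≗1)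

    unit-embed : (f : E [X]) → Over._∣_ E f (RawSemiring.1# (Over.polynomials E)) → UnitOver (embed E f)
    unit-embed f (t RawMagma., tf≈1) = embed E t , embed-∈ t ,
      ≗-trans (≗-reflexive (≡.sym (embed-*ₚ t f))) (embed-≈ _ _ tf≈1)

    IrreducibleOver : Poly → Set v
    IrreducibleOver f = ¬ UnitOver f ×
      (∀ {q r} → q ∈[X] E → r ∈[X] E → f ≗ q *ₚ r → UnitOver q ⊎ UnitOver r)

    irreducible-embed : (f : E [X]) → Over.Irreducible E f → IrreducibleOver (embed E f)
    irreducible-embed f irr = (λ u → RawSemiringDefs.Irreducible.p∤1 irr (unit-lift f u)) , split
      where
      split : ∀ {q r} → q ∈[X] E → r ∈[X] E → embed E f ≗ q *ₚ r → UnitOver q ⊎ UnitOver r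
      split {q} {r} q∈ r∈ f≗qr with RawSemiringDefs.Irreducible.split-∣1 irr {lift q∈} {lift r∈}
        (embed-reflects-≈ _ _ (≗-trans f≗qr (≗-reflexive (≡.sym
          (≡.trans (embed-*ₚ (lift q∈) (lift r∈)) (≡.cong₂ _*ₚ_ (embed-lift q∈) (embed-lift r∈)))))))
      ... | inj₁ q∣1 = inj₁ (≡.subst UnitOver (embed-lift q∈) (unit-embed (lift q∈) q∣1))
      ... | inj₂ r∣1 = inj₂ (≡.subst UnitOver (embed-lift r∈) (unit-embed (lift r∈) r∣1))

    irreducible-lift : (f∈ : f ∈[X] E) → IrreducibleOver f → Over.Irreducible E (lift f∈)
    irreducible-lift {f} f∈ (¬unit , split) = record
      { p∤1 = λ u → ¬unit (≡.subst UnitOver (embed-lift f∈) (unit-embed (lift f∈) u))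
      ; split-∣1 = λ {q} {r} f≈qr → [ inj₁ ∘ unit-lift q , inj₂ ∘ unit-lift r ]′
          (split (embed-∈ q) (embed-∈ r) (≗-trans (≗-reflexive (≡.sym (embed-lift f∈)))
            (≗-trans (embed-≈ _ _ f≈qr) (≗-reflexive (embed-*ₚ q r))))) }

  -- Roots, leading coefficients and division with remainder

  *ₚ-cancel-0 : ∀ f g → ¬ f ≗ [] → f *ₚ g ≗ [] → g ≗ []
  *ₚ-cancel-0 []      g f≉0 fg≗0 = contradiction ≗-refl f≉0
  *ₚ-cancel-0 (a ∷ f) g f≉0 fg≗0 with em {P = a ≈ 0#}
  ... | yes a≈0 = *ₚ-cancel-0 f g (λ f≗0 → f≉0 (∷-≗[] a≈0 f≗0))
          (tail-≗[] (≗-trans (+ₚ-cong (≗-sym (scale-0 a≈0 g)) (≗-refl {0# ∷ f *ₚ g})) fg≗0))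
  ... | no  a≉0 = cancel g fg≗0
    where
    -- A nonzero constant coefficient in the first factor forces that of g to vanish; `*ₚ-∷` then
    -- passes the equation on to the tail of g.
    cancel : ∀ g → (a ∷ f) *ₚ g ≗ [] → g ≗ []
    cancel []      _    = ≗-refl
    cancel (b ∷ g) fg≗0 = ∷-≗[] b≈0 (cancel g (tail-≗[]
      (≗-trans (+ₚ-cong (≗-sym (scale-0 b≈0 (a ∷ f))) (≗-refl {0# ∷ (a ∷ f) *ₚ g})) (≗-trans (≗-sym (*ₚ-∷ (a ∷ f) b g)) fg≗0))))
      where
      b≈0 : b ≈ 0#
      b≈0 = *-cancel-0 a≉0 (trans (sym (+-identityʳ _)) (coeffs fg≗0 0))

  -- Lists may end in zeros, so the leading coefficient has to be searched for. In the form
  -- `ks ∷ʳ 1#` the degree is visible as `length ks`.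
  monic-form : ∀ f → ¬ f ≗ [] → f ∈[X] E → ∃[ a ] ∃[ ks ]
    a ∈ₛ E × ¬ a ≈ 0# × ks ∈[X] E × length ks < length f × f ≗ scale a (ks ∷ʳ 1#)
  monic-form []      f≉0 _         = contradiction ≗-refl f≉0
  monic-form {E = E} (a ∷ f) af≉0 (a∈ ∷ f∈) with em {P = f ≗ []}
  ... | yes f≗0 = a , [] , a∈ , (λ a≈0 → af≉0 (∷-≗[] a≈0 f≗0)) , [] , s≤s z≤n , ∷-cong (sym (*-identityʳ a)) f≗0
  ... | no  f≉0
    with b , ks , b∈ , b≉0 , ks∈ , len , eq ← monic-form {E = E} f f≉0 f∈
    with b⁻¹ , bb⁻¹≈1 ← inverse b≉0
    = b , b⁻¹ * a ∷ ks , b∈ , b≉0 , *-closed (inv-closed bb⁻¹≈1 b∈) a∈ ∷ ks∈ , s≤s len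
    , ∷-cong (trans (sym (*-identityˡ a)) (trans (*-congʳ (sym bb⁻¹≈1)) (*-assoc b b⁻¹ a))) eq
    where open Subfield E

  coeff-monic : ∀ ks → coeff (ks ∷ʳ 1#) (length ks) ≡ 1#
  coeff-monic []       = ≡.refl
  coeff-monic (k ∷ ks) = coeff-monic ks

  coeff-beyond : ∀ f n → length f ≤ n → coeff f n ≡ 0#
  coeff-beyond []      n       _         = ≡.refl
  coeff-beyond (a ∷ f) (suc n) (s≤s len) = coeff-beyond f n len

  length-∷ʳ : ∀ (ks : Poly) a → length (ks ∷ʳ a) ≡ suc (length ks)
  length-∷ʳ ks a = ≡.trans (length-++ ks) (ℕ.+-comm (length ks) 1)

  monic-≉[] : ∀ ks → ¬ ks ∷ʳ 1# ≗ []
  monic-≉[] ks eq = 1≉0 (trans (reflexive (≡.sym (coeff-monic ks))) (coeffs eq (length ks)))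

  -- `c ∷ r` is one entry too long for a remainder; its last entry is the multiple of the monic
  -- polynomial to be removed.
  reduce : ∀ c r → r ∈[X] E → ∀ ks → ks ∈[X] E → c ∈ₛ E → length r ≡ length ks → ∃[ a ] ∃[ r′ ] a ∈ₛ E × r′ ∈[X] E ×
           length r′ ≡ length ks × c ∷ r ≗ scale a (ks ∷ʳ 1#) +ₚ r′
  reduce c [] [] [] [] c∈ len = c , [] , c∈ , [] , ≡.refl , ∷-cong (sym (*-identityʳ c)) ≗-refl
  reduce {E = E} c (d ∷ r) (d∈ ∷ r∈) (k ∷ ks) (k∈ ∷ ks∈) c∈ len
    with a , r′ , a∈ , r′∈ , len′ , eq ← reduce {E = E} d r r∈ ks ks∈ d∈ (ℕ.suc-injective len)
    = a , c + - (a * k) ∷ r′ , a∈ , +-closed c∈ (neg-closed (*-closed a∈ k∈)) ∷ r′∈ , ≡.cong suc len′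
    , ∷-cong (solve 2 (λ c ak → c := ak :+ (c :+ :- ak)) refl c (a * k)) eq
    where open Subfield E

  -- Horner-style division: X times the remainder of the tail, plus the new constant term, is
  -- reduced once more. Remainders are padded with zeros to the exact length of `ks`.
  divide : ∀ ks → ks ∈[X] E → ∀ f → f ∈[X] E → ∃[ s ] ∃[ r ] s ∈[X] E × r ∈[X] E ×
           length r ≡ length ks × f ≗ s *ₚ (ks ∷ʳ 1#) +ₚ r
  divide {E = E} ks ks∈ [] [] = [] , map (λ _ → 0#) ks , [] , All.map⁺ (All.map (λ _ → Subfield.0-closed E) ks∈)
    , length-map _ ks , ≗-sym (zeros ks)
    where
    zeros : ∀ (ks : Poly) → map (λ _ → 0#) ks ≗ []
    zeros []       = ≗-refl
    zeros (k ∷ ks) = ∷-≗[] refl (zeros ks)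
  divide {E = E} ks ks∈ (c ∷ f) (c∈ ∷ f∈)
    with s , r , s∈ , r∈ , len , eq ← divide {E = E} ks ks∈ f f∈
    with a , r′ , a∈ , r′∈ , len′ , eq′ ← reduce {E = E} c r r∈ ks ks∈ c∈ len
    = a ∷ s , r′ , a∈ ∷ s∈ , r′∈ , len′ , (let m = ks ∷ʳ 1# in begin
      c ∷ f                                          ≈⟨ ∷-cong (sym (+-identityˡ c)) eq ⟩
      (0# ∷ s *ₚ m) +ₚ (c ∷ r)                       ≈⟨ +ₚ-congˡ (0# ∷ s *ₚ m) eq′ ⟩
      (0# ∷ s *ₚ m) +ₚ (scale a m +ₚ r′)             ≈⟨ +ₚ-assoc (0# ∷ s *ₚ m) (scale a m) r′ ⟨
      ((0# ∷ s *ₚ m) +ₚ scale a m) +ₚ r′             ≈⟨ +ₚ-congʳ r′ (+ₚ-comm _ (scale a m)) ⟩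
      (scale a m +ₚ (0# ∷ s *ₚ m)) +ₚ r′             ∎)
    where open ≗-Reasoning

  -- Synthetic division: these Horner values are the coefficients of the quotient of `a ∷ f` by X -
  -- β, for any a.
  synth : Poly → Carrier → Poly
  synth []      β = []
  synth (b ∷ f) β = eval (b ∷ f) β ∷ synth f β

  synthetic-division : ∀ a f β → a ∷ f ≗ (X- β) *ₚ synth f β +ₚ (eval (a ∷ f) β ∷ [])
  synthetic-division a []      β = ⟨ (λ { zero → sym (trans (+-identityˡ _) (trans (+-congˡ (zeroʳ β)) (+-identityʳ a)))
                                        ; (suc zero) → refl ; (suc (suc n)) → refl }) ⟩
  synthetic-division a (b ∷ f) β = begin
    a ∷ b ∷ f                                       ≈⟨ ∷-cong (solve 3 (λ a β e → a := :- β :* e :+ (a :+ β :* e)) refl a β e)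
                                                              (≗-trans (synthetic-division b f β) (+ₚ-comm w (e ∷ []))) ⟩
    (- β * e + (a + β * e)) ∷ ((e ∷ []) +ₚ w)       ≈⟨ ∷-cong refl (+ₚ-identityʳ _) ⟨
    ((- β * e) ∷ ((e ∷ []) +ₚ w)) +ₚ (a + β * e ∷ [])
                                                    ≈⟨ +ₚ-congʳ (a + β * e ∷ []) step ⟨
    (X- β) *ₚ (e ∷ synth f β) +ₚ (a + β * e ∷ [])   ∎
    where
    open ≗-Reasoning
    e = eval (b ∷ f) β
    w = (X- β) *ₚ synth f β
    step : (X- β) *ₚ (e ∷ synth f β) ≗ (- β * e) ∷ ((e ∷ []) +ₚ w)
    step = ≗-trans (*ₚ-∷ (X- β) e (synth f β))
      (∷-cong (trans (+-identityʳ _) (*-comm e (- β))) (+ₚ-congʳ w (∷-cong (*-identityʳ e) ≗-refl)))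

  factor-root : ∀ a f β → eval (a ∷ f) β ≈ 0# → a ∷ f ≗ (X- β) *ₚ synth f β
  factor-root a f β eq = ≗-trans (synthetic-division a f β)
    (≗-trans (+ₚ-cong (≗-refl {(X- β) *ₚ synth f β}) (∷-≗[] eq ≗-refl)) (+ₚ-identityʳ _))

  synth-monic : ∀ ks β → ∃[ ks′ ] length ks′ ≡ length ks × synth (ks ∷ʳ 1#) β ≗ ks′ ∷ʳ 1#
  synth-monic []       β = [] , ≡.refl , ∷-cong (trans (+-congˡ (zeroʳ β)) (+-identityʳ 1#)) ≗-refl
  synth-monic (l ∷ ks) β with ks′ , len , eq ← synth-monic ks β =
    eval (l ∷ ks ∷ʳ 1#) β ∷ ks′ , ≡.cong suc len , ∷-cong refl eq

  eval-X- : ∀ β x → eval (X- β) x ≈ x + - β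
  eval-X- β x = trans (+-congˡ (trans (*-congˡ (trans (+-congˡ (zeroʳ x)) (+-identityʳ 1#))) (*-identityʳ x))) (+-comm _ x)

  eval-X-* : ∀ β f x → eval ((X- β) *ₚ f) x ≈ (x + - β) * eval f x
  eval-X-* β f x = trans (eval-*ₚ (X- β) f x) (*-congʳ (eval-X- β x))

  X-_-cong : ∀ {α β} → α ≈ β → X- α ≗ X- β
  X-_-cong α≈β = ∷-cong (-‿cong α≈β) ≗-refl

  SplitMonic : ∀ {t} (P : Carrier → Set t) → Poly → Set (c ⊔ ℓ₁ ⊔ t)
  SplitMonic P f = ∃[ αs ] All P αs × f ≗ ∏X- αs

  root-of-∏ : ∀ E αs → All (_∈ₛ E) αs → eval (∏X- αs) x ≈ 0# → x ∈ₛ E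
  root-of-∏ E []       []         eq = contradiction (trans (sym (trans (+-congˡ (zeroʳ _)) (+-identityʳ 1#))) eq) 1≉0
  root-of-∏ {x} E (α ∷ αs) (α∈ ∷ αs∈) eq with zero-product (trans (sym (eval-X-* α (∏X- αs) x)) eq)
  ... | inj₁ x-α≈0 = Subfield.≈-closed E (sym (x∙y⁻¹≈ε⇒x≈y x α x-α≈0)) α∈
  ... | inj₂ ∏≈0   = root-of-∏ E αs αs∈ ∏≈0

  cancel-cofactor : ∀ f s r → ¬ f ≗ [] → f ≗ (s *ₚ f) *ₚ r → s *ₚ r ≗ 1# ∷ []
  cancel-cofactor f s r f≉0 eq = Cofactors.1-x≈0 polynomialRing (s *ₚ r)
    (*ₚ-cancel-0 f ((1# ∷ []) +ₚ negate (s *ₚ r)) f≉0 (Cofactors.cofactor-difference polynomialRing f s r eq))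

-- Minimal polynomials, conjugates and multiple roots

module MinimalPolynomials (em : ∀ {a : Level} → ExcludedMiddle a)
  {c ℓ₁ ℓ₂ : Level} (K̄ : HeytingField c ℓ₁ ℓ₂) where

  open PolynomialsOverSubfields em K̄ public
  open Relation.Binary.Reasoning.Setoid setoid

  private
    variable
      E K L M : Subfield
      x y α β γ : Carrier
      f g h : Poly

    v : Level
    v = c ⊔ ℓ₁ ⊔ ℓ₂

  Algebraic : Subfield → Carrier → Set v
  Algebraic E α = ∃[ f ] f ∈[X] E × ¬ f ≗ [] × eval f α ≈ 0#

  -- Minimality is phrased by list length: no nonzero list with at most `degree` entries vanishes at
  -- α. This is the independence of 1, α, ..., αᵈ⁻¹, and division derives divisibility and
  -- irreducibility from it.
  record MinPoly (E : Subfield) (α : Carrier) : Set v where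
    field
      lower   : Poly
      lower∈  : lower ∈[X] E
      root    : eval (lower ∷ʳ 1#) α ≈ 0#
      minimal : g ∈[X] E → length g ≤ length lower → eval g α ≈ 0# → g ≗ []

    poly : Poly
    poly = lower ∷ʳ 1#

    poly∈ : poly ∈[X] E
    poly∈ = All.∷ʳ⁺ lower∈ (Subfield.1-closed E)

    degree : ℕ
    degree = length lower

  minPoly : Algebraic E α → MinPoly E α
  minPoly {E} {α} (f , f∈ , f≉0 , fα≈0) = fromLeast (let ks , ks∈ , ksα , _ = monic f f≉0 f∈ fα≈0 in
      least (λ d → ∃[ ks ] ks ∈[X] E × eval (ks ∷ʳ 1#) α ≈ 0# × length ks ≡ d) (length ks) (ks , ks∈ , ksα , ≡.refl))
    where
    monic : ∀ g → ¬ g ≗ [] → g ∈[X] E → eval g α ≈ 0# →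
            ∃[ ks ] ks ∈[X] E × eval (ks ∷ʳ 1#) α ≈ 0# × length ks < length g
    monic g g≉0 g∈ gα≈0 with a , ks , a∈ , a≉0 , ks∈ , len , eq ← monic-form {E = E} g g≉0 g∈ =
      ks , ks∈ , *-cancel-0 a≉0 (trans (sym (eval-scale a (ks ∷ʳ 1#) α))
        (trans (sym (eval-cong g (scale a (ks ∷ʳ 1#)) α eq)) gα≈0)) , len
    fromLeast : (∃[ d ] (∃[ ks ] ks ∈[X] E × eval (ks ∷ʳ 1#) α ≈ 0# × length ks ≡ d) ×
                  (∀ k → k < d → ¬ (∃[ ks ] ks ∈[X] E × eval (ks ∷ʳ 1#) α ≈ 0# × length ks ≡ k))) → MinPoly E α
    fromLeast (_ , (ks , ks∈ , ksα , ≡.refl) , smallest) = record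
      { lower = ks ; lower∈ = ks∈ ; root = ksα
      ; minimal = λ {g} g∈ len gα≈0 → decidable-stable em λ g≉0 →
          let ls , ls∈ , lsα , lt = monic g g≉0 g∈ gα≈0 in
          smallest (length ls) (ℕ.<-≤-trans lt len) (ls , ls∈ , lsα , ≡.refl) }

  take-≗ : ∀ d f → (∀ n → d ≤ n → coeff f n ≈ 0#) → take d f ≗ f
  take-≗ zero    f       zeros = ⟨ (λ n → sym (zeros n z≤n)) ⟩
  take-≗ (suc d) []      zeros = ≗-refl
  take-≗ (suc d) (a ∷ f) zeros = ∷-cong refl (take-≗ d f (λ n d≤n → zeros (suc n) (s≤s d≤n)))

  module _ {E α} (m : MinPoly E α) where

    open MinPoly m

    -- Meant for lists that are too long only because of zeros at the end, such as the derivative of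
    -- `poly`, which `D` leaves as long as `poly`.
    minimal-coeffs : g ∈[X] E → (∀ n → degree ≤ n → coeff g n ≈ 0#) → eval g α ≈ 0# → g ≗ []
    minimal-coeffs {g} g∈ zeros gα≈0 = ≗-trans (≗-sym trunc)
      (minimal (All.take⁺ degree g∈) (≡.subst (_≤ degree) (≡.sym (length-take degree g)) (ℕ.m⊓n≤m degree (length g)))
        (trans (eval-cong (take degree g) g α trunc) gα≈0))
      where
      trunc : take degree g ≗ g
      trunc = take-≗ degree g zeros

    minPoly-∣ : g ∈[X] E → eval g α ≈ 0# → ∃[ s ] s ∈[X] E × g ≗ s *ₚ poly
    minPoly-∣ {g} g∈ gα≈0 with s , r , s∈ , r∈ , len , eq ← divide {E = E} lower lower∈ g g∈ =
      s , s∈ , ≗-trans eq (≗-trans (+ₚ-congˡ (s *ₚ poly) (minimal r∈ (ℕ.≤-reflexive len) rα≈0)) (+ₚ-identityʳ _))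
      where
      rα≈0 : eval r α ≈ 0#
      rα≈0 = begin
        eval r α                            ≈⟨ +-identityˡ _ ⟨
        0# + eval r α                       ≈⟨ +-congʳ (trans (*-congˡ root) (zeroʳ (eval s α))) ⟨
        eval s α * eval poly α + eval r α   ≈⟨ +-congʳ (eval-*ₚ s poly α) ⟨
        eval (s *ₚ poly) α + eval r α       ≈⟨ eval-+ₚ (s *ₚ poly) r α ⟨
        eval (s *ₚ poly +ₚ r) α             ≈⟨ eval-cong g _ α eq ⟨
        eval g α                            ≈⟨ gα≈0 ⟩
        0#                                  ∎

    minPoly-nonunit : ¬ UnitOver E poly
    minPoly-nonunit (t , t∈ , tm≗1) = 1≉0 (begin
      1#                      ≈⟨ trans (+-congˡ (zeroʳ α)) (+-identityʳ 1#) ⟨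
      eval (1# ∷ []) α        ≈⟨ eval-cong (t *ₚ poly) (1# ∷ []) α tm≗1 ⟨
      eval (t *ₚ poly) α      ≈⟨ eval-*ₚ t poly α ⟩
      eval t α * eval poly α  ≈⟨ *-congˡ root ⟩
      eval t α * 0#           ≈⟨ zeroʳ _ ⟩
      0#                      ∎)

    minPoly-irreducible : IrreducibleOver E poly
    minPoly-irreducible = minPoly-nonunit , split
      where
      split : ∀ {q r} → q ∈[X] E → r ∈[X] E → poly ≗ q *ₚ r → UnitOver E q ⊎ UnitOver E r
      split {q} {r} q∈ r∈ eq
        with zero-product (trans (sym (eval-*ₚ q r α)) (trans (sym (eval-cong poly (q *ₚ r) α eq)) root))
      ... | inj₁ qα≈0 with s , s∈ , q≗sm ← minPoly-∣ q∈ qα≈0 =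
            inj₂ (s , s∈ , cancel-cofactor poly s r (monic-≉[] lower) (≗-trans eq (*ₚ-congʳ q≗sm r)))
      ... | inj₂ rα≈0 with s , s∈ , r≗sm ← minPoly-∣ r∈ rα≈0 =
            inj₁ (s , s∈ , cancel-cofactor poly s q (monic-≉[] lower) (≗-trans eq (≗-trans (*ₚ-comm q r) (*ₚ-congʳ r≗sm q))))

    -- f = s · `poly` with `poly` not a unit, so irreducibility makes s a unit, which can be moved
    -- to the other side.
    irreducible-∣-minPoly : f ∈[X] E → IrreducibleOver E f → eval f α ≈ 0# → ∃[ t ] poly ≗ t *ₚ f
    irreducible-∣-minPoly {f} f∈ (_ , split) fα≈0 with s , s∈ , f≗sm ← minPoly-∣ f∈ fα≈0 with split s∈ poly∈ f≗sm
    ... | inj₂ m-unit = contradiction m-unit minPoly-nonunit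
    ... | inj₁ (t , t∈ , ts≗1) = t , Cofactors.unit-cofactor polynomialRing t s ts≗1 f≗sm

    ∣-root : ∀ s → g ≗ s *ₚ f → eval f γ ≈ 0# → eval g γ ≈ 0#
    ∣-root {g} {f} {γ} s eq fγ≈0 = trans (eval-cong g (s *ₚ f) γ eq) (trans (eval-*ₚ s f γ) (trans (*-congˡ fγ≈0) (zeroʳ _)))

    -- This stands in for an embedding that takes α to γ. `poly` is a multiple of f and g a multiple
    -- of `poly`, so every zero of f is one of g.
    conjugate-root : f ∈[X] E → IrreducibleOver E f → eval f α ≈ 0# → eval f γ ≈ 0# →
                     g ∈[X] E → eval g α ≈ 0# → eval g γ ≈ 0#
    conjugate-root f∈ irr fα≈0 fγ≈0 g∈ gα≈0
      with t , m≗tf ← irreducible-∣-minPoly f∈ irr fα≈0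
      with s , s∈ , g≗sm ← minPoly-∣ g∈ gα≈0 = ∣-root s g≗sm (∣-root t m≗tf fγ≈0)

  noMultipleRoots-∣ : ∀ s → h ≗ s *ₚ g → NoMultipleRoots h → NoMultipleRoots g
  noMultipleRoots-∣ {h} {g} s eq simple β (q RawMagma., qr≈g) =
    simple β (s *ₚ q RawMagma., coeffs (≗-trans (*ₚ-assoc s q _) (≗-trans (*ₚ-congˡ s ⟨ qr≈g ⟩) (≗-sym eq))))

  minPoly-separable : (m : MinPoly E α) → NoMultipleRoots (MinPoly.poly m) → SeparableOver E α
  minPoly-separable {E} {α} m simple = lift E poly∈
    , ( (degree
        , ≡.subst (_≈ 1#) (≡.sym (coeff-lift degree)) (reflexive (coeff-monic lower))
        , λ n d<n → ≡.subst (_≈ 0#) (≡.sym (coeff-lift n))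
            (reflexive (coeff-beyond poly n (≡.subst (_≤ n) (≡.sym (length-∷ʳ lower 1#)) d<n))))
      , irreducible-lift E poly∈ (minPoly-irreducible m)
      , ≡.subst (λ g → eval g α ≈ 0#) (≡.sym (embed-lift E poly∈)) root )
    , ≡.subst NoMultipleRoots (≡.sym (embed-lift E poly∈)) simple
    where
    open MinPoly m
    coeff-lift : ∀ n → proj₁ (Over.coeff E (lift E poly∈) n) ≡ coeff poly n
    coeff-lift n = ≡.trans (embed-coeff E (lift E poly∈) n) (≡.cong (λ g → coeff g n) (embed-lift E poly∈))

  factor-monic : ∀ k ks β → eval (k ∷ ks ∷ʳ 1#) β ≈ 0# →
                 ∃[ ls ] length ls ≡ length ks × k ∷ ks ∷ʳ 1# ≗ (X- β) *ₚ (ls ∷ʳ 1#)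
  factor-monic k ks β root with ls , len , eq ← synth-monic ks β =
    ls , len , ≗-trans (factor-root k (ks ∷ʳ 1#) β root) (*ₚ-congˡ (X- β) eq)

  factor-∣-root : ∀ f g → f ≗ (X- β) *ₚ g → eval g γ ≈ 0# → eval f γ ≈ 0#
  factor-∣-root {β} {γ} f g eq root = trans (eval-cong f ((X- β) *ₚ g) γ eq)
    (trans (eval-X-* β g γ) (trans (*-congˡ root) (zeroʳ _)))

  square-∣ : ∀ f g h → f ≗ (X- α) *ₚ g → g ≗ (X- α) *ₚ h → ((X- α) *ₚ (X- α)) K̄[X].∣ f
  square-∣ {α} f g h f≗ g≗ = h RawMagma., coeffs (Cofactors.square-factor polynomialRing {f} {g} (X- α) h f≗ g≗)

  -- Splitting over an algebraically closed field

  AlgebraicallyClosed : Set (c ⊔ ℓ₁)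
  AlgebraicallyClosed = ∀ f → K̄[X].NonConstant f → ∃[ α ] eval f α ≈ 0#

  module _ (closed : AlgebraicallyClosed) where

    monic-root : ∀ k ks → ∃[ α ] eval (k ∷ ks ∷ʳ 1#) α ≈ 0#
    monic-root k ks = closed (k ∷ ks ∷ʳ 1#) (length ks , λ eq → 1≉0 (trans (reflexive (≡.sym (coeff-monic ks))) eq))

    -- The degree d drives the recursion, as the coefficients change with each linear factor split
    -- off; every root of a cofactor is a root of the original, so P descends.
    split-monic : ∀ {t} {P : Carrier → Set t} d ks → length ks ≡ d →
                  (∀ γ → eval (ks ∷ʳ 1#) γ ≈ 0# → P γ) → SplitMonic P (ks ∷ʳ 1#)
    split-monic d       []       len roots = [] , [] , ≗-refl
    split-monic (suc d) (k ∷ ks) len roots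
      with β , root ← monic-root k ks
      with ls , len′ , eq ← factor-monic k ks β root
      with αs , pαs , eq′ ← split-monic d ls (≡.trans len′ (ℕ.suc-injective len))
             (λ γ γ-root → roots γ (factor-∣-root (k ∷ ks ∷ʳ 1#) (ls ∷ʳ 1#) eq γ-root))
      = β ∷ αs , roots β root ∷ pαs , ≗-trans eq (*ₚ-congˡ (X- β) eq′)

    splits : E ⊑ M → f ∈[X] E → ¬ f ≗ [] → (∀ {γ} → eval f γ ≈ 0# → γ ∈ₛ M) → SplitsIn M f
    splits {E} {M} {f} E⊑M f∈ f≉0 roots
      with a , ks , a∈ , a≉0 , ks∈ , _ , eq ← monic-form {E = E} f f≉0 f∈
      with αs , αs∈ , eq′ ← split-monic (length ks) ks ≡.refl (λ γ γ-root → roots (begin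
        eval f γ                       ≈⟨ eval-cong f (scale a (ks ∷ʳ 1#)) γ eq ⟩
        eval (scale a (ks ∷ʳ 1#)) γ    ≈⟨ eval-scale a (ks ∷ʳ 1#) γ ⟩
        a * eval (ks ∷ʳ 1#) γ          ≈⟨ *-congˡ γ-root ⟩
        a * 0#                         ≈⟨ zeroʳ a ⟩
        0#                             ∎))
      = a , αs , E⊑M a∈ , αs∈ , coeffs (≗-trans eq (≗-trans (≗-sym (constant-*ₚ a (ks ∷ʳ 1#))) (*ₚ-congˡ (a ∷ []) eq′)))

    -- In degree 2 or more, dividing by X - α leaves a nonconstant cofactor. Its roots equal α too,
    -- so (X - α)² divides the polynomial. Degree 0 has no root, and degree 1 gives α = -k.
    unique-root⇒∈ : (m : MinPoly E α) → NoMultipleRoots (MinPoly.poly m) →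
                    (∀ {β} → eval (MinPoly.poly m) β ≈ 0# → β ≈ α) → α ∈ₛ E
    unique-root⇒∈ {E} {α} m simple unique = go (MinPoly.lower m) (MinPoly.lower∈ m) (MinPoly.root m) simple unique
      where
      go : ∀ ks → ks ∈[X] E → eval (ks ∷ʳ 1#) α ≈ 0# → NoMultipleRoots (ks ∷ʳ 1#) →
           (∀ {β} → eval (ks ∷ʳ 1#) β ≈ 0# → β ≈ α) → α ∈ₛ E
      go [] _ root _ _ = contradiction (trans (sym (trans (+-congˡ (zeroʳ α)) (+-identityʳ 1#))) root) 1≉0
      go (k ∷ []) (k∈ ∷ []) root _ _ = Subfield.≈-closed E (sym (+-inverseʳ-unique k α (begin
        k + α                    ≈⟨ +-congˡ (*-identityʳ α) ⟨
        k + α * 1#               ≈⟨ +-congˡ (*-congˡ (trans (+-congˡ (zeroʳ α)) (+-identityʳ 1#))) ⟨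
        k + α * (1# + α * 0#)    ≈⟨ root ⟩
        0#                       ∎))) (Subfield.neg-closed E k∈)
      go (k ∷ l ∷ ks) _ root simple unique with factor-monic k (l ∷ ks) α root
      ... | j ∷ js , _ , eq with β , β-root ← monic-root j js =
        contradiction (square-∣ (k ∷ l ∷ ks ∷ʳ 1#) (j ∷ js ∷ʳ 1#) (synth (js ∷ʳ 1#) α) eq (factor-root j (js ∷ʳ 1#) α
            (trans (eval-point (j ∷ js ∷ʳ 1#) (sym (unique (factor-∣-root (k ∷ l ∷ ks ∷ʳ 1#) (j ∷ js ∷ʳ 1#) eq β-root)))) β-root)))
          (simple α)

  normal-root : Normal K M → ∀ {α γ} → α ∈ₛ M → (m : MinPoly K α) → eval (MinPoly.poly m) γ ≈ 0# → γ ∈ₛ M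
  normal-root {K} {M} normal {α} {γ} α∈ m γ-root
    with a , αs , a∈ , αs∈ , eq ← normal (lift K (MinPoly.poly∈ m)) (irreducible-lift K (MinPoly.poly∈ m) (minPoly-irreducible m)) α∈
           (≡.subst (λ g → eval g α ≈ 0#) (≡.sym (embed-lift K (MinPoly.poly∈ m))) (MinPoly.root m))
    = root-of-∏ M αs αs∈ (*-cancel-0 a≉0 (begin
        a * eval (∏X- αs) γ          ≈⟨ eval-scale a (∏X- αs) γ ⟨
        eval (scale a (∏X- αs)) γ    ≈⟨ eval-cong poly _ γ poly≗ ⟨
        eval poly γ                  ≈⟨ γ-root ⟩
        0#                           ∎))
    where
    open MinPoly m
    poly≗ : poly ≗ scale a (∏X- αs)
    poly≗ = ≗-trans (≗-reflexive (≡.sym (embed-lift K poly∈))) (≗-trans ⟨ eq ⟩ (constant-*ₚ a (∏X- αs)))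
    a≉0 : ¬ a ≈ 0#
    a≉0 a≈0 = monic-≉[] lower (≗-trans poly≗ (scale-0 a≈0 (∏X- αs)))

  monomial : ℕ → Poly
  monomial zero    = 1# ∷ []
  monomial (suc n) = 0# ∷ monomial n

  eval-monomial : ∀ n x → eval (monomial n) x ≈ x ^ n
  eval-monomial zero    x = trans (+-congˡ (zeroʳ x)) (+-identityʳ 1#)
  eval-monomial (suc n) x = trans (+-identityˡ _) (*-congˡ (eval-monomial n x))

  monomial-∈ : ∀ E n → monomial n ∈[X] E
  monomial-∈ E zero    = Subfield.1-closed E ∷ []
  monomial-∈ E (suc n) = Subfield.0-closed E ∷ monomial-∈ E n

  abstract

    -- The polynomial f(X^q), by which an equation for φ n α becomes one for α.
    inflate : ℕ → Poly → Poly
    inflate q []      = []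
    inflate q (a ∷ f) = (a ∷ []) +ₚ monomial q *ₚ inflate q f

    eval-inflate : ∀ q f x → eval (inflate q f) x ≈ eval f (x ^ q)
    eval-inflate q []      x = refl
    eval-inflate q (a ∷ f) x = trans (eval-+ₚ (a ∷ []) (monomial q *ₚ inflate q f) x)
      (+-cong (trans (+-congˡ (zeroʳ x)) (+-identityʳ a))
        (trans (eval-*ₚ (monomial q) (inflate q f) x) (*-cong (eval-monomial q x) (eval-inflate q f x))))

    inflate-∈ : ∀ E q → f ∈[X] E → inflate q f ∈[X] E
    inflate-∈ E q []        = []
    inflate-∈ E q (a∈ ∷ f∈) = +ₚ-∈ E (a∈ ∷ []) (*ₚ-∈ E (monomial-∈ E q) (inflate-∈ E q f∈))

  -- Derivatives

  D : Poly → Poly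
  D []      = []
  D (a ∷ f) = f +ₚ (0# ∷ D f)

  coeff-D : ∀ f n → coeff (D f) n ≈ suc n · coeff f (suc n)
  coeff-D []      n       = sym (·-0 (suc n))
    where
    ·-0 : ∀ n → n · 0# ≈ 0#
    ·-0 zero    = refl
    ·-0 (suc n) = trans (+-identityˡ _) (·-0 n)
  coeff-D (a ∷ f) zero    = coeff-+ₚ f (0# ∷ D f) 0
  coeff-D (a ∷ f) (suc n) = trans (coeff-+ₚ f (0# ∷ D f) (suc n)) (+-congˡ (coeff-D f n))

  D-cong : f ≗ g → D f ≗ D g
  D-cong {f} {g} eq = ⟨ (λ n → trans (coeff-D f n) (trans (×-congʳ (suc n) (coeffs eq (suc n))) (sym (coeff-D g n)))) ⟩

  D-∈ : ∀ E → f ∈[X] E → D f ∈[X] E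
  D-∈ E []        = []
  D-∈ E (a∈ ∷ f∈) = +ₚ-∈ E f∈ (Subfield.0-closed E ∷ D-∈ E f∈)

  eval-D-∷ : ∀ a f x → eval (D (a ∷ f)) x ≈ eval f x + x * eval (D f) x
  eval-D-∷ a f x = trans (eval-+ₚ f (0# ∷ D f) x) (+-congˡ (+-identityˡ _))

  eval-D-+ₚ : ∀ f g x → eval (D (f +ₚ g)) x ≈ eval (D f) x + eval (D g) x
  eval-D-+ₚ []      g       x = sym (+-identityˡ _)
  eval-D-+ₚ (a ∷ f) []      x = sym (+-identityʳ _)
  eval-D-+ₚ (a ∷ f) (b ∷ g) x = begin
    eval (D (a + b ∷ f +ₚ g)) x                                     ≈⟨ eval-D-∷ (a + b) (f +ₚ g) x ⟩
    eval (f +ₚ g) x + x * eval (D (f +ₚ g)) x                       ≈⟨ +-cong (eval-+ₚ f g x) (*-congˡ (eval-D-+ₚ f g x)) ⟩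
    (eval f x + eval g x) + x * (eval (D f) x + eval (D g) x)       ≈⟨ solve 5 (λ x f g f′ g′ → (f :+ g) :+ x :* (f′ :+ g′) := (f :+ x :* f′) :+ (g :+ x :* g′)) refl x (eval f x) (eval g x) (eval (D f) x) (eval (D g) x) ⟩
    (eval f x + x * eval (D f) x) + (eval g x + x * eval (D g) x)   ≈⟨ +-cong (eval-D-∷ a f x) (eval-D-∷ b g x) ⟨
    eval (D (a ∷ f)) x + eval (D (b ∷ g)) x                         ∎

  eval-D-scale : ∀ a f x → eval (D (scale a f)) x ≈ a * eval (D f) x
  eval-D-scale a []      x = sym (zeroʳ a)
  eval-D-scale a (b ∷ f) x = begin
    eval (D (a * b ∷ scale a f)) x                      ≈⟨ eval-D-∷ (a * b) (scale a f) x ⟩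
    eval (scale a f) x + x * eval (D (scale a f)) x     ≈⟨ +-cong (eval-scale a f x) (*-congˡ (eval-D-scale a f x)) ⟩
    a * eval f x + x * (a * eval (D f) x)               ≈⟨ solve 4 (λ a x f f′ → a :* f :+ x :* (a :* f′) := a :* (f :+ x :* f′)) refl a x (eval f x) (eval (D f) x) ⟩
    a * (eval f x + x * eval (D f) x)                   ≈⟨ *-congˡ (eval-D-∷ b f x) ⟨
    a * eval (D (b ∷ f)) x                              ∎

  -- Stated for values at a point: multiple roots are detected by values, and the identity can then
  -- be solved in the field.
  leibniz : ∀ f g x → eval (D (f *ₚ g)) x ≈ eval (D f) x * eval g x + eval f x * eval (D g) x
  leibniz []      g x = sym (trans (+-cong (zeroˡ _) (zeroˡ _)) (+-identityˡ 0#))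
  leibniz (a ∷ f) g x = begin
    eval (D (scale a g +ₚ (0# ∷ f *ₚ g))) x                ≈⟨ eval-D-+ₚ (scale a g) (0# ∷ f *ₚ g) x ⟩
    eval (D (scale a g)) x + eval (D (0# ∷ f *ₚ g)) x      ≈⟨ +-cong (eval-D-scale a g x) (eval-D-∷ 0# (f *ₚ g) x) ⟩
    a * g′ + (eval (f *ₚ g) x + x * eval (D (f *ₚ g)) x)   ≈⟨ +-congˡ (+-cong (eval-*ₚ f g x) (*-congˡ (leibniz f g x))) ⟩
    a * g′ + (f₀ * g₀ + x * (f′ * g₀ + f₀ * g′))           ≈⟨ solve 6 (λ a x f₀ f′ g₀ g′ → a :* g′ :+ (f₀ :* g₀ :+ x :* (f′ :* g₀ :+ f₀ :* g′)) :=
                                                                (f₀ :+ x :* f′) :* g₀ :+ (a :+ x :* f₀) :* g′) refl a x f₀ f′ g₀ g′ ⟩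
    (f₀ + x * f′) * g₀ + (a + x * f₀) * g′                 ≈⟨ +-congʳ (*-congʳ (eval-D-∷ a f x)) ⟨
    eval (D (a ∷ f)) x * g₀ + eval (a ∷ f) x * g′          ∎
    where
    f₀ = eval f x
    f′ = eval (D f) x
    g₀ = eval g x
    g′ = eval (D g) x

  multiple-root : ∀ q → q *ₚ ((X- β) *ₚ (X- β)) ≗ f → eval f β ≈ 0# × eval (D f) β ≈ 0#
  multiple-root {β} {f} q eq
    = trans (eval-cong f _ β (≗-sym eq)) (trans (eval-*ₚ q s² β) (trans (*-congˡ s²≈0) (zeroʳ _)))
    , (begin
      eval (D f) β                                          ≈⟨ eval-cong (D f) (D (q *ₚ s²)) β (D-cong (≗-sym eq)) ⟩
      eval (D (q *ₚ s²)) β                                  ≈⟨ leibniz q s² β ⟩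
      eval (D q) β * eval s² β + eval q β * eval (D s²) β   ≈⟨ +-cong (*-congˡ s²≈0) (*-congˡ s²′≈0) ⟩
      eval (D q) β * 0# + eval q β * 0#                     ≈⟨ +-cong (zeroʳ _) (zeroʳ _) ⟩
      0# + 0#                                               ≈⟨ +-identityˡ 0# ⟩
      0#                                                    ∎)
    where
    s² = (X- β) *ₚ (X- β)
    s≈0 : eval (X- β) β ≈ 0#
    s≈0 = trans (eval-X- β β) (-‿inverseʳ β)
    s²≈0 : eval s² β ≈ 0#
    s²≈0 = trans (eval-*ₚ (X- β) (X- β) β) (trans (*-congˡ s≈0) (zeroʳ _))
    s²′≈0 : eval (D s²) β ≈ 0#
    s²′≈0 = trans (leibniz (X- β) (X- β) β) (trans (+-cong (trans (*-congˡ s≈0) (zeroʳ _)) (trans (*-congʳ s≈0) (zeroˡ _))) (+-identityˡ 0#))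

  square-∣⇒roots : ∀ f → ((X- β) *ₚ (X- β)) K̄[X].∣ f → eval f β ≈ 0# × eval (D f) β ≈ 0#
  square-∣⇒roots {β} f (q RawMagma., eq) = multiple-root {β} {f} q ⟨ eq ⟩

-- Polynomials in X^p, fields given as spans, and Frobenius descent

module FrobeniusMethods (em : ∀ {a : Level} → ExcludedMiddle a)
  {c ℓ₁ ℓ₂ : Level} (K̄ : HeytingField c ℓ₁ ℓ₂) where

  open MinimalPolynomials em K̄ public
  open Relation.Binary.Reasoning.Setoid setoid
  open Basis

  private
    variable
      E K L M : Subfield
      x y α β γ : Carrier
      f g h : Poly
      us vs ws : List Carrier

    v : Level
    v = c ⊔ ℓ₁ ⊔ ℓ₂

  -- Powers of an element and polynomials whose exponents are multiples of a fixed number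

  powers : Carrier → Carrier → ℕ → List Carrier
  powers a x zero    = []
  powers a x (suc n) = a ∷ powers (a * x) x n

  length-powers : ∀ a x n → length (powers a x n) ≡ n
  length-powers a x zero    = ≡.refl
  length-powers a x (suc n) = ≡.cong suc (length-powers (a * x) x n)

  powers-∈ : ∀ E {a} n → a ∈ₛ E → x ∈ₛ E → All (_∈ₛ E) (powers a x n)
  powers-∈ E zero    a∈ x∈ = []
  powers-∈ E (suc n) a∈ x∈ = a∈ ∷ powers-∈ E n (Subfield.*-closed E a∈ x∈) x∈

  ≗[]⇒All : f ≗ [] → All (_≈ 0#) f
  ≗[]⇒All {[]}    eq = []
  ≗[]⇒All {a ∷ f} eq = coeffs eq 0 ∷ ≗[]⇒All (tail-≗[] eq)

  All⇒≗[] : All (_≈ 0#) f → f ≗ []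
  All⇒≗[] []       = ≗-refl
  All⇒≗[] (z ∷ zs) = ∷-≗[] z (All⇒≗[] zs)

  module Decimation (q : ℕ) where

    p : ℕ
    p = suc q

    -- Keeps the entries at k, k + p, k + 2p, ...; the counter restarts at q = p - 1 after each.
    -- When f is a polynomial in X^p, the case k = 0 returns the g with f = g(X^p).
    decimate : ℕ → Poly → Poly
    decimate k       []      = []
    decimate zero    (a ∷ f) = a ∷ decimate q f
    decimate (suc k) (a ∷ f) = decimate k f

    Sparse : ℕ → Poly → Set ℓ₁
    Sparse k f = ∀ n → (∀ j → n ≢ k ℕ.+ j ℕ.* p) → coeff f n ≈ 0#

    eval-decimate : ∀ k f x → Sparse k f → eval f x ≈ x ^ k * eval (decimate k f) (x ^ p)
    eval-decimate k [] x sparse = sym (zeroʳ _)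
    eval-decimate zero (a ∷ f) x sparse = begin
      a + x * eval f x                                      ≈⟨ +-congˡ (*-congˡ (eval-decimate q f x sparse′)) ⟩
      a + x * (x ^ q * eval (decimate q f) (x ^ p))         ≈⟨ +-congˡ (*-assoc x (x ^ q) _) ⟨
      a + x ^ p * eval (decimate q f) (x ^ p)               ≈⟨ *-identityˡ _ ⟨
      1# * (a + x ^ p * eval (decimate q f) (x ^ p))        ∎
      where
      sparse′ : Sparse q f
      sparse′ n n≢ = sparse (suc n) λ { zero () ; (suc j) eq → n≢ j (ℕ.suc-injective eq) }
    eval-decimate (suc k) (a ∷ f) x sparse = begin
      a + x * eval f x                                      ≈⟨ +-cong (sparse 0 λ j ()) (*-congˡ (eval-decimate k f x sparse′)) ⟩
      0# + x * (x ^ k * eval (decimate k f) (x ^ p))        ≈⟨ +-identityˡ _ ⟩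
      x * (x ^ k * eval (decimate k f) (x ^ p))             ≈⟨ *-assoc x (x ^ k) _ ⟨
      x ^ suc k * eval (decimate k f) (x ^ p)               ∎
      where
      sparse′ : Sparse k f
      sparse′ n n≢ = sparse (suc n) λ j eq → n≢ j (ℕ.suc-injective eq)

    coeff-decimate : ∀ k f j → coeff (decimate k f) j ≡ coeff f (k ℕ.+ j ℕ.* p)
    coeff-decimate k       []      j       = ≡.refl
    coeff-decimate zero    (a ∷ f) zero    = ≡.refl
    coeff-decimate zero    (a ∷ f) (suc j) = coeff-decimate q f j
    coeff-decimate (suc k) (a ∷ f) j       = coeff-decimate k f j

    decimate-∈ : ∀ k → f ∈[X] E → decimate k f ∈[X] E
    decimate-∈ k       []        = []
    decimate-∈ {E = E} zero    (a∈ ∷ f∈) = a∈ ∷ decimate-∈ {E = E} q f∈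
    decimate-∈ {E = E} (suc k) (a∈ ∷ f∈) = decimate-∈ {E = E} k f∈

    length-decimate : ∀ k f → length (decimate k f) ≤ length f
    length-decimate k       []      = z≤n
    length-decimate zero    (a ∷ f) = s≤s (length-decimate q f)
    length-decimate (suc k) (a ∷ f) = ℕ.m≤n⇒m≤1+n (length-decimate k f)

  -- Here p ≥ 2, so the second entry is dropped and the list becomes strictly shorter.
  length-decimate-< : ∀ q a b f → length (Decimation.decimate (suc q) 0 (a ∷ b ∷ f)) ≤ length (b ∷ f)
  length-decimate-< q a b f = s≤s (Decimation.length-decimate (suc q) q f)

  -- Subfields that are spans

  module _ (E : Subfield) (vs : List Carrier) (one∈ : Span E vs 1#)
           (products∈ : All (λ u → All (λ w → Span E vs (u * w)) vs) vs)
           (inverse-power∈ : ∀ {x y} → Span E vs x → x * y ≈ 1# → ∃[ k ] Span E vs (y ^ suc k)) where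

    span-product : Span E vs x → Span E vs y → Span E vs (x * y)
    span-product {x} {y} x∈ y∈ = span-elim (right x) (All.map (λ {u} all → span-resp (*-comm u x) (span-elim (right u) all x∈)) products∈) y∈
      where
      right : ∀ x → IsSubspace E (λ y → Span E vs (x * y))
      right x = record
        { resp-closed  = λ y≈z → span-resp (*-congˡ y≈z)
        ; zero-closed  = span-resp (sym (zeroʳ x)) (span-0 vs)
        ; add-closed   = λ s t → span-resp (sym (distribˡ x _ _)) (span-+ s t)
        ; scale-closed = λ {_} {k} k∈ s → span-resp (solve 3 (λ k x y → k :* (x :* y) := x :* (k :* y)) refl k x _) (span-* k∈ s) }

    span-power : ∀ k → Span E vs x → Span E vs (x ^ k)
    span-power zero    x∈ = one∈
    span-power (suc k) x∈ = span-product x∈ (span-power k x∈)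

    -- An inverse y of x satisfies y = yᵏ⁺¹ xᵏ.
    span-inverse : ∀ {x y} → x * y ≈ 1# → Span E vs x → Span E vs y
    span-inverse {x} {y} xy≈1 x∈ with k , y^∈ ← inverse-power∈ x∈ xy≈1 = span-resp (begin
      y ^ suc k * x ^ k      ≈⟨ *-assoc y (y ^ k) (x ^ k) ⟩
      y * (y ^ k * x ^ k)    ≈⟨ *-congˡ (^-distrib-* y x k) ⟨
      y * (y * x) ^ k        ≈⟨ *-congˡ (^-congˡ k (trans (*-comm y x) xy≈1)) ⟩
      y * 1# ^ k             ≈⟨ trans (*-congˡ (1^ k)) (*-identityʳ y) ⟩
      y                      ∎)
      (span-product y^∈ (span-power k x∈))

    abstract

      -- For an inverse, only some positive power is assumed to lie in the span, because in both
      -- applications it is y^(pⁿ) that can be placed there.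
      spanField : Subfield
      spanField = record
        { member = Span E vs ; ≈-closed = span-resp ; 0-closed = span-0 vs ; 1-closed = one∈
        ; +-closed = span-+ ; *-closed = span-product ; neg-closed = span-neg ; inv-closed = span-inverse }

      span⇒∈ : Span E vs x → x ∈ₛ spanField
      span⇒∈ x∈ = x∈

      ∈⇒span : x ∈ₛ spanField → Span E vs x
      ∈⇒span x∈ = x∈

    spanField-⊒ : E ⊑ spanField
    spanField-⊒ x∈ = span⇒∈ (span-resp (*-identityʳ _) (span-* x∈ one∈))

  generated-⊑ : ∀ T → E ⊑ T → M ⊑ T → E ∙ M ⊑ T
  generated-⊑ T E⊑T M⊑T (gen (inj₁ x∈)) = E⊑T x∈
  generated-⊑ T E⊑T M⊑T (gen (inj₂ x∈)) = M⊑T x∈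
  generated-⊑ {E} {M} T E⊑T M⊑T (resp eq s)    = Subfield.≈-closed T eq (generated-⊑ {E} {M} T E⊑T M⊑T s)
  generated-⊑ T E⊑T M⊑T zro            = Subfield.0-closed T
  generated-⊑ T E⊑T M⊑T one            = Subfield.1-closed T
  generated-⊑ {E} {M} T E⊑T M⊑T (add s t)      = Subfield.+-closed T (generated-⊑ {E} {M} T E⊑T M⊑T s) (generated-⊑ {E} {M} T E⊑T M⊑T t)
  generated-⊑ {E} {M} T E⊑T M⊑T (mul s t)      = Subfield.*-closed T (generated-⊑ {E} {M} T E⊑T M⊑T s) (generated-⊑ {E} {M} T E⊑T M⊑T t)
  generated-⊑ {E} {M} T E⊑T M⊑T (neg s)        = Subfield.neg-closed T (generated-⊑ {E} {M} T E⊑T M⊑T s)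
  generated-⊑ {E} {M} T E⊑T M⊑T (inv eq s)     = Subfield.inv-closed T eq (generated-⊑ {E} {M} T E⊑T M⊑T s)

  -- Descent along Frobenius and MacLane's criterion

  module FrobeniusDescent (closed : AlgebraicallyClosed) {p : ℕ} (charExp : IsCharacteristicExponent p) where

    open Frobenius charExp public

    mapφ : ℕ → Poly → Poly
    mapφ n = map (φ n)

    φ-∈ : ∀ E n → x ∈ₛ E → φ n x ∈ₛ E
    φ-∈ E n = ^-closed E (p ℕ.^ n)

    coeff-mapφ : ∀ n f k → coeff (mapφ n f) k ≈ φ n (coeff f k)
    coeff-mapφ n []      k       = sym (φ-0 n)
    coeff-mapφ n (a ∷ f) zero    = refl
    coeff-mapφ n (a ∷ f) (suc k) = coeff-mapφ n f k

    mapφ-cong : ∀ n → f ≗ g → mapφ n f ≗ mapφ n g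
    mapφ-cong {f} {g} n eq = ⟨ (λ k → trans (coeff-mapφ n f k) (trans (φ-cong n (coeffs eq k)) (sym (coeff-mapφ n g k)))) ⟩

    mapφ-+ₚ : ∀ n f g → mapφ n (f +ₚ g) ≗ mapφ n f +ₚ mapφ n g
    mapφ-+ₚ n []      g       = ≗-refl
    mapφ-+ₚ n (a ∷ f) []      = ≗-refl
    mapφ-+ₚ n (a ∷ f) (b ∷ g) = ∷-cong (φ-+ n a b) (mapφ-+ₚ n f g)

    mapφ-scale : ∀ n a f → mapφ n (scale a f) ≗ scale (φ n a) (mapφ n f)
    mapφ-scale n a []      = ≗-refl
    mapφ-scale n a (b ∷ f) = ∷-cong (φ-* n a b) (mapφ-scale n a f)

    mapφ-*ₚ : ∀ n f g → mapφ n (f *ₚ g) ≗ mapφ n f *ₚ mapφ n g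
    mapφ-*ₚ n []      g = ≗-refl
    mapφ-*ₚ n (a ∷ f) g = ≗-trans (mapφ-+ₚ n (scale a g) (0# ∷ f *ₚ g))
      (+ₚ-cong (mapφ-scale n a g) (∷-cong (φ-0 n) (mapφ-*ₚ n f g)))

    mapφ-X- : ∀ n {α β} → φ n α ≈ β → mapφ n (X- α) ≗ X- β
    mapφ-X- n {α} φα≈β = ∷-cong (trans (φ-neg n α) (-‿cong φα≈β)) (∷-cong (φ-1 n) ≗-refl)

    eval-mapφ : ∀ n f x → eval (mapφ n f) (φ n x) ≈ φ n (eval f x)
    eval-mapφ n []      x = sym (φ-0 n)
    eval-mapφ n (a ∷ f) x = sym (trans (φ-+ n a _) (+-congˡ (trans (φ-* n x _) (*-congˡ (sym (eval-mapφ n f x))))))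

    -- `mapφ n` is multiplicative and takes X - β to X - φ n β, so a square factor of h yields one
    -- of its image.
    noMultipleRoots-mapφ : ∀ n h → mapφ n h ≗ g → NoMultipleRoots g → NoMultipleRoots h
    noMultipleRoots-mapφ {g} n h eq simple β (q RawMagma., qs²≈h) =
      simple (φ n β) (mapφ n q RawMagma., coeffs (chain (X- β) (X- φ n β) (mapφ-X- n refl) ⟨ qs²≈h ⟩))
      where
      chain : ∀ a b → mapφ n a ≗ b → q *ₚ (a *ₚ a) ≗ h → mapφ n q *ₚ (b *ₚ b) ≗ g
      chain a b φa≗b qa²≗h = ≗-trans (*ₚ-congˡ (mapφ n q) (≗-sym (≗-trans (mapφ-*ₚ n a a)
          (≗-trans (*ₚ-congʳ φa≗b (mapφ n a)) (*ₚ-congˡ b φa≗b)))))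
        (≗-trans (≗-sym (mapφ-*ₚ n q (a *ₚ a))) (≗-trans (mapφ-cong n qa²≗h) eq))

    abstract

      pure-equation : ℕ → Carrier → Poly
      pure-equation n α = monomial (p ℕ.^ n) +ₚ (- φ n α ∷ [])

      eval-pure-equation : ∀ n α x → eval (pure-equation n α) x ≈ φ n x + - φ n α
      eval-pure-equation n α x = trans (eval-+ₚ (monomial (p ℕ.^ n)) (- φ n α ∷ []) x)
        (+-cong (eval-monomial (p ℕ.^ n) x) (trans (+-congˡ (zeroʳ x)) (+-identityʳ _)))

      pure-equation-∈ : ∀ E n → φ n α ∈ₛ E → pure-equation n α ∈[X] E
      pure-equation-∈ E n φα∈ = +ₚ-∈ E (monomial-∈ E (p ℕ.^ n)) (Subfield.neg-closed E φα∈ ∷ [])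

    frobenius-descent : Algebraic E α → ∀ n → φ n α ∈ₛ E → ∀ h → h ∈[X] E → eval h α ≈ 0# → NoMultipleRoots h → α ∈ₛ E
    frobenius-descent {E} {α} alg n φα∈ h h∈ hα≈0 simple =
      descend (minPoly-∣ m h∈ hα≈0) (minPoly-∣ m (pure-equation-∈ E n φα∈) (trans (eval-pure-equation n α α) (-‿inverseʳ (φ n α))))
      where
      m : MinPoly E α
      m = minPoly alg
      descend : (∃[ s ] s ∈[X] E × h ≗ s *ₚ MinPoly.poly m) → (∃[ t ] t ∈[X] E × pure-equation n α ≗ t *ₚ MinPoly.poly m) → α ∈ₛ E
      descend (s , _ , h≗sm) (t , _ , f≗tm) = unique-root⇒∈ closed m (noMultipleRoots-∣ s h≗sm simple) λ {β} β-root →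
        φ-injective n (x∙y⁻¹≈ε⇒x≈y (φ n β) (φ n α) (trans (sym (eval-pure-equation n α β))
          (∣-root m {pure-equation n α} {MinPoly.poly m} t f≗tm β-root)))

    -- φ n α and φ n γ are again conjugate: g(X^(pⁿ)) lies over E and vanishes at α, hence at γ.
    conjugate-φ-root : MinPoly E α → f ∈[X] E → IrreducibleOver E f → eval f α ≈ 0# → eval f γ ≈ 0# →
                       ∀ n → g ∈[X] E → eval g (φ n α) ≈ 0# → eval g (φ n γ) ≈ 0#
    conjugate-φ-root {E} {α} {f} {γ} {g} m f∈ irr fα≈0 fγ≈0 n g∈ gφα≈0 = trans (sym (eval-inflate (p ℕ.^ n) g γ))
      (conjugate-root m f∈ irr fα≈0 fγ≈0 (inflate-∈ E (p ℕ.^ n) g∈) (trans (eval-inflate (p ℕ.^ n) g α) gφα≈0))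

    span-φ : ∀ n → Span E vs x → Span E (map (φ n) vs) (φ n x)
    span-φ n (none x≈0) = none (trans (φ-cong n x≈0) (φ-0 n))
    span-φ {E} n (plus {k = k} k∈ s x≈) = plus (φ-∈ E n k∈) (span-φ n s)
      (trans (φ-cong n x≈) (trans (φ-+ n _ _) (+-congʳ (φ-* n k _))))

    -- Turns linear relations between powers into polynomial equations; the first term a is general
    -- because the induction multiplies it by x.
    combination-powers : ∀ n ks a x d → length ks ≤ d → combination ks (map (φ n) (powers a x d)) ≈ φ n a * eval ks (φ n x)
    combination-powers n []       a x d       len       = sym (zeroʳ _)
    combination-powers n (k ∷ ks) a x (suc d) (s≤s len) = begin
      k * φ n a + combination ks (map (φ n) (powers (a * x) x d))   ≈⟨ +-congˡ (combination-powers n ks (a * x) x d len) ⟩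
      k * φ n a + φ n (a * x) * eval ks (φ n x)                     ≈⟨ +-congˡ (*-congʳ (φ-* n a x)) ⟩
      k * φ n a + (φ n a * φ n x) * eval ks (φ n x)                 ≈⟨ solve 4 (λ k a x e → k :* a :+ (a :* x) :* e := a :* (k :+ x :* e)) refl k (φ n a) (φ n x) (eval ks (φ n x)) ⟩
      φ n a * (k + φ n x * eval ks (φ n x))                         ∎

    module _ {E M : Subfield} (algebraic : ∀ β → Algebraic E β) (E⊑M : E ⊑ M) {d : ℕ} (B : Basis E M d)
             (us : List Carrier) (us∈ : All (_∈ₛ M) us) (φ-spanning : ∀ {x} → x ∈ₛ M → Span E (map (φ 1) us) x) where

      -- Each φ 1 u is in the span of the φ 1 w, so spanning by p-th powers carries over from us to
      -- every spanning list.
      φ-spanning-any : (∀ {x} → x ∈ₛ M → Span E ws x) → x ∈ₛ M → Span E (map (φ 1) ws) x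
      φ-spanning-any sp x∈ = span-⊆ (All.map⁺ (All.map (λ u∈ → span-φ 1 (sp u∈)) us∈)) (φ-spanning x∈)

      -- Complete ws to a spanning list of d vectors. The p-th powers of these are again d vectors
      -- that span M, hence independent, and those of ws form the end of the list.
      φ-independent : Independent E ws → All (_∈ₛ M) ws → Independent E (map (φ 1) ws)
      φ-independent {ws} ind ws∈ with exchange {P = _∈ₛ M} ind (inside B) (All.map (spanning B) ws∈)
      ... | zs , len , zs∈ , ⊆ = independent-++ʳ (map (φ 1) zs) (≡.subst (Independent E) (map-++ (φ 1) zs ws)
        (spanning⇒independent B (All.map⁺ (All.map (φ-∈ M 1) (All.++⁺ zs∈ ws∈)))
          (φ-spanning-any (λ x∈ → ⊆ (spanning B x∈)))
          (ℕ.≤-reflexive (≡.trans (length-map (φ 1) (zs ++ ws)) (≡.trans (length-++ zs)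
            (≡.trans (ℕ.+-comm (length zs) (length ws)) (≡.trans len (size B))))))))

      module _ {α} (α∈ : α ∈ₛ M) (m : MinPoly E α) where

        open MinPoly m

        powers-independent : Independent E (powers 1# α degree)
        powers-independent = coefficients-independent λ {ks} ks∈ len eq → ≗[]⇒All (minimal ks∈
          (ℕ.≤-reflexive (≡.trans len (length-powers 1# α degree)))
          (trans (eval-point ks (sym (*-identityʳ α))) (trans (sym (trans (*-congʳ (*-identityʳ 1#)) (*-identityˡ _)))
            (trans (sym (combination-powers 0 ks 1# α degree (ℕ.≤-reflexive (≡.trans len (length-powers 1# α degree)))))
              (trans (combination-map-φ0 ks (powers 1# α degree)) eq)))))
          where
          combination-map-φ0 : ∀ ks vs → combination ks (map (φ 0) vs) ≈ combination ks vs
          combination-map-φ0 []       vs       = refl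
          combination-map-φ0 (k ∷ ks) []       = refl
          combination-map-φ0 (k ∷ ks) (w ∷ vs) = +-cong (*-congˡ (*-identityʳ w)) (combination-map-φ0 ks vs)

        -- Passing to the p-th power does not lower the degree: the p-th powers of 1, α, ..., αᵈ⁻¹
        -- remain independent.
        φ-degree : f ∈[X] E → length f ≤ degree → eval f (φ 1 α) ≈ 0# → f ≗ []
        φ-degree {f} f∈ len fφα≈0 = All⇒≗[] (independent-coefficients
          (φ-independent powers-independent (powers-∈ M degree (Subfield.1-closed M) α∈)) f∈
          (≡.subst (length f ≤_) (≡.sym (≡.trans (length-map (φ 1) (powers 1# α degree)) (length-powers 1# α degree))) len)
          (trans (combination-powers 1 f 1# α degree len) (trans (*-congˡ fφα≈0) (zeroʳ _))))

        degree≢0 : degree ≢ 0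
        degree≢0 eq = go lower eq root
          where
          go : ∀ ks → length ks ≡ 0 → ¬ eval (ks ∷ʳ 1#) α ≈ 0#
          go [] _ root = 1≉0 (trans (sym (trans (+-congˡ (zeroʳ α)) (+-identityʳ 1#))) root)

        -- If the derivative vanishes, n · (coefficient n) = 0 for every n. In characteristic 0 this
        -- fails at the leading coefficient. Otherwise `poly` is g(X^p) with g of smaller degree,
        -- and g(αᵖ) = 0 forces g = 0 by `φ-degree`, although its leading coefficient is 1.
        derivative≉[] : ¬ D poly ≗ []
        derivative≉[] D≗[] = go charExp
          where
          vanish : ∀ n → n · coeff poly n ≈ 0#
          vanish zero    = refl
          vanish (suc n) = trans (sym (coeff-D poly n)) (coeffs D≗[] n)
          degree·1≈0 : degree · 1# ≈ 0#
          degree·1≈0 = trans (×-congʳ degree (reflexive (≡.sym (coeff-monic lower)))) (vanish degree)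
          go : ¬ IsCharacteristicExponent p
          go (char-0 n≉0) with degree in eq
          ... | zero  = degree≢0 eq
          ... | suc n = n≉0 n (≡.subst (λ k → k · 1# ≈ 0#) eq degree·1≈0)
          go (char-p pr p·1≈0) with prime⇒nonTrivial pr
          ... | nonTrivial = go-p p ≡.refl nonTrivial
            where
            go-p : ∀ p′ → p ≡ p′ → ¬ ℕ.NonTrivial p′
            -- The decimation modulus is p, written as the successor of `suc q`; having p ≥ 2 is
            -- what shortens `poly`.
            go-p (suc (suc q)) ≡.refl _ = 1≉0 (coefficient (characteristic-∣ pr p·1≈0 degree degree·1≈0))
              where
              open Decimation (suc q) using (decimate; Sparse; eval-decimate; coeff-decimate; decimate-∈)
              sparse : Sparse 0 poly
              sparse n n≢ with zero-product (trans (×-assoc-* n 1# (coeff poly n)) (trans (×-congʳ n (*-identityˡ _)) (vanish n)))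
              ... | inj₂ c≈0   = c≈0
              ... | inj₁ n·1≈0 with divides j eq ← characteristic-∣ pr p·1≈0 n n·1≈0 = contradiction eq (n≢ j)
              bound : ∀ ks → length ks ≢ 0 → length (decimate 0 (ks ∷ʳ 1#)) ≤ length ks
              bound []           ≢0 = contradiction ≡.refl ≢0
              bound (k ∷ [])     ≢0 = length-decimate-< q k 1# []
              bound (k ∷ l ∷ ks) ≢0 = ≡.subst (length (decimate 0 (k ∷ l ∷ ks ∷ʳ 1#)) ≤_) (≡.cong suc (length-∷ʳ ks 1#))
                (length-decimate-< q k l (ks ∷ʳ 1#))
              decimate≗[] : decimate 0 poly ≗ []
              decimate≗[] = φ-degree (decimate-∈ {E = E} 0 poly∈) (bound lower degree≢0) (begin
                eval (decimate 0 poly) (φ 1 α)          ≈⟨ eval-point (decimate 0 poly) (^-congʳ α (ℕ.*-identityʳ p)) ⟩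
                eval (decimate 0 poly) (α ^ p)          ≈⟨ *-identityˡ _ ⟨
                1# * eval (decimate 0 poly) (α ^ p)     ≈⟨ eval-decimate 0 poly α sparse ⟨
                eval poly α                             ≈⟨ root ⟩
                0#                                      ∎)
              coefficient : p ∣ degree → 1# ≈ 0#
              coefficient (divides j eq) = begin
                1#                          ≡⟨ coeff-monic lower ⟨
                coeff poly degree           ≡⟨ ≡.cong (coeff poly) eq ⟩
                coeff poly (j ℕ.* p)        ≡⟨ coeff-decimate 0 poly j ⟨
                coeff (decimate 0 poly) j   ≈⟨ coeffs decimate≗[] j ⟩
                0#                          ∎

        -- At a multiple root β both `poly` and its derivative vanish. As α and β are roots of the
        -- same irreducible polynomial, the derivative also vanishes at α, and being of lower degree
        -- it is zero.
        separable-criterion : NoMultipleRoots poly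
        separable-criterion β s²∣m = derivative≉[] (minimal-coeffs m {D poly} D∈ beyond D-root)
          where
          ·-0 : ∀ n {x} → x ≈ 0# → n · x ≈ 0#
          ·-0 zero    x≈0 = refl
          ·-0 (suc n) x≈0 = trans (+-cong x≈0 (·-0 n x≈0)) (+-identityˡ 0#)
          beyond : ∀ n → degree ≤ n → coeff (D poly) n ≈ 0#
          beyond n d≤n = trans (coeff-D poly n) (·-0 (suc n) (reflexive
            (coeff-beyond poly (suc n) (≡.subst (_≤ suc n) (≡.sym (length-∷ʳ lower 1#)) (s≤s d≤n)))))
          D∈ : D poly ∈[X] E
          D∈ = D-∈ E poly∈
          D-root : eval (D poly) α ≈ 0#
          D-root = conjugate-root (minPoly {E} {β} (algebraic β)) {poly} {α} {D poly} poly∈ (minPoly-irreducible m)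
            (proj₁ (square-∣⇒roots poly s²∣m)) root D∈ (proj₂ (square-∣⇒roots poly s²∣m))

-- Finite extensions inside the algebraic closure

module Extensions (em : ∀ {a : Level} → ExcludedMiddle a)
  {c ℓ₁ ℓ₂ : Level} (K̄ : HeytingField c ℓ₁ ℓ₂) where

  open FrobeniusMethods em K̄ public
  open Relation.Binary.Reasoning.Setoid setoid
  open Basis

  private
    variable
      E K L M : Subfield
      x y α β γ : Carrier
      f g h : Poly
      us vs ws : List Carrier

    v : Level
    v = c ⊔ ℓ₁ ⊔ ℓ₂

  ∈[X]-mono : E ⊑ M → f ∈[X] E → f ∈[X] M
  ∈[X]-mono E⊑M = All.map (λ a∈ → E⊑M a∈)

  coeffs-∈ : ∀ f → (∀ n → coeff f n ∈ₛ E) → f ∈[X] E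
  coeffs-∈         []      h = []
  coeffs-∈ {E = E} (a ∷ f) h = h 0 ∷ coeffs-∈ {E = E} f (h ∘ suc)

  X-‿∈ : ∀ E → α ∈ₛ E → (X- α) ∈[X] E
  X-‿∈ E α∈ = Subfield.neg-closed E α∈ ∷ Subfield.1-closed E ∷ []

  ∏X-∈ : ∀ E {αs} → All (_∈ₛ E) αs → ∏X- αs ∈[X] E
  ∏X-∈ E []         = Subfield.1-closed E ∷ []
  ∏X-∈ E (α∈ ∷ αs∈) = *ₚ-∈ E (X-‿∈ E α∈) (∏X-∈ E αs∈)

  algebraic-over : K ⊑ E → AlgebraicOver K α → Algebraic E α
  algebraic-over {K} K⊑E (f , (n , fn≉0) , fα≈0) = embed K f , All.map (λ a∈ → K⊑E a∈) (embed-∈ K f)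
    , (λ f≗[] → fn≉0 (≡.subst (_≈ 0#) (≡.sym (embed-coeff K f n)) (coeffs f≗[] n))) , fα≈0

  infixr 7 _⊓_
  _⊓_ : Subfield → Subfield → Subfield
  E ⊓ M = record
    { member     = λ x → x ∈ₛ E × x ∈ₛ M
    ; ≈-closed   = λ eq (p , q) → E.≈-closed eq p , M.≈-closed eq q
    ; 0-closed   = E.0-closed , M.0-closed
    ; 1-closed   = E.1-closed , M.1-closed
    ; +-closed   = λ (p , q) (p′ , q′) → E.+-closed p p′ , M.+-closed q q′
    ; *-closed   = λ (p , q) (p′ , q′) → E.*-closed p p′ , M.*-closed q q′
    ; neg-closed = λ (p , q) → E.neg-closed p , M.neg-closed q
    ; inv-closed = λ eq (p , q) → E.inv-closed eq p , M.inv-closed eq q }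
    where
    module E = Subfield E
    module M = Subfield M

  basis-≋ : ∀ {n} → L ⊑ M → M ⊑ L → Basis K L n → Basis K M n
  basis-≋ L⊑M M⊑L B = record
    { vectors = vectors B ; size = size B ; inside = All.map (λ x∈ → L⊑M x∈) (inside B)
    ; spanning = λ x∈ → spanning B (M⊑L x∈) ; independent = independent B }

  eval-zeros : ∀ k x → eval (replicate k 0# ∷ʳ 1#) x ≈ x ^ k
  eval-zeros zero    x = trans (+-congˡ (zeroʳ x)) (+-identityʳ 1#)
  eval-zeros (suc k) x = trans (+-identityˡ _) (*-congˡ (eval-zeros k x))

  module Closure (K : Subfield) (closure : IsAlgebraicClosureOf K) {p : ℕ} (charExp : IsCharacteristicExponent p) where

    closed : AlgebraicallyClosed
    closed = proj₁ closure

    open FrobeniusDescent closed charExp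

    algebraic : K ⊑ E → ∀ α → Algebraic E α
    algebraic {E} K⊑E α = algebraic-over {K} {E} K⊑E (proj₂ closure α)

    minPoly-K : ∀ α → MinPoly K α
    minPoly-K α = minPoly (algebraic {K} id α)

    conjugate : (f : K [X]) → Over.Irreducible K f → IsRootOf K α f → IsRootOf K γ f → eval (MinPoly.poly (minPoly-K α)) γ ≈ 0#
    conjugate {α} {γ} f irr fα≈0 fγ≈0 = conjugate-root (minPoly-K α) {embed K f} {γ} {MinPoly.poly (minPoly-K α)}
      (embed-∈ K f) (irreducible-embed K f irr) fα≈0 fγ≈0 (MinPoly.poly∈ (minPoly-K α)) (MinPoly.root (minPoly-K α))

    irreducible-≉[] : (f : K [X]) → Over.Irreducible K f → IsRootOf K α f → ¬ embed K f ≗ []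
    irreducible-≉[] {α} f irr fα≈0 f≗[] = nonzero (irreducible-∣-minPoly m {embed K f} (embed-∈ K f) (irreducible-embed K f irr) fα≈0)
      where
      m : MinPoly K α
      m = minPoly-K α
      nonzero : ¬ (∃[ t ] MinPoly.poly m ≗ t *ₚ embed K f)
      nonzero (t , m≗tf) = monic-≉[] (MinPoly.lower m) (≗-trans m≗tf (≗-trans (*ₚ-congˡ t f≗[]) (*ₚ-zeroʳ t)))

    roots⇒normal : K ⊑ M → (∀ (f : K [X]) → Over.Irreducible K f → ∀ {α γ} → α ∈ₛ M → IsRootOf K α f → IsRootOf K γ f → γ ∈ₛ M) →
                   Normal K M
    roots⇒normal {M} K⊑M roots f irr {α} α∈ fα≈0 =
      splits closed {K} {M} {embed K f} K⊑M (embed-∈ K f) (irreducible-≉[] f irr fα≈0) (λ {γ} fγ≈0 → roots f irr {α} {γ} α∈ fα≈0 fγ≈0)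

    -- With pⁿ = k + 1, a preimage is a root of X^(k+1) - β, whose list is -β, then k zeros, then 1.
    φ-surjective : ∀ n β → ∃[ α ] φ n α ≈ β
    φ-surjective n β with k , eq ← exponent-positive n with α , root ← monic-root closed (- β) (replicate k 0#) =
      α , trans (^-congʳ α eq) (trans (*-congˡ (sym (eval-zeros k α)))
            (sym (trans (sym (-‿involutive β)) (sym (+-inverseʳ-unique (- β) _ root)))))

    φ-raise : ∀ E k n → φ n x ∈ₛ E → φ (k ℕ.+ n) x ∈ₛ E
    φ-raise {x} E k n φx∈ = Subfield.≈-closed E (sym (φ-∘ k n x)) (φ-∈ E k φx∈)

    φ-raiseʳ : ∀ E n k → φ n x ∈ₛ E → φ (n ℕ.+ k) x ∈ₛ E
    φ-raiseʳ {x} E n k φx∈ = ≡.subst (λ j → φ j x ∈ₛ E) (ℕ.+-comm k n) (φ-raise E k n φx∈)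

    -- The purely inseparable closure of E in K̄. Two exponents are merged by adding them, since
    -- applying φ keeps elements of E in E.
    rootClosure : Subfield → Subfield
    rootClosure E = record
      { member     = λ x → ∃[ n ] φ n x ∈ₛ E
      ; ≈-closed   = λ eq (n , x∈) → n , ≈-closed (φ-cong n eq) x∈
      ; 0-closed   = 0 , ≈-closed (sym (φ-0 0)) 0-closed
      ; 1-closed   = 0 , ≈-closed (sym (φ-1 0)) 1-closed
      ; +-closed   = λ {x} {y} (m , x∈) (n , y∈) → m ℕ.+ n ,
          ≈-closed (sym (φ-+ (m ℕ.+ n) x y)) (+-closed (φ-raiseʳ E m n x∈) (φ-raise E m n y∈))
      ; *-closed   = λ {x} {y} (m , x∈) (n , y∈) → m ℕ.+ n ,
          ≈-closed (sym (φ-* (m ℕ.+ n) x y)) (*-closed (φ-raiseʳ E m n x∈) (φ-raise E m n y∈))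
      ; neg-closed = λ {x} (n , x∈) → n , ≈-closed (sym (φ-neg n x)) (neg-closed x∈)
      ; inv-closed = λ {x} {y} eq (n , x∈) → n , inv-closed (trans (sym (φ-* n x y)) (trans (φ-cong n eq) (φ-1 n))) x∈ }
      where open Subfield E

    rootClosure-⊒ : E ⊑ rootClosure E
    rootClosure-⊒ {E} x∈ = 0 , Subfield.≈-closed E (sym (*-identityʳ _)) x∈

    common-exponent : All (_∈ₛ rootClosure E) f → ∃[ n ] mapφ n f ∈[X] E
    common-exponent [] = 0 , []
    common-exponent {E} ((m , a∈) ∷ f∈) with n , φf∈ ← common-exponent {E} f∈ =
      m ℕ.+ n , φ-raiseʳ E m n a∈ ∷ All.map⁺ (All.map (φ-raise E m n) (All.map⁻ φf∈))

    mapφ-raise : ∀ E k n → mapφ n f ∈[X] E → mapφ (k ℕ.+ n) f ∈[X] E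
    mapφ-raise E k n φf∈ = All.map⁺ (All.map (φ-raise E k n) (All.map⁻ φf∈))

    -- The K-spans of the pⁿ-th powers of a finite extension

    module FrobeniusSpan {M : Subfield} (K⊑M : K ⊑ M) {d : ℕ} (B : Basis K M d) where

      φ-vectors : ℕ → List Carrier
      φ-vectors n = map (φ n) (vectors B)

      φ-spanned : ∀ n → x ∈ₛ M → Span K (φ-vectors n) (φ n x)
      φ-spanned n x∈ = span-φ n (spanning B x∈)

      φ-vectors-∈ : ∀ n → All (_∈ₛ M) (φ-vectors n)
      φ-vectors-∈ n = All.map⁺ (All.map (φ-∈ M n) (inside B))

      -- The power is y^(pⁿ) itself; this feeds the inverse condition of `spanField`.
      φ-power : ∀ n {y} → y ∈ₛ M → ∃[ k ] Span K (φ-vectors n) (y ^ suc k)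
      φ-power n {y} y∈ with k , eq ← exponent-positive n =
        k , ≡.subst (λ j → Span K (φ-vectors n) (y ^ j)) eq (φ-spanned n y∈)

      one∈ : ∀ n → Span K (φ-vectors n) 1#
      one∈ n = span-resp (φ-1 n) (φ-spanned n (Subfield.1-closed M))

      products∈ : ∀ n → All (λ u → All (λ w → Span K (φ-vectors n) (u * w)) (φ-vectors n)) (φ-vectors n)
      products∈ n = All.map⁺ (All.map (λ {b} b∈ → All.map⁺ (All.map (λ {b′} b′∈ →
        span-resp (φ-* n b b′) (φ-spanned n (Subfield.*-closed M b∈ b′∈))) (inside B))) (inside B))

      inverse-power∈ : ∀ n {x y} → Span K (φ-vectors n) x → x * y ≈ 1# → ∃[ k ] Span K (φ-vectors n) (y ^ suc k)
      inverse-power∈ n x∈ xy≈1 = φ-power n (Subfield.inv-closed M xy≈1 (span-⊑ {K} {M} K⊑M (φ-vectors-∈ n) x∈))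

      frobeniusSpan : ℕ → Subfield
      frobeniusSpan n = spanField K (φ-vectors n) (one∈ n) (products∈ n) (inverse-power∈ n)

      to : ∀ n → Span K (φ-vectors n) x → x ∈ₛ frobeniusSpan n
      to n = span⇒∈ K (φ-vectors n) (one∈ n) (products∈ n) (inverse-power∈ n)

      from : ∀ n → x ∈ₛ frobeniusSpan n → Span K (φ-vectors n) x
      from n = ∈⇒span K (φ-vectors n) (one∈ n) (products∈ n) (inverse-power∈ n)

      K⊑frobeniusSpan : ∀ n → K ⊑ frobeniusSpan n
      K⊑frobeniusSpan n = spanField-⊒ K (φ-vectors n) (one∈ n) (products∈ n) (inverse-power∈ n)

      frobeniusSpan⊑ : ∀ n → frobeniusSpan n ⊑ M
      frobeniusSpan⊑ n x∈ = span-⊑ {K} {M} K⊑M (φ-vectors-∈ n) (from n x∈)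

      φ-∈-frobeniusSpan : ∀ n → x ∈ₛ M → φ n x ∈ₛ frobeniusSpan n
      φ-∈-frobeniusSpan n x∈ = to n (φ-spanned n x∈)

      frobeniusSpan-suc : ∀ n → frobeniusSpan (suc n) ⊑ frobeniusSpan n
      frobeniusSpan-suc n x∈ = to n (span-⊆ (All.map⁺ (All.map (λ {b} b∈ →
        span-resp (sym (φ-suc n b)) (φ-spanned n (^-closed M p b∈))) (inside B))) (from (suc n) x∈))

      -- Take n for which the degree of the span is least: the next span lies inside and has no
      -- smaller degree.
      stabilises : ∃[ n ] frobeniusSpan n ⊑ frobeniusSpan (suc n)
      stabilises = smallest (let d₀ , B₀ = basis 0 in least (λ e → ∃[ n ] Basis K (frobeniusSpan n) e) d₀ (0 , B₀))
        where
        basis : ∀ n → ∃[ e ] Basis K (frobeniusSpan n) e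
        basis n = subfield-basis {frobeniusSpan n} {M} (frobeniusSpan⊑ n) B
        smallest : (∃[ e ] (∃[ n ] Basis K (frobeniusSpan n) e) × (∀ k → k < e → ¬ (∃[ n ] Basis K (frobeniusSpan n) k))) →
                   ∃[ n ] frobeniusSpan n ⊑ frobeniusSpan (suc n)
        smallest (e , (n , Bₙ) , minimal) with e′ , Bₙ₊₁ ← basis (suc n) =
          n , full-dimension⇒⊒ {K} {frobeniusSpan (suc n)} {frobeniusSpan n} (K⊑frobeniusSpan (suc n)) (frobeniusSpan-suc n) Bₙ₊₁ Bₙ
                (ℕ.≮⇒≥ (λ e′<e → minimal e′ e′<e (suc n , Bₙ₊₁)))

      -- φ n x lies in the span and x is a root of a polynomial over K without multiple roots, so
      -- descent applies. A basis of a separable extension therefore keeps spanning, and stays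
      -- independent, under φ n.
      separable⇒⊑ : Separable K M → ∀ n → M ⊑ frobeniusSpan n
      separable⇒⊑ separable n {x} x∈ = descend (separable x∈)
        where
        descend : SeparableOver K x → x ∈ₛ frobeniusSpan n
        descend (f , (_ , _ , fx≈0) , simple) =
          frobenius-descent {frobeniusSpan n} (algebraic {frobeniusSpan n} (K⊑frobeniusSpan n) x) n (φ-∈-frobeniusSpan n x∈)
            (embed K f) (∈[X]-mono {K} {frobeniusSpan n} (K⊑frobeniusSpan n) (embed-∈ K f)) fx≈0 simple

      separable-spanning : Separable K M → ∀ n → x ∈ₛ M → Span K (φ-vectors n) x
      separable-spanning separable n x∈ = from n (separable⇒⊑ separable n x∈)

      φ-vectors-independent : Separable K M → ∀ n → Independent K (φ-vectors n)
      φ-vectors-independent separable n = spanning⇒independent B (φ-vectors-∈ n) (separable-spanning separable n)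
        (ℕ.≤-reflexive (≡.trans (length-map (φ n) (vectors B)) (size B)))

      module _ (n : ℕ) (stable : frobeniusSpan n ⊑ frobeniusSpan (suc n)) where

        private
          S : Subfield
          S = frobeniusSpan n

        φ-vectors-suc : All (Span K (map (φ 1) (φ-vectors n))) (φ-vectors (suc n))
        φ-vectors-suc = All.map⁺ (All.map (λ {b} → span-resp (sym (φ-∘ 1 n b)))
          (All.map⁻ (All.map⁻ (span-self (map (φ 1) (φ-vectors n))))))

        -- Stability says that S is spanned by the p-th powers of its own spanning vectors, the
        -- hypothesis of MacLane's criterion.
        stable⇒simple : x ∈ₛ S → (m : MinPoly K x) → NoMultipleRoots (MinPoly.poly m)
        stable⇒simple x∈ m = separable-criterion {K} {S} (algebraic {K} id) (K⊑frobeniusSpan n)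
          (proj₂ (subfield-basis {S} {M} (frobeniusSpan⊑ n) B)) (φ-vectors n) (All.map (to n) (span-self (φ-vectors n)))
          (λ y∈ → span-⊆ φ-vectors-suc (from (suc n) (stable y∈))) x∈ m

        stable⇒separable : Separable K S
        stable⇒separable {x} x∈ = minPoly-separable (minPoly-K x) (stable⇒simple x∈ (minPoly-K x))

        -- A conjugate γ of an element of S lies in M, so φ n γ lies in S; the minimal polynomial
        -- over K that γ satisfies has no multiple roots.
        stable⇒normal : Normal K M → Normal K S
        stable⇒normal normal = roots⇒normal {S} (K⊑frobeniusSpan n) λ f irr {α} {γ} α∈ fα≈0 fγ≈0 →
          let m = minPoly-K α
              mγ≈0 = conjugate f irr fα≈0 fγ≈0 in
          frobenius-descent {S} (algebraic {S} (K⊑frobeniusSpan n) γ) n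
            (φ-∈-frobeniusSpan n (normal-root {K} {M} normal (frobeniusSpan⊑ n α∈) m mγ≈0))
            (MinPoly.poly m) (∈[X]-mono {K} {S} (K⊑frobeniusSpan n) (MinPoly.poly∈ m)) mγ≈0 (stable⇒simple α∈ m)

    -- Composite of a separable and a purely inseparable extension

    module Composite {E I : Subfield} (K⊑E : K ⊑ E) (K⊑I : K ⊑ I) (I-pure : I ⊑ rootClosure K)
                     (separable : Separable K E) {d : ℕ} (B : Basis K E d) where

      open FrobeniusSpan {E} K⊑E B

      E⊑EI : E ⊑ E ∙ I
      E⊑EI x∈ = gen (inj₁ x∈)

      I⊑EI : I ⊑ E ∙ I
      I⊑EI x∈ = gen (inj₂ x∈)

      K⊑EI : K ⊑ E ∙ I
      K⊑EI x∈ = E⊑EI (K⊑E x∈)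

      I⊑rootClosure : I ⊑ rootClosure E
      I⊑rootClosure x∈ with n , φx∈ ← I-pure x∈ = n , K⊑E φx∈

      span-pure : Span I (vectors B) x → x ∈ₛ rootClosure E
      span-pure = span-⊑ {I} {rootClosure E} I⊑rootClosure (All.map (rootClosure-⊒ {E}) (inside B))

      -- The I-span is not yet known to be a field, but φ n x lies in the field E for some n, and
      -- its inverse there is φ n y.
      inverse-power : ∀ {x y} → Span I (vectors B) x → x * y ≈ 1# → ∃[ k ] Span I (vectors B) (y ^ suc k)
      inverse-power {x} {y} x∈ xy≈1 with n , φx∈ ← span-pure x∈ with k , eq ← exponent-positive n =
        k , ≡.subst (λ j → Span I (vectors B) (y ^ j)) eq (span-base {K} {I} K⊑I (spanning B
          (Subfield.inv-closed E (trans (sym (φ-* n x y)) (trans (φ-cong n xy≈1) (φ-1 n))) φx∈)))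

      one-spanned : Span I (vectors B) 1#
      one-spanned = span-base {K} {I} K⊑I (spanning B (Subfield.1-closed E))

      products-spanned : All (λ u → All (λ w → Span I (vectors B) (u * w)) (vectors B)) (vectors B)
      products-spanned = All.map (λ b∈ → All.map (λ b′∈ →
        span-base {K} {I} K⊑I (spanning B (Subfield.*-closed E b∈ b′∈))) (inside B)) (inside B)

      compositeSpan : Subfield
      compositeSpan = spanField I (vectors B) one-spanned products-spanned inverse-power

      -- The I-span of a K-basis of E is a field containing both E and I, hence contains the
      -- composite.
      composite-spanning : x ∈ₛ E ∙ I → Span I (vectors B) x
      composite-spanning x∈ = ∈⇒span I (vectors B) one-spanned products-spanned inverse-power
        (generated-⊑ {E} {I} compositeSpan
          (λ y∈ → span⇒∈ I (vectors B) one-spanned products-spanned inverse-power (span-base {K} {I} K⊑I (spanning B y∈)))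
          (spanField-⊒ I (vectors B) one-spanned products-spanned inverse-power) x∈)

      EI⊑rootClosure : E ∙ I ⊑ rootClosure E
      EI⊑rootClosure = generated-⊑ {E} {I} (rootClosure E) (rootClosure-⊒ {E}) I⊑rootClosure

      -- A sufficiently high φ carries the finitely many coefficients from I into K; the exponent of
      -- the head coefficient is added to that of the rest.
      span-φ-pure : ∀ vs → Span I vs x → ∃[ n ] Span K (map (φ n) vs) (φ n x)
      span-φ-pure [] (none x≈0) = 0 , none (trans (φ-cong 0 x≈0) (φ-0 0))
      span-φ-pure (w ∷ vs) (plus {y = y} {k = k} k∈ s x≈) with m , φk∈ ← I-pure k∈ with n , φs ← span-φ-pure vs s =
        m ℕ.+ n , plus (φ-raiseʳ K m n φk∈)
          (span-resp (sym (φ-∘ m n y)) (span-⊆ (All.map⁺ (All.map⁺ (All.map (λ {z} → span-resp (φ-∘ m n z))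
            (All.map⁻ (span-self (map (φ (m ℕ.+ n)) vs)))))) (span-φ m φs)))
          (trans (φ-cong (m ℕ.+ n) x≈) (trans (φ-+ (m ℕ.+ n) (k * w) y) (+-congʳ (φ-* (m ℕ.+ n) k w))))

      -- Linear disjointness: a dependence over I becomes, under some φ n, a dependence over K
      -- between the images.
      pure-independent : ∀ vs → (∀ n → Independent K (map (φ n) vs)) → Independent I vs
      pure-independent []       ind = []
      pure-independent (w ∷ vs) ind = w∉ ∷ pure-independent vs (independent-tail ∘ ind)
        where
        w∉ : ¬ Span I vs w
        w∉ s with n , φs ← span-φ-pure vs s with φw∉ ∷ _ ← ind n = φw∉ φs

      compositeBasis : Basis I (E ∙ I) d
      compositeBasis = record
        { vectors = vectors B ; size = size B ; inside = All.map (λ x∈ → E⊑EI x∈) (inside B) ; spanning = composite-spanning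
        ; independent = pure-independent (vectors B) (φ-vectors-independent separable) }

      -- Since E is separable, the p-th powers of its basis span E over K, and thereby the composite
      -- over I; MacLane's criterion applies with base I.
      simple-over-I : x ∈ₛ E ∙ I → (m : MinPoly I x) → NoMultipleRoots (MinPoly.poly m)
      simple-over-I x∈ m = separable-criterion {I} {E ∙ I} (algebraic {I} K⊑I) I⊑EI compositeBasis (vectors B)
        (inside compositeBasis)
        (λ y∈ → span-⊆ (All.map (λ b∈ → span-base {K} {I} K⊑I (separable-spanning separable 1 b∈)) (inside B)) (composite-spanning y∈)) x∈ m

      composite-normal : Normal K E → Normal K (E ∙ I)
      composite-normal normal = roots⇒normal {E ∙ I} K⊑EI roots
        where
        roots : ∀ (f : K [X]) → Over.Irreducible K f → ∀ {α γ} → α ∈ₛ E ∙ I → IsRootOf K α f → IsRootOf K γ f → γ ∈ₛ E ∙ I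
        roots f irr {α} {γ} α∈ fα≈0 fγ≈0 =
          conjugate∈ (EI⊑rootClosure α∈) (common-exponent {K} (All.map (λ c∈ → I-pure c∈) (MinPoly.poly∈ m)))
          where
          m : MinPoly I α
          m = minPoly (algebraic {I} K⊑I α)
          transfer : ∀ n → g ∈[X] K → eval g (φ n α) ≈ 0# → eval g (φ n γ) ≈ 0#
          transfer {g} n = conjugate-φ-root {f = embed K f} {γ = γ} {g = g} (minPoly-K α) (embed-∈ K f) (irreducible-embed K f irr) fα≈0 fγ≈0 n
          conjugate∈ : α ∈ₛ rootClosure E → (∃[ n ] mapφ n (MinPoly.poly m) ∈[X] K) → γ ∈ₛ E ∙ I
          conjugate∈ (j , φα∈) (k , φm∈) = frobenius-descent {E ∙ I} (algebraic {E ∙ I} K⊑EI γ) n (E⊑EI φγ∈)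
            (MinPoly.poly m) (∈[X]-mono {I} {E ∙ I} I⊑EI (MinPoly.poly∈ m)) mγ≈0 (simple-over-I α∈ m)
            where
            -- The summand j brings α into E and k brings the coefficients of m into K.
            n : ℕ
            n = j ℕ.+ k
            -- The coefficients of m lie in I, so m cannot be transferred from α to γ directly; its
            -- image under φ n is over K and can, and φ n has trivial kernel.
            mγ≈0 : eval (MinPoly.poly m) γ ≈ 0#
            mγ≈0 = φ-≈0 n (trans (sym (eval-mapφ n (MinPoly.poly m) γ))
              (transfer {mapφ n (MinPoly.poly m)} n (mapφ-raise K j k φm∈)
                (trans (eval-mapφ n (MinPoly.poly m) α) (trans (φ-cong n (MinPoly.root m)) (φ-0 n)))))
            φγ∈ : φ n γ ∈ₛ E
            φγ∈ = normal-root {K} {E} normal (φ-raiseʳ E j k φα∈) (minPoly-K (φ n α))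
              (transfer {MinPoly.poly (minPoly-K (φ n α))} n (MinPoly.poly∈ (minPoly-K (φ n α))) (MinPoly.root (minPoly-K (φ n α))))

    ∏X-lift : ∀ n βs → All (λ β → ∃[ α ] α ∈ₛ M × φ n α ≈ β) βs → ∃[ αs ] All (_∈ₛ M) αs × mapφ n (∏X- αs) ≗ ∏X- βs
    ∏X-lift n [] [] = [] , [] , ∷-cong (φ-1 n) ≗-refl
    ∏X-lift {M} n (β ∷ βs) ((α , α∈ , φα≈β) ∷ lifts) with αs , αs∈ , eq ← ∏X-lift {M} n βs lifts =
      α ∷ αs , α∈ ∷ αs∈ , ≗-trans (mapφ-*ₚ n (X- α) (∏X- αs))
        (≗-trans (*ₚ-congʳ (mapφ-X- n φα≈β) (mapφ n (∏X- αs))) (*ₚ-congˡ (X- β) eq))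

    -- The minimal polynomial of φ n α divides the φ n-image of that of α. Hence a φ n-preimage of
    -- each of its roots is a conjugate of α and lies in M; h is the product of X - γ over these
    -- preimages.
    pure-factor : Normal K M → ∀ n → α ∈ₛ M → (m : MinPoly K (φ n α)) →
                  ∃[ h ] h ∈[X] M × mapφ n h ≗ MinPoly.poly m
    pure-factor {M} {α} normal n α∈ m = from (split-monic closed (length lower) lower ≡.refl preimage)
      where
      open MinPoly m
      mα : MinPoly K α
      mα = minPoly-K α
      φmα : Poly
      φmα = mapφ n (MinPoly.poly mα)
      φmα∈ : φmα ∈[X] K
      φmα∈ = All.map⁺ (All.map (φ-∈ K n) (MinPoly.poly∈ mα))
      φmα-root : eval φmα (φ n α) ≈ 0#
      φmα-root = trans (eval-mapφ n (MinPoly.poly mα) α) (trans (φ-cong n (MinPoly.root mα)) (φ-0 n))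
      preimage : ∀ β → eval poly β ≈ 0# → ∃[ γ ] γ ∈ₛ M × φ n γ ≈ β
      preimage β β-root = preroot , normal-root {K} {M} normal α∈ mα (φ-≈0 n image-root) , φ-root≈β
        where
        preroot : Carrier
        preroot = proj₁ (φ-surjective n β)
        φ-root≈β : φ n preroot ≈ β
        φ-root≈β = proj₂ (φ-surjective n β)
        divisor : ∃[ s ] s ∈[X] K × φmα ≗ s *ₚ poly
        divisor = minPoly-∣ m {φmα} φmα∈ φmα-root
        image-root : φ n (eval (MinPoly.poly mα) preroot) ≈ 0#
        image-root = trans (sym (eval-mapφ n (MinPoly.poly mα) preroot)) (trans (eval-point φmα φ-root≈β)
          (∣-root m {φmα} {poly} {β} (proj₁ divisor) (proj₂ (proj₂ divisor)) β-root))
      from : SplitMonic (λ β → ∃[ γ ] γ ∈ₛ M × φ n γ ≈ β) poly → ∃[ h ] h ∈[X] M × mapφ n h ≗ poly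
      from (βs , lifts , eq) with αs , αs∈ , eq′ ← ∏X-lift {M} n βs lifts = ∏X- αs , ∏X-∈ M αs∈ , ≗-trans eq′ (≗-sym eq)

-- The maximal normal subextension and the degree formulas

module MainProof (em : ∀ {a : Level} → ExcludedMiddle a)
  {c ℓ₁ ℓ₂ : Level} (K̄ : HeytingField c ℓ₁ ℓ₂) where

  open Extensions em K̄ public
  open Degree em
  open Basis

  normal-≋ : ∀ {K L M} → M ⊑ L → L ⊑ M → Normal K M → Normal K L
  normal-≋ M⊑L L⊑M normal f irr α∈ fα≈0 with a , αs , a∈ , αs∈ , eq ← normal f irr (L⊑M α∈) fα≈0 =
    a , αs , M⊑L a∈ , All.map (λ x∈ → M⊑L x∈) αs∈ , eq

  module Proposition (K L Lₛ Lᵢ F F' : Subfield) (closure : IsAlgebraicClosureOf K) (finite : IsFiniteExtension K L)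
                     (Lₛ-largest : IsLargest Separable K L Lₛ) (Lᵢ-largest : IsLargest PurelyInseparable K L Lᵢ)
                     (F-largest : IsLargest Galois K L F) (F'-maximal : IsNormalOfMaximumDegree K L F')
                     {p : ℕ} (charExp : IsCharacteristicExponent p) where

    open Closure K closure charExp
    open FrobeniusDescent (proj₁ closure) charExp
    private
      module Lₛ = IsLargest Lₛ-largest
      module Lᵢ = IsLargest Lᵢ-largest
      module F = IsLargest F-largest
      module F' = IsNormalOfMaximumDegree F'-maximal

    K⊑L : K ⊑ L
    K⊑L = proj₁ finite

    K⊑F : K ⊑ F
    K⊑F = proj₁ F.subextension

    F⊑L : F ⊑ L
    F⊑L = proj₂ F.subextension

    K⊑F' : K ⊑ F'
    K⊑F' = proj₁ F'.subextension

    F'⊑L : F' ⊑ L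
    F'⊑L = proj₂ F'.subextension

    K⊑Lᵢ : K ⊑ Lᵢ
    K⊑Lᵢ = proj₁ Lᵢ.subextension

    Lᵢ⊑L : Lᵢ ⊑ L
    Lᵢ⊑L = proj₂ Lᵢ.subextension

    K⊑Lₛ : K ⊑ Lₛ
    K⊑Lₛ = proj₁ Lₛ.subextension

    F⊑Lₛ : F ⊑ Lₛ
    F⊑Lₛ = Lₛ.largest F F.subextension (proj₂ F.property)

    finite-basis : ∀ M → M ⊑ L → ∃[ n ] Basis K M n
    finite-basis M M⊑L = subfield-basis {M} {L} M⊑L (fromIsBasis {K} {L} (proj₂ (proj₂ finite)))

    t i a l u : ℕ
    t = proj₁ (finite-basis F F⊑L)
    i = proj₁ (finite-basis Lᵢ Lᵢ⊑L)
    a = proj₁ (finite-basis F' F'⊑L)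
    l = proj₁ (finite-basis L id)

    F-basis : Basis K F t
    F-basis = proj₂ (finite-basis F F⊑L)

    Lᵢ-basis : Basis K Lᵢ i
    Lᵢ-basis = proj₂ (finite-basis Lᵢ Lᵢ⊑L)

    F'-basis : Basis K F' a
    F'-basis = proj₂ (finite-basis F' F'⊑L)

    L-basis : Basis K L l
    L-basis = proj₂ (finite-basis L id)

    Lₛ/F : ∃[ n ] Basis F Lₛ n
    Lₛ/F = larger-base-basis {K} {F} K⊑F (proj₂ (finite-basis Lₛ (proj₂ Lₛ.subextension)))

    u = proj₁ Lₛ/F

    -- Built through F, so that its size is u · t from the start and the second formula reduces to
    -- arithmetic.
    Lₛ-basis : Basis K Lₛ (u ℕ.* t)
    Lₛ-basis = tower {K} {F} {Lₛ} K⊑F F⊑Lₛ (proj₂ Lₛ/F) F-basis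

    Lᵢ-pure : Lᵢ ⊑ rootClosure K
    Lᵢ-pure x∈ = Lᵢ.property charExp x∈

    module FLᵢ = Composite {F} {Lᵢ} K⊑F K⊑Lᵢ Lᵢ-pure (proj₂ F.property) F-basis
    module LₛLᵢ = Composite {Lₛ} {Lᵢ} K⊑Lₛ K⊑Lᵢ Lᵢ-pure Lₛ.property Lₛ-basis

    FLᵢ-basis : Basis K (F ∙ Lᵢ) (t ℕ.* i)
    FLᵢ-basis = tower {K} {Lᵢ} {F ∙ Lᵢ} K⊑Lᵢ FLᵢ.I⊑EI FLᵢ.compositeBasis Lᵢ-basis

    LₛLᵢ-basis : Basis K (Lₛ ∙ Lᵢ) ((u ℕ.* t) ℕ.* i)
    LₛLᵢ-basis = tower {K} {Lᵢ} {Lₛ ∙ Lᵢ} K⊑Lᵢ LₛLᵢ.I⊑EI LₛLᵢ.compositeBasis Lᵢ-basis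

    FLᵢ⊑L : F ∙ Lᵢ ⊑ L
    FLᵢ⊑L = generated-⊑ {F} {Lᵢ} L F⊑L Lᵢ⊑L

    ⊓-pure : PurelyInseparable K (L ⊓ rootClosure K)
    ⊓-pure charExp′ (_ , x∈) with ≡.refl ← charExp-unique charExp charExp′ = x∈

    -- All elements of L that some φ n takes into K form one purely inseparable subextension, so
    -- maximality of `Lᵢ` absorbs them together.
    pure⊑Lᵢ : L ⊓ rootClosure K ⊑ Lᵢ
    pure⊑Lᵢ = Lᵢ.largest (L ⊓ rootClosure K) ((λ x∈ → K⊑L x∈ , rootClosure-⊒ {K} x∈) , proj₁) ⊓-pure

    open FrobeniusSpan {F'} K⊑F' F'-basis

    F'⊑FLᵢ : F' ⊑ F ∙ Lᵢ
    F'⊑FLᵢ {α} α∈ = descend stabilises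
      where
      descend : (∃[ n ] frobeniusSpan n ⊑ frobeniusSpan (suc n)) → α ∈ₛ F ∙ Lᵢ
      descend (n , stable) = conclude (pure-factor {F'} F'.normal n α∈ m)
        where
        m : MinPoly K (φ n α)
        m = minPoly-K (φ n α)
        span⊑F : frobeniusSpan n ⊑ F
        span⊑F = F.largest (frobeniusSpan n) (K⊑frobeniusSpan n , (λ x∈ → F'⊑L (frobeniusSpan⊑ n x∈)))
          (stable⇒normal n stable F'.normal , stable⇒separable n stable)
        conclude : (∃[ h ] h ∈[X] F' × mapφ n h ≗ MinPoly.poly m) → α ∈ₛ F ∙ Lᵢ
        conclude (h , h∈ , φh≗m) = frobenius-descent {F ∙ Lᵢ} (algebraic {F ∙ Lᵢ} FLᵢ.K⊑EI α) n
          (FLᵢ.E⊑EI (span⊑F (φ-∈-frobeniusSpan n α∈))) h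
          -- A coefficient of h lies in F' and so in L, and φ n takes it to a coefficient of m,
          -- which is in K.
          (coeffs-∈ {F ∙ Lᵢ} h λ k → FLᵢ.I⊑EI (pure⊑Lᵢ (F'⊑L (coeff-∈ F' h∈ k) , n ,
            Subfield.≈-closed K (sym (trans (sym (coeff-mapφ n h k)) (coeffs φh≗m k))) (coeff-∈ K (MinPoly.poly∈ m) k))))
          (φ-≈0 n (trans (sym (eval-mapφ n h α)) (trans (eval-cong (mapφ n h) (MinPoly.poly m) (φ n α) φh≗m) (MinPoly.root m))))
          (noMultipleRoots-mapφ n h φh≗m (stable⇒simple n stable (φ-∈-frobeniusSpan n α∈) m))

    -- F' is only known to have maximum degree among the normal subextensions, so the reverse
    -- inclusion is obtained by comparing dimensions.
    FLᵢ⊑F' : F ∙ Lᵢ ⊑ F'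
    FLᵢ⊑F' = full-dimension⇒⊒ {K} {F'} {F ∙ Lᵢ} K⊑F' F'⊑FLᵢ F'-basis FLᵢ-basis
      (≡.subst₂ _≤_ (degree-basis {K} {F ∙ Lᵢ} FLᵢ-basis) (degree-basis {K} {F'} F'-basis)
        (F'.maximum (F ∙ Lᵢ) (FLᵢ.K⊑EI , FLᵢ⊑L) (FLᵢ.composite-normal (proj₁ F.property))))

    degree-F' : [ F' ∶ K ] ≡ [ F ∶ K ] ℕ.* [ Lᵢ ∶ K ]
    degree-F' = ≡.trans (degree-basis {K} {F'} (basis-≋ {F ∙ Lᵢ} {F'} FLᵢ⊑F' F'⊑FLᵢ FLᵢ-basis))
      (≡.sym (≡.cong₂ ℕ._*_ (degree-basis {K} {F} F-basis) (degree-basis {K} {Lᵢ} Lᵢ-basis)))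

    degree-LₛLᵢ : [ F' ∶ K ] ℕ.* [ Lₛ ∶ F ] ≡ [ Lₛ ∙ Lᵢ ∶ K ]
    degree-LₛLᵢ = begin
      [ F' ∶ K ] ℕ.* [ Lₛ ∶ F ]                  ≡⟨ ≡.cong₂ ℕ._*_ degree-F' (degree-basis {F} {Lₛ} (proj₂ Lₛ/F)) ⟩
      [ F ∶ K ] ℕ.* [ Lᵢ ∶ K ] ℕ.* u             ≡⟨ ≡.cong (ℕ._* u) (≡.cong₂ ℕ._*_ (degree-basis {K} {F} F-basis) (degree-basis {K} {Lᵢ} Lᵢ-basis)) ⟩
      t ℕ.* i ℕ.* u                              ≡⟨ ℕ.*-comm (t ℕ.* i) u ⟩
      u ℕ.* (t ℕ.* i)                            ≡⟨ ℕ.*-assoc u t i ⟨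
      u ℕ.* t ℕ.* i                              ≡⟨ degree-basis {K} {Lₛ ∙ Lᵢ} LₛLᵢ-basis ⟨
      [ Lₛ ∙ Lᵢ ∶ K ]                            ∎
      where open ≡.≡-Reasoning

    normal⇔degree : Normal K L ⇔ [ F' ∶ K ] ≡ [ L ∶ K ]
    normal⇔degree = mk⇔
      (λ normal → ℕ.≤-antisym
        (≡.subst₂ _≤_ (≡.sym (degree-basis {K} {F'} F'-basis)) (≡.sym (degree-basis {K} {L} L-basis))
          (basis-≤ {F'} {L} F'⊑L F'-basis L-basis))
        (F'.maximum L (K⊑L , id) normal))
      (λ eq → normal-≋ {K} {L} {F'} F'⊑L (full-dimension⇒⊒ {K} {F'} {L} K⊑F' F'⊑L F'-basis L-basis
        (≡.subst₂ _≤_ (degree-basis {K} {L} L-basis) (degree-basis {K} {F'} F'-basis) (ℕ.≤-reflexive (≡.sym eq)))) F'.normal)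

open import Data.Nat.Base using (_*_)

proposition2p12 :
    (em : ∀ {a : Level} → ExcludedMiddle a) →
    {c ℓ₁ ℓ₂ : Level} (K̄ : HeytingField c ℓ₁ ℓ₂) →
    let open FieldTheory K̄
        open Degree em
    in
    (K L Lₛ Lᵢ F F' : Subfield) →
    IsAlgebraicClosureOf K →
    IsFiniteExtension K L →
    IsLargest Separable K L Lₛ →
    IsLargest PurelyInseparable K L Lᵢ →
    IsLargest Galois K L F →
    IsNormalOfMaximumDegree K L F' →
    let i = [ Lᵢ ∶ K ]
        t = [ F ∶ K ]
        u = [ Lₛ ∶ F ]
        a = [ F' ∶ K ]
    in
    (F' ≋ F ∙ Lᵢ × a ≡ t * i) ×
    (a * u ≡ [ Lₛ ∙ Lᵢ ∶ K ]) ×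
    (Normal K L ⇔ a ≡ [ L ∶ K ])
proposition2p12 em K̄ K L Lₛ Lᵢ F F' closure finite Lₛ-largest Lᵢ-largest F-largest F'-maximal =
  ((F'⊑FLᵢ , FLᵢ⊑F') , degree-F') , degree-LₛLᵢ , normal⇔degree
  where
  open MainProof em K̄
  open Proposition K L Lₛ Lᵢ F F' closure finite Lₛ-largest Lᵢ-largest F-largest F'-maximal
         (proj₂ characteristicExponent-exists)
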